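{- Let $L,H$ be functional causal models in a Markov category $\mathcal C$ with endogenous variables $V_L,V_H$. A counterfactual abstraction $L\to H$ is equivalent to a downward abstraction $(\pi,\tau)\colon(\mathrm{CF}(V_L),L)\to(\mathrm{CF}(V_H),H)$ of counterfactual queries such that $$\pi\big([Y_1|_{X_1},\dots,Y_m|_{X_m}]\big)=[\pi(Y_1)|_{\pi(X_1)},\dots,\pi(Y_m)|_{\pi(X_m)}]$$ for all subsets $X_j,Y_j\subseteq V_H$. That is, restricting $\pi$ and $\tau$ to variables gives a bijection from such downward abstractions to counterfactual abstractions $L\to H$.
   Context: **Categories.** A Markov category is a symmetric monoidal category with terminal unit $I$ in which each object has a commutative comonoid structure (copy, discard) compatible with $\otimes$. Morphisms are called channels; $f$ is deterministic if $\mathrm{copy}\circ f=(f\otimes f)\circ\mathrm{copy}$. Functors are strong symmetric monoidal, copy-preserving, with deterministic structure isomorphisms; natural transformations are monoidal with deterministic components; "epic" means all components are epic. **Functional causal models (FCMs).** An FCM $M$ in $\mathcal C$ consists of a finite acyclic directed graph on variables $V\cup U$ with $V=\{X_1,\dots,X_n\}$ (endogenous) and $U=\{U_1,\dots,U_n\}$ (exogenous), where each $U_i$ has no parents and each $X_i$ has parents $\mathrm{Pa}'(X_i)\cup\{U_i\}$ with $\mathrm{Pa}'(X_i)\subseteq V$; an object of $\mathcal C$ for each variable; a state $\lambda_i\colon I\to U_i$ for each $i$; and a deterministic channel $f_i\colon\mathrm{Pa}'(X_i)\otimes U_i\to X_i$ for each $i$. It has no inputs, and outputs $V$. A set of variables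 is also used for the list of its elements (lists of distinct variables considered up to permutation) and for the tensor of the corresponding objects. Let $\lambda=\bigotimes_i\lambda_i\colon I\to U$. Let $F$ be the deterministic part of $M$: the causal model with inputs $U$ and mechanisms $f_i$. For $X,Y\subseteq V$ let $F_{\mathrm{Do}(X)}^{Y}\colon U\otimes X\to Y$ be the channel obtained by deleting the mechanisms $f_i$ of the variables in $X$, making $X$ into inputs, wiring the remaining mechanisms together with copy maps, and outputting (copies of) the variables in $Y$, discarding everything else. **Counterfactual queries.** A query signature $Q$ is a set of objects (types) and a set of generators (queries), each with finite lists of input and output types; it freely generates a Markov category $\mathbf Q$. A model of $Q$ in $\mathcal C$ is a functor $[\![-]\!]\colon\mathbf Q\to\mathcal C$. The signature $\mathrm{CF}(V)$ has types $V$ and, for all choices of subsets $X_j,Y_j\subseteq V$, $j=1,\dots,m$, a query $[Y_1|_{X_1},\dots,Y_m|_{X_m}]$ with inputs $X_1,\dots,X_m$ and outputs $Y_1,\dots,Y_m$. An FCM $M$ with endogenous variables $V$ models it by $$[\![\,[Y_1|_{X_1},\dots,Y_m|_{X_m}]\,]\!]_M=\big(F_{\mathrm{Do}(X_1)}^{Y_1}\otimes\dots\otimes F_{\mathrm{Do}(X_m)}^{Y_m}\big)\circ\big((\mathrm{copy}^{(m)}_U\circ\lambda)\otimes\mathrm{id}_{X_1\otimes\dots\otimes X_m}\big),$$ where $\mathrm{copy}^{(m)}_U\colon U\to U^{\otimes m}$ is the $m$-fold copy and the $j$-th copy of $U$ together with $X_j$ is fed (after permuting wires) into the $j$-th factor.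 **Downward abstraction** $(\pi,\tau)\colon(Q_L,L)\to(Q_H,H)$: a functor $\pi\colon\mathbf Q_H\to\mathbf Q_L$ sending each query of $Q_H$ to a query (generator) of $Q_L$, and an epic natural transformation $\tau\colon[\![-]\!]_L\circ\pi\Rightarrow[\![-]\!]_H$. **Counterfactual abstraction** $L\to H$: a family of pairwise disjoint subsets $\pi(X)\subseteq V_L$, $X\in V_H$ (with $\pi(S)=\bigcup_{X\in S}\pi(X)$), and epic deterministic channels $\tau_X\colon\pi(X)\to X$ in $\mathcal C$ (with $\tau_S=\bigotimes_{X\in S}\tau_X$; all tensor products of the $\tau_X$ are also required to be epic), such that for all queries $[Y_1|_{X_1},\dots,Y_m|_{X_m}]$ of $\mathrm{CF}(V_H)$, $$(\tau_{Y_1}\otimes\dots\otimes\tau_{Y_m})\circ[\![\,[\pi(Y_1)|_{\pi(X_1)},\dots,\pi(Y_m)|_{\pi(X_m)}]\,]\!]_L=[\![\,[Y_1|_{X_1},\dots,Y_m|_{X_m}]\,]\!]_H\circ(\tau_{X_1}\otimes\dots\otimes\tau_{X_m}).$$ -}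

module Defs where

open import Level using (Level; _⊔_; 0ℓ) renaming (suc to lsuc)
open import Data.Empty using (⊥-elim)
open import Data.Fin.Base using (Fin)
open import Data.Fin.Induction using (spo-wellFounded)
open import Data.Fin.Subset using (Subset; _∈_; _⊆_; _∪_; _∩_; ⊥; ⁅_⁆; ⋃; Empty)
open import Data.Fin.Subset.Properties
  using (_∈?_; ∉⊥; x∈⁅x⁆; x∈⁅y⁆⇒x≡y; x∈p∪q⁻; x∈p∪q⁺; p⊆p∪q; q⊆p∪q; ⊆-antisym)
open import Data.List.Base using (List; []; _∷_; _++_; filter; allFin; map)
open import Data.List.Membership.Propositional using () renaming (_∈_ to _∈ˡ_)
open import Data.List.Membership.Propositional.Properties
  using (∈-filter⁺; ∈-filter⁻; ∈-allFin)
import Data.List.Membership.DecPropositional as DecMembership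
open import Data.List.Relation.Unary.All as All using (All; []; _∷_)
open import Data.List.Relation.Unary.Any using (here; there)
open import Data.List.Relation.Unary.AllPairs using ([]; _∷_)
open import Data.List.Relation.Unary.Unique.Propositional using (Unique)
open import Data.List.Relation.Unary.Unique.Propositional.Properties
  using () renaming (filter⁺ to unique-filter⁺; allFin⁺ to unique-allFin⁺)
open import Data.Nat.Base using (ℕ; zero; suc)
open import Data.Product using (Σ-syntax; ∃-syntax; _×_; _,_; proj₁; proj₂)
open import Data.Sum using (inj₁; inj₂)
open import Data.Vec.Base as Vec using (Vec; []; _∷_)
open import Function.Base using () renaming (_∘_ to _∘ᶠ_)
open import Function.Bundles using (_↔_; mk↔ₛ′; module Inverse)
open import Function.Properties.Inverse using (↔-refl; ↔-sym; ↔-trans)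
open import Induction.WellFounded using (Acc; acc; WellFounded)
open import Relation.Binary.Bundles using (Setoid)
open import Relation.Binary.Construct.Closure.Transitive
  using (TransClosure; [_]; transitive; wellFounded⁻)
open import Relation.Binary.PropositionalEquality
  using (_≡_; _≢_; refl; sym; trans; cong; cong₂; subst; isEquivalence)
open import Relation.Binary.Structures using (IsEquivalence; IsStrictPartialOrder)
open import Relation.Nullary using (¬_; yes; no)
import Data.Fin.Properties as Fin
import Relation.Binary.Reasoning.Setoid as SetoidReasoning

private
  variable
    o ℓ e o′ ℓ′ e′ o″ ℓ″ e″ : Level
    T T′ : Set
    n : ℕ

-- Compatibility of `copy` with the unit, and of discarding with ⊗, follow
-- from the terminality of the unit.

record MarkovCategory (o ℓ e : Level) : Set (lsuc (o ⊔ ℓ ⊔ e)) where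
  infix  4 _≈_ _⇒_
  infixr 9 _∘_
  infixr 10 _⊗₀_ _⊗₁_
  field
    Ob  : Set o
    _⇒_ : Ob → Ob → Set ℓ
    _≈_ : ∀ {A B} → A ⇒ B → A ⇒ B → Set e

    id  : ∀ {A} → A ⇒ A
    _∘_ : ∀ {A B C} → B ⇒ C → A ⇒ B → A ⇒ C

    equiv     : ∀ {A B} → IsEquivalence (_≈_ {A} {B})
    ∘-resp-≈  : ∀ {A B C} {f h : B ⇒ C} {g i : A ⇒ B} →
                f ≈ h → g ≈ i → f ∘ g ≈ h ∘ i
    identityˡ : ∀ {A B} {f : A ⇒ B} → id ∘ f ≈ f
    identityʳ : ∀ {A B} {f : A ⇒ B} → f ∘ id ≈ f
    assoc     : ∀ {A B C D} {f : A ⇒ B} {g : B ⇒ C} {h : C ⇒ D} →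
                (h ∘ g) ∘ f ≈ h ∘ (g ∘ f)

    unit : Ob
    _⊗₀_ : Ob → Ob → Ob
    _⊗₁_ : ∀ {A B C D} → A ⇒ B → C ⇒ D → A ⊗₀ C ⇒ B ⊗₀ D

    ⊗-resp-≈ : ∀ {A B C D} {f h : A ⇒ B} {g i : C ⇒ D} →
               f ≈ h → g ≈ i → f ⊗₁ g ≈ h ⊗₁ i
    ⊗-id     : ∀ {A B} → id {A} ⊗₁ id {B} ≈ id
    ⊗-∘      : ∀ {A B C A′ B′ C′} {f : A ⇒ B} {g : B ⇒ C} {f′ : A′ ⇒ B′} {g′ : B′ ⇒ C′} →
               (g ∘ f) ⊗₁ (g′ ∘ f′) ≈ (g ⊗₁ g′) ∘ (f ⊗₁ f′)

    α⇒ : ∀ {A B C} → (A ⊗₀ B) ⊗₀ C ⇒ A ⊗₀ (B ⊗₀ C)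
    α⇐ : ∀ {A B C} → A ⊗₀ (B ⊗₀ C) ⇒ (A ⊗₀ B) ⊗₀ C
    λ⇒ : ∀ {A} → unit ⊗₀ A ⇒ A
    λ⇐ : ∀ {A} → A ⇒ unit ⊗₀ A
    ρ⇒ : ∀ {A} → A ⊗₀ unit ⇒ A
    ρ⇐ : ∀ {A} → A ⇒ A ⊗₀ unit
    σ  : ∀ {A B} → A ⊗₀ B ⇒ B ⊗₀ A

    α-isoˡ : ∀ {A B C} → α⇐ ∘ α⇒ {A} {B} {C} ≈ id
    α-isoʳ : ∀ {A B C} → α⇒ {A} {B} {C} ∘ α⇐ ≈ id
    λ-isoˡ : ∀ {A} → λ⇐ ∘ λ⇒ {A} ≈ id
    λ-isoʳ : ∀ {A} → λ⇒ {A} ∘ λ⇐ ≈ id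
    ρ-isoˡ : ∀ {A} → ρ⇐ ∘ ρ⇒ {A} ≈ id
    ρ-isoʳ : ∀ {A} → ρ⇒ {A} ∘ ρ⇐ ≈ id
    σ-inv  : ∀ {A B} → σ {B} {A} ∘ σ {A} {B} ≈ id

    α-natural : ∀ {A B C A′ B′ C′} {f : A ⇒ A′} {g : B ⇒ B′} {h : C ⇒ C′} →
                α⇒ ∘ ((f ⊗₁ g) ⊗₁ h) ≈ (f ⊗₁ (g ⊗₁ h)) ∘ α⇒
    λ-natural : ∀ {A B} {f : A ⇒ B} → λ⇒ ∘ (id ⊗₁ f) ≈ f ∘ λ⇒
    ρ-natural : ∀ {A B} {f : A ⇒ B} → ρ⇒ ∘ (f ⊗₁ id) ≈ f ∘ ρ⇒
    σ-natural : ∀ {A B C D} {f : A ⇒ B} {g : C ⇒ D} →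
                σ ∘ (f ⊗₁ g) ≈ (g ⊗₁ f) ∘ σ

    triangle : ∀ {A B} → (id {A} ⊗₁ λ⇒ {B}) ∘ α⇒ ≈ ρ⇒ ⊗₁ id
    pentagon : ∀ {A B C D} →
               (id {A} ⊗₁ α⇒ {B} {C} {D}) ∘ (α⇒ ∘ (α⇒ ⊗₁ id)) ≈ α⇒ ∘ α⇒
    hexagon  : ∀ {A B C} →
               (id {B} ⊗₁ σ {A} {C}) ∘ (α⇒ ∘ (σ ⊗₁ id)) ≈ α⇒ ∘ (σ ∘ α⇒)

    copy    : ∀ {A} → A ⇒ A ⊗₀ A
    discard : ∀ {A} → A ⇒ unit

    discard-unique : ∀ {A} (f : A ⇒ unit) → f ≈ discard
    copy-assoc     : ∀ {A} → α⇒ ∘ ((copy ⊗₁ id) ∘ copy {A}) ≈ (id ⊗₁ copy) ∘ copy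
    copy-comm      : ∀ {A} → σ ∘ copy {A} ≈ copy
    copy-unit      : ∀ {A} → λ⇒ ∘ ((discard ⊗₁ id) ∘ copy {A}) ≈ id

  interchange : ∀ {A B C D} → (A ⊗₀ B) ⊗₀ (C ⊗₀ D) ⇒ (A ⊗₀ C) ⊗₀ (B ⊗₀ D)
  interchange = α⇐ ∘ ((id ⊗₁ (α⇒ ∘ ((σ ⊗₁ id) ∘ α⇐))) ∘ α⇒)

  field
    copy-⊗ : ∀ {A B} → copy {A ⊗₀ B} ≈ interchange ∘ (copy ⊗₁ copy)

  Deterministic : ∀ {A B} → A ⇒ B → Set e
  Deterministic f = copy ∘ f ≈ (f ⊗₁ f) ∘ copy

  Epic : ∀ {A B} → A ⇒ B → Set (o ⊔ ℓ ⊔ e)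
  Epic {A} {B} f = ∀ {Z} (g h : B ⇒ Z) → g ∘ f ≈ h ∘ f → g ≈ h

  fst : ∀ {A B} → A ⊗₀ B ⇒ A
  fst = ρ⇒ ∘ (id ⊗₁ discard)

  snd : ∀ {A B} → A ⊗₀ B ⇒ B
  snd = λ⇒ ∘ (discard ⊗₁ id)

  hom-setoid : Ob → Ob → Setoid ℓ e
  hom-setoid A B = record { Carrier = A ⇒ B ; _≈_ = _≈_ ; isEquivalence = equiv }

  module ≈ {A B} = IsEquivalence (equiv {A} {B})
  module ≈-Reasoning {A B} = SetoidReasoning (hom-setoid A B)

record Functor (𝒞 : MarkovCategory o ℓ e) (𝒟 : MarkovCategory o′ ℓ′ e′) :
               Set (o ⊔ ℓ ⊔ e ⊔ o′ ⊔ ℓ′ ⊔ e′) where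
  private
    module C = MarkovCategory 𝒞
    module D = MarkovCategory 𝒟
  open D using (_∘_; _⊗₁_; _≈_)
  field
    F₀ : C.Ob → D.Ob
    F₁ : ∀ {A B} → A C.⇒ B → F₀ A D.⇒ F₀ B

    F-resp-≈     : ∀ {A B} {f g : A C.⇒ B} → f C.≈ g → F₁ f ≈ F₁ g
    identity     : ∀ {A} → F₁ (C.id {A}) ≈ D.id
    homomorphism : ∀ {A B C} {f : A C.⇒ B} {g : B C.⇒ C} →
                   F₁ (g C.∘ f) ≈ F₁ g ∘ F₁ f

    ε   : D.unit D.⇒ F₀ C.unit
    ε⁻¹ : F₀ C.unit D.⇒ D.unit
    μ   : ∀ {A B} → F₀ A D.⊗₀ F₀ B D.⇒ F₀ (A C.⊗₀ B)
    μ⁻¹ : ∀ {A B} → F₀ (A C.⊗₀ B) D.⇒ F₀ A D.⊗₀ F₀ B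

    ε-isoˡ : ε⁻¹ ∘ ε ≈ D.id
    ε-isoʳ : ε ∘ ε⁻¹ ≈ D.id
    μ-isoˡ : ∀ {A B} → μ⁻¹ ∘ μ {A} {B} ≈ D.id
    μ-isoʳ : ∀ {A B} → μ {A} {B} ∘ μ⁻¹ ≈ D.id

    μ-natural      : ∀ {A B A′ B′} {f : A C.⇒ A′} {g : B C.⇒ B′} →
                     μ ∘ (F₁ f ⊗₁ F₁ g) ≈ F₁ (f C.⊗₁ g) ∘ μ
    associativity  : ∀ {A B C} →
                     F₁ (C.α⇒ {A} {B} {C}) ∘ (μ ∘ (μ ⊗₁ D.id)) ≈ μ ∘ ((D.id ⊗₁ μ) ∘ D.α⇒)
    unitalityˡ     : ∀ {A} → F₁ (C.λ⇒ {A}) ∘ (μ ∘ (ε ⊗₁ D.id)) ≈ D.λ⇒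
    unitalityʳ     : ∀ {A} → F₁ (C.ρ⇒ {A}) ∘ (μ ∘ (D.id ⊗₁ ε)) ≈ D.ρ⇒
    braided        : ∀ {A B} → F₁ (C.σ {A} {B}) ∘ μ ≈ μ ∘ D.σ
    copy-preserving : ∀ {A} → F₁ (C.copy {A}) ≈ μ ∘ D.copy

    ε-deterministic : D.Deterministic ε
    μ-deterministic : ∀ {A B} → D.Deterministic (μ {A} {B})

record NaturalTransformation {𝒞 : MarkovCategory o ℓ e} {𝒟 : MarkovCategory o′ ℓ′ e′}
                             (F G : Functor 𝒞 𝒟) : Set (o ⊔ ℓ ⊔ e ⊔ o′ ⊔ ℓ′ ⊔ e′) where
  private
    module C = MarkovCategory 𝒞
    module F = Functor F
    module G = Functor G
  open MarkovCategory 𝒟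
  field
    η             : ∀ A → F.F₀ A ⇒ G.F₀ A
    natural       : ∀ {A B} (f : A C.⇒ B) → η B ∘ F.F₁ f ≈ G.F₁ f ∘ η A
    monoidal-⊗    : ∀ {A B} → η (A C.⊗₀ B) ∘ F.μ ≈ G.μ ∘ (η A ⊗₁ η B)
    monoidal-unit : η C.unit ∘ F.ε ≈ G.ε
    deterministic : ∀ A → Deterministic (η A)

record NaturalIsomorphism {𝒞 : MarkovCategory o ℓ e} {𝒟 : MarkovCategory o′ ℓ′ e′}
                          (F G : Functor 𝒞 𝒟) : Set (o ⊔ ℓ ⊔ e ⊔ o′ ⊔ ℓ′ ⊔ e′) where
  open MarkovCategory 𝒟
  field
    transformation : NaturalTransformation F G
  open NaturalTransformation transformation public
  field
    η⁻¹  : ∀ A → Functor.F₀ G A ⇒ Functor.F₀ F A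
    isoˡ : ∀ A → η⁻¹ A ∘ η A ≈ id
    isoʳ : ∀ A → η A ∘ η⁻¹ A ≈ id

module _ {𝒞 : MarkovCategory o ℓ e} {𝒟 : MarkovCategory o′ ℓ′ e′}
         {ℰ : MarkovCategory o″ ℓ″ e″} where

  infixr 9 _∘F_

  _∘F_ : Functor 𝒟 ℰ → Functor 𝒞 𝒟 → Functor 𝒞 ℰ
  G ∘F F = record
    { F₀ = λ A → G.F₀ (F.F₀ A)
    ; F₁ = λ f → G.F₁ (F.F₁ f)
    ; F-resp-≈     = λ p → G.F-resp-≈ (F.F-resp-≈ p)
    ; identity     = ≈.trans (G.F-resp-≈ F.identity) G.identity
    ; homomorphism = ≈.trans (G.F-resp-≈ F.homomorphism) G.homomorphism
    ; ε   = G.F₁ F.ε ∘ G.ε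
    ; ε⁻¹ = G.ε⁻¹ ∘ G.F₁ F.ε⁻¹
    ; μ   = G.F₁ F.μ ∘ G.μ
    ; μ⁻¹ = G.μ⁻¹ ∘ G.F₁ F.μ⁻¹
    ; ε-isoˡ = cancel (G-inverse F.ε-isoˡ) G.ε-isoˡ
    ; ε-isoʳ = cancel G.ε-isoʳ (G-inverse F.ε-isoʳ)
    ; μ-isoˡ = cancel (G-inverse F.μ-isoˡ) G.μ-isoˡ
    ; μ-isoʳ = cancel G.μ-isoʳ (G-inverse F.μ-isoʳ)
    ; μ-natural = begin
        (G.F₁ F.μ ∘ G.μ) ∘ (G.F₁ _ ⊗₁ G.F₁ _)  ≈⟨ assoc ⟩
        G.F₁ F.μ ∘ (G.μ ∘ (G.F₁ _ ⊗₁ G.F₁ _))  ≈⟨ ∘-resp-≈ ≈.refl G.μ-natural ⟩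
        G.F₁ F.μ ∘ (G.F₁ (_ D.⊗₁ _) ∘ G.μ)     ≈⟨ assoc ⟨
        (G.F₁ F.μ ∘ G.F₁ (_ D.⊗₁ _)) ∘ G.μ     ≈⟨ ∘-resp-≈ (G-square F.μ-natural) ≈.refl ⟩
        (G.F₁ (F.F₁ _) ∘ G.F₁ F.μ) ∘ G.μ       ≈⟨ assoc ⟩
        G.F₁ (F.F₁ _) ∘ (G.F₁ F.μ ∘ G.μ)       ∎
    ; associativity = begin
        G.F₁ (F.F₁ C.α⇒) ∘ ((G.F₁ F.μ ∘ G.μ) ∘ ((G.F₁ F.μ ∘ G.μ) ⊗₁ id))
          ≈⟨ ∘-resp-≈ ≈.refl (∘-resp-≈ ≈.refl split₁) ⟩
        G.F₁ (F.F₁ C.α⇒) ∘ ((G.F₁ F.μ ∘ G.μ) ∘ ((G.F₁ F.μ ⊗₁ G.F₁ D.id) ∘ (G.μ ⊗₁ id)))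
          ≈⟨ ∘-resp-≈ ≈.refl middle ⟩
        G.F₁ (F.F₁ C.α⇒) ∘ ((G.F₁ F.μ ∘ G.F₁ (F.μ D.⊗₁ D.id)) ∘ (G.μ ∘ (G.μ ⊗₁ id)))
          ≈⟨ assoc ⟨
        (G.F₁ (F.F₁ C.α⇒) ∘ (G.F₁ F.μ ∘ G.F₁ (F.μ D.⊗₁ D.id))) ∘ (G.μ ∘ (G.μ ⊗₁ id))
          ≈⟨ ∘-resp-≈ (≈.trans (∘-resp-≈ ≈.refl (≈.sym G.homomorphism)) (≈.sym G.homomorphism)) ≈.refl ⟩
        G.F₁ (F.F₁ C.α⇒ D.∘ (F.μ D.∘ (F.μ D.⊗₁ D.id))) ∘ (G.μ ∘ (G.μ ⊗₁ id))
          ≈⟨ ∘-resp-≈ (G.F-resp-≈ F.associativity) ≈.refl ⟩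
        G.F₁ (F.μ D.∘ ((D.id D.⊗₁ F.μ) D.∘ D.α⇒)) ∘ (G.μ ∘ (G.μ ⊗₁ id))
          ≈⟨ ∘-resp-≈ (≈.trans G.homomorphism (∘-resp-≈ ≈.refl G.homomorphism)) ≈.refl ⟩
        (G.F₁ F.μ ∘ (G.F₁ (D.id D.⊗₁ F.μ) ∘ G.F₁ D.α⇒)) ∘ (G.μ ∘ (G.μ ⊗₁ id))
          ≈⟨ ≈.trans assoc (∘-resp-≈ ≈.refl assoc) ⟩
        G.F₁ F.μ ∘ (G.F₁ (D.id D.⊗₁ F.μ) ∘ (G.F₁ D.α⇒ ∘ (G.μ ∘ (G.μ ⊗₁ id))))
          ≈⟨ ∘-resp-≈ ≈.refl (∘-resp-≈ ≈.refl G.associativity) ⟩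
        G.F₁ F.μ ∘ (G.F₁ (D.id D.⊗₁ F.μ) ∘ (G.μ ∘ ((id ⊗₁ G.μ) ∘ α⇒)))
          ≈⟨ ∘-resp-≈ ≈.refl (≈.sym assoc) ⟩
        G.F₁ F.μ ∘ ((G.F₁ (D.id D.⊗₁ F.μ) ∘ G.μ) ∘ ((id ⊗₁ G.μ) ∘ α⇒))
          ≈⟨ ∘-resp-≈ ≈.refl (∘-resp-≈ (≈.sym G.μ-natural) ≈.refl) ⟩
        G.F₁ F.μ ∘ ((G.μ ∘ (G.F₁ D.id ⊗₁ G.F₁ F.μ)) ∘ ((id ⊗₁ G.μ) ∘ α⇒))
          ≈⟨ ∘-resp-≈ ≈.refl (≈.trans assoc (∘-resp-≈ ≈.refl (≈.sym assoc))) ⟩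
        G.F₁ F.μ ∘ (G.μ ∘ (((G.F₁ D.id ⊗₁ G.F₁ F.μ) ∘ (id ⊗₁ G.μ)) ∘ α⇒))
          ≈⟨ ≈.sym assoc ⟩
        (G.F₁ F.μ ∘ G.μ) ∘ (((G.F₁ D.id ⊗₁ G.F₁ F.μ) ∘ (id ⊗₁ G.μ)) ∘ α⇒)
          ≈⟨ ∘-resp-≈ ≈.refl (∘-resp-≈ split₂ ≈.refl) ⟨
        (G.F₁ F.μ ∘ G.μ) ∘ ((id ⊗₁ (G.F₁ F.μ ∘ G.μ)) ∘ α⇒) ∎
    ; unitalityˡ = begin
        G.F₁ (F.F₁ C.λ⇒) ∘ ((G.F₁ F.μ ∘ G.μ) ∘ ((G.F₁ F.ε ∘ G.ε) ⊗₁ id))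
          ≈⟨ ∘-resp-≈ ≈.refl (∘-resp-≈ ≈.refl split₁) ⟩
        G.F₁ (F.F₁ C.λ⇒) ∘ ((G.F₁ F.μ ∘ G.μ) ∘ ((G.F₁ F.ε ⊗₁ G.F₁ D.id) ∘ (G.ε ⊗₁ id)))
          ≈⟨ ∘-resp-≈ ≈.refl middle ⟩
        G.F₁ (F.F₁ C.λ⇒) ∘ ((G.F₁ F.μ ∘ G.F₁ (F.ε D.⊗₁ D.id)) ∘ (G.μ ∘ (G.ε ⊗₁ id)))
          ≈⟨ collapse F.unitalityˡ ⟩
        G.F₁ D.λ⇒ ∘ (G.μ ∘ (G.ε ⊗₁ id))
          ≈⟨ G.unitalityˡ ⟩
        λ⇒ ∎
    ; unitalityʳ = begin
        G.F₁ (F.F₁ C.ρ⇒) ∘ ((G.F₁ F.μ ∘ G.μ) ∘ (id ⊗₁ (G.F₁ F.ε ∘ G.ε)))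
          ≈⟨ ∘-resp-≈ ≈.refl (∘-resp-≈ ≈.refl split₂) ⟩
        G.F₁ (F.F₁ C.ρ⇒) ∘ ((G.F₁ F.μ ∘ G.μ) ∘ ((G.F₁ D.id ⊗₁ G.F₁ F.ε) ∘ (id ⊗₁ G.ε)))
          ≈⟨ ∘-resp-≈ ≈.refl middle ⟩
        G.F₁ (F.F₁ C.ρ⇒) ∘ ((G.F₁ F.μ ∘ G.F₁ (D.id D.⊗₁ F.ε)) ∘ (G.μ ∘ (id ⊗₁ G.ε)))
          ≈⟨ collapse F.unitalityʳ ⟩
        G.F₁ D.ρ⇒ ∘ (G.μ ∘ (id ⊗₁ G.ε))
          ≈⟨ G.unitalityʳ ⟩
        ρ⇒ ∎
    ; braided = begin
        G.F₁ (F.F₁ C.σ) ∘ (G.F₁ F.μ ∘ G.μ)  ≈⟨ assoc ⟨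
        (G.F₁ (F.F₁ C.σ) ∘ G.F₁ F.μ) ∘ G.μ  ≈⟨ ∘-resp-≈ (G-square F.braided) ≈.refl ⟩
        (G.F₁ F.μ ∘ G.F₁ D.σ) ∘ G.μ         ≈⟨ assoc ⟩
        G.F₁ F.μ ∘ (G.F₁ D.σ ∘ G.μ)         ≈⟨ ∘-resp-≈ ≈.refl G.braided ⟩
        G.F₁ F.μ ∘ (G.μ ∘ σ)                ≈⟨ assoc ⟨
        (G.F₁ F.μ ∘ G.μ) ∘ σ                ∎
    ; copy-preserving = begin
        G.F₁ (F.F₁ C.copy)        ≈⟨ G.F-resp-≈ F.copy-preserving ⟩
        G.F₁ (F.μ D.∘ D.copy)     ≈⟨ G.homomorphism ⟩
        G.F₁ F.μ ∘ G.F₁ D.copy    ≈⟨ ∘-resp-≈ ≈.refl G.copy-preserving ⟩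
        G.F₁ F.μ ∘ (G.μ ∘ copy)   ≈⟨ assoc ⟨
        (G.F₁ F.μ ∘ G.μ) ∘ copy   ∎
    ; ε-deterministic = ∘-deterministic (G-deterministic F.ε-deterministic) G.ε-deterministic
    ; μ-deterministic = ∘-deterministic (G-deterministic F.μ-deterministic) G.μ-deterministic
    }
    where
    module C = MarkovCategory 𝒞
    module D = MarkovCategory 𝒟
    module F = Functor F
    module G = Functor G
    open MarkovCategory ℰ
    open ≈-Reasoning

    G-inverse : ∀ {A B} {f : A D.⇒ B} {g : B D.⇒ A} → g D.∘ f D.≈ D.id → G.F₁ g ∘ G.F₁ f ≈ id
    G-inverse p = ≈.trans (≈.sym G.homomorphism) (≈.trans (G.F-resp-≈ p) G.identity)

    G-square : ∀ {A B B′ Z} {f : A D.⇒ B} {g : B D.⇒ Z} {f′ : A D.⇒ B′} {g′ : B′ D.⇒ Z} →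
               g D.∘ f D.≈ g′ D.∘ f′ → G.F₁ g ∘ G.F₁ f ≈ G.F₁ g′ ∘ G.F₁ f′
    G-square p = ≈.trans (≈.sym G.homomorphism) (≈.trans (G.F-resp-≈ p) G.homomorphism)

    cancel : ∀ {X Y Z} {f : X ⇒ Y} {g : Y ⇒ X} {h : Z ⇒ X} {k : X ⇒ Z} →
             g ∘ f ≈ id → k ∘ h ≈ id → (k ∘ g) ∘ (f ∘ h) ≈ id
    cancel p q = ≈.trans assoc (≈.trans (∘-resp-≈ ≈.refl
      (≈.trans (≈.sym assoc) (≈.trans (∘-resp-≈ p ≈.refl) identityˡ))) q)

    split₁ : ∀ {X Y Z A} {f : Y ⇒ Z} {g : X ⇒ Y} →
             (f ∘ g) ⊗₁ id ≈ (f ⊗₁ G.F₁ (D.id {A})) ∘ (g ⊗₁ id)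
    split₁ = ≈.trans (⊗-resp-≈ ≈.refl (≈.sym (≈.trans identityʳ G.identity))) ⊗-∘

    split₂ : ∀ {X Y Z A} {f : Y ⇒ Z} {g : X ⇒ Y} →
             id ⊗₁ (f ∘ g) ≈ (G.F₁ (D.id {A}) ⊗₁ f) ∘ (id ⊗₁ g)
    split₂ = ≈.trans (⊗-resp-≈ (≈.sym (≈.trans identityʳ G.identity)) ≈.refl) ⊗-∘

    middle : ∀ {A A′ B B′ X Z} {f : A D.⇒ A′} {g : B D.⇒ B′}
             {h : X ⇒ G.F₀ A ⊗₀ G.F₀ B} {k : G.F₀ (A′ D.⊗₀ B′) ⇒ Z} →
             (k ∘ G.μ) ∘ ((G.F₁ f ⊗₁ G.F₁ g) ∘ h) ≈ (k ∘ G.F₁ (f D.⊗₁ g)) ∘ (G.μ ∘ h)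
    middle {f = f} {g} {h} {k} = begin
      (k ∘ G.μ) ∘ ((G.F₁ f ⊗₁ G.F₁ g) ∘ h)   ≈⟨ ≈.trans (≈.sym assoc) (∘-resp-≈ assoc ≈.refl) ⟩
      (k ∘ (G.μ ∘ (G.F₁ f ⊗₁ G.F₁ g))) ∘ h   ≈⟨ ∘-resp-≈ (∘-resp-≈ ≈.refl G.μ-natural) ≈.refl ⟩
      (k ∘ (G.F₁ (f D.⊗₁ g) ∘ G.μ)) ∘ h      ≈⟨ ∘-resp-≈ assoc ≈.refl ⟨
      ((k ∘ G.F₁ (f D.⊗₁ g)) ∘ G.μ) ∘ h      ≈⟨ assoc ⟩
      (k ∘ G.F₁ (f D.⊗₁ g)) ∘ (G.μ ∘ h)      ∎

    collapse : ∀ {A B B′ Z X} {f : A D.⇒ B} {g : B D.⇒ B′} {h : B′ D.⇒ Z} {k : A D.⇒ Z}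
               {l : X ⇒ G.F₀ A} →
               h D.∘ (g D.∘ f) D.≈ k → G.F₁ h ∘ ((G.F₁ g ∘ G.F₁ f) ∘ l) ≈ G.F₁ k ∘ l
    collapse p = ≈.trans (≈.sym assoc) (∘-resp-≈
      (≈.trans (∘-resp-≈ ≈.refl (≈.sym G.homomorphism))
               (≈.trans (≈.sym G.homomorphism) (G.F-resp-≈ p))) ≈.refl)

    ∘-deterministic : ∀ {X Y Z} {f : Y ⇒ Z} {g : X ⇒ Y} →
                      Deterministic f → Deterministic g → Deterministic (f ∘ g)
    ∘-deterministic {f = f} {g} p q = begin
      copy ∘ (f ∘ g)                  ≈⟨ assoc ⟨
      (copy ∘ f) ∘ g                  ≈⟨ ∘-resp-≈ p ≈.refl ⟩
      ((f ⊗₁ f) ∘ copy) ∘ g           ≈⟨ assoc ⟩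
      (f ⊗₁ f) ∘ (copy ∘ g)           ≈⟨ ∘-resp-≈ ≈.refl q ⟩
      (f ⊗₁ f) ∘ ((g ⊗₁ g) ∘ copy)    ≈⟨ assoc ⟨
      ((f ⊗₁ f) ∘ (g ⊗₁ g)) ∘ copy    ≈⟨ ∘-resp-≈ ⊗-∘ ≈.refl ⟨
      ((f ∘ g) ⊗₁ (f ∘ g)) ∘ copy     ∎

    G-deterministic : ∀ {A B} {f : A D.⇒ B} → D.Deterministic f → Deterministic (G.F₁ f)
    G-deterministic {f = f} p = begin
      copy ∘ G.F₁ f
        ≈⟨ identityˡ ⟨
      id ∘ (copy ∘ G.F₁ f)
        ≈⟨ ∘-resp-≈ G.μ-isoˡ ≈.refl ⟨
      (G.μ⁻¹ ∘ G.μ) ∘ (copy ∘ G.F₁ f)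
        ≈⟨ ≈.trans assoc (∘-resp-≈ ≈.refl (≈.sym assoc)) ⟩
      G.μ⁻¹ ∘ ((G.μ ∘ copy) ∘ G.F₁ f)
        ≈⟨ ∘-resp-≈ ≈.refl (∘-resp-≈ (≈.sym G.copy-preserving) ≈.refl) ⟩
      G.μ⁻¹ ∘ (G.F₁ D.copy ∘ G.F₁ f)
        ≈⟨ ∘-resp-≈ ≈.refl (G-square p) ⟩
      G.μ⁻¹ ∘ (G.F₁ (f D.⊗₁ f) ∘ G.F₁ D.copy)
        ≈⟨ ∘-resp-≈ ≈.refl (∘-resp-≈ ≈.refl G.copy-preserving) ⟩
      G.μ⁻¹ ∘ (G.F₁ (f D.⊗₁ f) ∘ (G.μ ∘ copy))
        ≈⟨ ∘-resp-≈ ≈.refl (≈.trans (≈.sym assoc) (∘-resp-≈ (≈.sym G.μ-natural) ≈.refl)) ⟩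
      G.μ⁻¹ ∘ ((G.μ ∘ (G.F₁ f ⊗₁ G.F₁ f)) ∘ copy)
        ≈⟨ ≈.trans (∘-resp-≈ ≈.refl assoc) (≈.sym assoc) ⟩
      (G.μ⁻¹ ∘ G.μ) ∘ ((G.F₁ f ⊗₁ G.F₁ f) ∘ copy)
        ≈⟨ ≈.trans (∘-resp-≈ G.μ-isoˡ ≈.refl) identityˡ ⟩
      (G.F₁ f ⊗₁ G.F₁ f) ∘ copy ∎

infixr 10 _⊗_
infix  4  _∈ᵗ_

data Obj (T : Set) : Set where
  I   : Obj T
  var : T → Obj T
  _⊗_ : Obj T → Obj T → Obj T

⨂ : List T → Obj T
⨂ []       = I
⨂ (x ∷ xs) = var x ⊗ ⨂ xs

bind : (T → Obj T′) → Obj T → Obj T′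
bind f I       = I
bind f (var x) = f x
bind f (A ⊗ B) = bind f A ⊗ bind f B

-- A proof of x ∈ᵗ A is a position at which x occurs in A.

data _∈ᵗ_ (x : T) : Obj T → Set where
  here  : x ∈ᵗ var x
  left  : ∀ {A B} → x ∈ᵗ A → x ∈ᵗ A ⊗ B
  right : ∀ {A B} → x ∈ᵗ B → x ∈ᵗ A ⊗ B

Distinct : Obj T → Set
Distinct A = ∀ x (i j : x ∈ᵗ A) → i ≡ j

-- Where each factor of B is to be taken from in A.

Rewiring : Obj T → Obj T → Set
Rewiring A B = ∀ x → x ∈ᵗ B → x ∈ᵗ A

-- A and B have the same factors, up to permutation and bracketing.

Arrangement : Obj T → Obj T → Set
Arrangement A B = ∀ x → (x ∈ᵗ A) ↔ (x ∈ᵗ B)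

module Arr where

  to : {A B : Obj T} → Arrangement A B → Rewiring B A
  to a x = Inverse.to (a x)

  from : {A B : Obj T} → Arrangement A B → Rewiring A B
  from a x = Inverse.from (a x)

  idₐ : {A : Obj T} → Arrangement A A
  idₐ x = ↔-refl

  symₐ : {A B : Obj T} → Arrangement A B → Arrangement B A
  symₐ a x = ↔-sym (a x)

  transₐ : {A B C : Obj T} → Arrangement A B → Arrangement B C → Arrangement A C
  transₐ a b x = ↔-trans (a x) (b x)

  unitₐ : {A : Obj T} → Arrangement (I ⊗ A) A
  unitₐ x = mk↔ₛ′ (λ { (left ()) ; (right i) → i }) right (λ _ → refl)
                   (λ { (left ()) ; (right i) → refl })

  assocₐ : {A B C : Obj T} → Arrangement ((A ⊗ B) ⊗ C) (A ⊗ (B ⊗ C))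
  assocₐ x = mk↔ₛ′
    (λ { (left (left i)) → left i ; (left (right i)) → right (left i) ; (right i) → right (right i) })
    (λ { (left i) → left (left i) ; (right (left i)) → left (right i) ; (right (right i)) → right i })
    (λ { (left i) → refl ; (right (left i)) → refl ; (right (right i)) → refl })
    (λ { (left (left i)) → refl ; (left (right i)) → refl ; (right i) → refl })

  infixr 10 _⊗ₐ_

  _⊗ₐ_ : {A A′ B B′ : Obj T} → Arrangement A A′ → Arrangement B B′ → Arrangement (A ⊗ B) (A′ ⊗ B′)
  (a ⊗ₐ b) x = mk↔ₛ′
    (λ { (left i) → left (to a x i) ; (right i) → right (to b x i) })
    (λ { (left i) → left (from a x i) ; (right i) → right (from b x i) })
    (λ { (left i) → cong left (Inverse.strictlyInverseˡ (a x) i)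
       ; (right i) → cong right (Inverse.strictlyInverseˡ (b x) i) })
    (λ { (left i) → cong left (Inverse.strictlyInverseʳ (a x) i)
       ; (right i) → cong right (Inverse.strictlyInverseʳ (b x) i) })

  ⨂-++ : (xs ys : List T) → Arrangement (⨂ (xs ++ ys)) (⨂ xs ⊗ ⨂ ys)
  ⨂-++ []       ys = symₐ unitₐ
  ⨂-++ (x ∷ xs) ys = transₐ (idₐ ⊗ₐ ⨂-++ xs ys) (symₐ assocₐ)

  bind-⨂-++ : (f : T → Obj T′) (xs ys : List T) →
              Arrangement (bind f (⨂ (xs ++ ys))) (bind f (⨂ xs) ⊗ bind f (⨂ ys))
  bind-⨂-++ f []       ys = symₐ unitₐ
  bind-⨂-++ f (x ∷ xs) ys = transₐ (idₐ ⊗ₐ bind-⨂-++ f xs ys) (symₐ assocₐ)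

at : ∀ {x : T} {xs} → x ∈ˡ xs → x ∈ᵗ ⨂ xs
at (here refl) = left here
at (there i)   = right (at i)

at⁻¹ : ∀ {x : T} {xs} → x ∈ᵗ ⨂ xs → x ∈ˡ xs
at⁻¹ {xs = _ ∷ _} (left here) = here refl
at⁻¹ {xs = _ ∷ _} (right i)   = there (at⁻¹ i)

module Wiring (𝒞 : MarkovCategory o ℓ e) (ob : T → MarkovCategory.Ob 𝒞) where
  open MarkovCategory 𝒞

  ⟦_⟧ : Obj T → Ob
  ⟦ I ⟧     = unit
  ⟦ var x ⟧ = ob x
  ⟦ A ⊗ B ⟧ = ⟦ A ⟧ ⊗₀ ⟦ B ⟧

  proj : ∀ {x A} → x ∈ᵗ A → ⟦ A ⟧ ⇒ ob x
  proj here      = id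
  proj (left i)  = proj i ∘ fst
  proj (right i) = proj i ∘ snd

  -- Copies, discards and permutes the factors of A as prescribed; a
  -- permutation of the factors when the rewiring is bijective.

  wire : ∀ A B → Rewiring A B → ⟦ A ⟧ ⇒ ⟦ B ⟧
  wire A I       r = discard
  wire A (var x) r = proj (r x here)
  wire A (B ⊗ B′) r =
    (wire A B (λ x i → r x (left i)) ⊗₁ wire A B′ (λ x i → r x (right i))) ∘ copy

  split : ∀ xs ys → ⟦ ⨂ (xs ++ ys) ⟧ ⇒ ⟦ ⨂ xs ⟧ ⊗₀ ⟦ ⨂ ys ⟧
  split xs ys = wire (⨂ (xs ++ ys)) (⨂ xs ⊗ ⨂ ys) (Arr.from (Arr.⨂-++ xs ys))

  join : ∀ xs ys → ⟦ ⨂ xs ⟧ ⊗₀ ⟦ ⨂ ys ⟧ ⇒ ⟦ ⨂ (xs ++ ys) ⟧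
  join xs ys = wire (⨂ xs ⊗ ⨂ ys) (⨂ (xs ++ ys)) (Arr.to (Arr.⨂-++ xs ys))

record Signature : Set₁ where
  field
    Type  : Set
    Query : Set
    ins   : Query → List Type
    outs  : Query → List Type

module Syntax (Σ : Signature) where
  open Signature Σ

  infix  4 _⇒_ _≈_
  infixr 9 _∘_
  infixr 10 _⊗₁_

  data _⇒_ : Obj Type → Obj Type → Set where
    gen  : ∀ q → ⨂ (ins q) ⇒ ⨂ (outs q)
    id   : ∀ {A} → A ⇒ A
    _∘_  : ∀ {A B C} → B ⇒ C → A ⇒ B → A ⇒ C
    _⊗₁_ : ∀ {A B C D} → A ⇒ B → C ⇒ D → A ⊗ C ⇒ B ⊗ D
    α⇒   : ∀ {A B C} → (A ⊗ B) ⊗ C ⇒ A ⊗ (B ⊗ C)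
    α⇐   : ∀ {A B C} → A ⊗ (B ⊗ C) ⇒ (A ⊗ B) ⊗ C
    λ⇒   : ∀ {A} → I ⊗ A ⇒ A
    λ⇐   : ∀ {A} → A ⇒ I ⊗ A
    ρ⇒   : ∀ {A} → A ⊗ I ⇒ A
    ρ⇐   : ∀ {A} → A ⇒ A ⊗ I
    σ    : ∀ {A B} → A ⊗ B ⇒ B ⊗ A
    copy : ∀ {A} → A ⇒ A ⊗ A
    discard : ∀ {A} → A ⇒ I

  data _≈_ : ∀ {A B} → A ⇒ B → A ⇒ B → Set where
    ≈-refl    : ∀ {A B} {f : A ⇒ B} → f ≈ f
    ≈-sym     : ∀ {A B} {f g : A ⇒ B} → f ≈ g → g ≈ f
    ≈-trans   : ∀ {A B} {f g h : A ⇒ B} → f ≈ g → g ≈ h → f ≈ h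
    ∘-resp-≈  : ∀ {A B C} {f h : B ⇒ C} {g i : A ⇒ B} → f ≈ h → g ≈ i → f ∘ g ≈ h ∘ i
    identityˡ : ∀ {A B} {f : A ⇒ B} → id ∘ f ≈ f
    identityʳ : ∀ {A B} {f : A ⇒ B} → f ∘ id ≈ f
    assoc     : ∀ {A B C D} {f : A ⇒ B} {g : B ⇒ C} {h : C ⇒ D} → (h ∘ g) ∘ f ≈ h ∘ (g ∘ f)
    ⊗-resp-≈  : ∀ {A B C D} {f h : A ⇒ B} {g i : C ⇒ D} → f ≈ h → g ≈ i → f ⊗₁ g ≈ h ⊗₁ i
    ⊗-id      : ∀ {A B} → id {A} ⊗₁ id {B} ≈ id
    ⊗-∘       : ∀ {A B C A′ B′ C′} {f : A ⇒ B} {g : B ⇒ C} {f′ : A′ ⇒ B′} {g′ : B′ ⇒ C′} →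
                (g ∘ f) ⊗₁ (g′ ∘ f′) ≈ (g ⊗₁ g′) ∘ (f ⊗₁ f′)
    α-isoˡ    : ∀ {A B C} → α⇐ ∘ α⇒ {A} {B} {C} ≈ id
    α-isoʳ    : ∀ {A B C} → α⇒ {A} {B} {C} ∘ α⇐ ≈ id
    λ-isoˡ    : ∀ {A} → λ⇐ ∘ λ⇒ {A} ≈ id
    λ-isoʳ    : ∀ {A} → λ⇒ {A} ∘ λ⇐ ≈ id
    ρ-isoˡ    : ∀ {A} → ρ⇐ ∘ ρ⇒ {A} ≈ id
    ρ-isoʳ    : ∀ {A} → ρ⇒ {A} ∘ ρ⇐ ≈ id
    σ-inv     : ∀ {A B} → σ {B} {A} ∘ σ {A} {B} ≈ id
    α-natural : ∀ {A B C A′ B′ C′} {f : A ⇒ A′} {g : B ⇒ B′} {h : C ⇒ C′} →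
                α⇒ ∘ ((f ⊗₁ g) ⊗₁ h) ≈ (f ⊗₁ (g ⊗₁ h)) ∘ α⇒
    λ-natural : ∀ {A B} {f : A ⇒ B} → λ⇒ ∘ (id ⊗₁ f) ≈ f ∘ λ⇒
    ρ-natural : ∀ {A B} {f : A ⇒ B} → ρ⇒ ∘ (f ⊗₁ id) ≈ f ∘ ρ⇒
    σ-natural : ∀ {A B C D} {f : A ⇒ B} {g : C ⇒ D} → σ ∘ (f ⊗₁ g) ≈ (g ⊗₁ f) ∘ σ
    triangle  : ∀ {A B} → (id {A} ⊗₁ λ⇒ {B}) ∘ α⇒ ≈ ρ⇒ ⊗₁ id
    pentagon  : ∀ {A B C D} →
                (id {A} ⊗₁ α⇒ {B} {C} {D}) ∘ (α⇒ ∘ (α⇒ ⊗₁ id)) ≈ α⇒ ∘ α⇒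
    hexagon   : ∀ {A B C} →
                (id {B} ⊗₁ σ {A} {C}) ∘ (α⇒ ∘ (σ ⊗₁ id)) ≈ α⇒ ∘ (σ ∘ α⇒)
    discard-unique : ∀ {A} (f : A ⇒ I) → f ≈ discard
    copy-assoc : ∀ {A} → α⇒ ∘ ((copy ⊗₁ id) ∘ copy {A}) ≈ (id ⊗₁ copy) ∘ copy
    copy-comm  : ∀ {A} → σ ∘ copy {A} ≈ copy
    copy-unit  : ∀ {A} → λ⇒ ∘ ((discard ⊗₁ id) ∘ copy {A}) ≈ id
    copy-⊗     : ∀ {A B} → copy {A ⊗ B} ≈
                 (α⇐ ∘ ((id ⊗₁ (α⇒ ∘ ((σ ⊗₁ id) ∘ α⇐))) ∘ α⇒)) ∘ (copy ⊗₁ copy)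

Free : Signature → MarkovCategory 0ℓ 0ℓ 0ℓ
Free Σ = record
  { Ob = Obj (Signature.Type Σ) ; _⇒_ = _⇒_ ; _≈_ = _≈_ ; id = id ; _∘_ = _∘_
  ; equiv = record { refl = ≈-refl ; sym = ≈-sym ; trans = ≈-trans }
  ; ∘-resp-≈ = ∘-resp-≈ ; identityˡ = identityˡ ; identityʳ = identityʳ ; assoc = assoc
  ; unit = I ; _⊗₀_ = _⊗_ ; _⊗₁_ = _⊗₁_
  ; ⊗-resp-≈ = ⊗-resp-≈ ; ⊗-id = ⊗-id ; ⊗-∘ = ⊗-∘
  ; α⇒ = α⇒ ; α⇐ = α⇐ ; λ⇒ = λ⇒ ; λ⇐ = λ⇐ ; ρ⇒ = ρ⇒ ; ρ⇐ = ρ⇐ ; σ = σ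
  ; α-isoˡ = α-isoˡ ; α-isoʳ = α-isoʳ ; λ-isoˡ = λ-isoˡ ; λ-isoʳ = λ-isoʳ
  ; ρ-isoˡ = ρ-isoˡ ; ρ-isoʳ = ρ-isoʳ ; σ-inv = σ-inv
  ; α-natural = α-natural ; λ-natural = λ-natural ; ρ-natural = ρ-natural ; σ-natural = σ-natural
  ; triangle = triangle ; pentagon = pentagon ; hexagon = hexagon
  ; copy = copy ; discard = discard ; discard-unique = discard-unique
  ; copy-assoc = copy-assoc ; copy-comm = copy-comm ; copy-unit = copy-unit ; copy-⊗ = copy-⊗
  }
  where open Syntax Σ

module FreeWiring (Σ : Signature) where
  open MarkovCategory (Free Σ)

  proj : ∀ {x A} → x ∈ᵗ A → A ⇒ var x
  proj here      = id
  proj (left i)  = proj i ∘ fst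
  proj (right i) = proj i ∘ snd

  wire : ∀ A B → Rewiring A B → A ⇒ B
  wire A I       r = discard
  wire A (var x) r = proj (r x here)
  wire A (B ⊗ B′) r =
    (wire A B (λ x i → r x (left i)) ⊗₁ wire A B′ (λ x i → r x (right i))) ∘ copy

Model : Signature → MarkovCategory o ℓ e → Set (o ⊔ ℓ ⊔ e)
Model Σ 𝒞 = Functor (Free Σ) 𝒞

module _ (Σ : Signature) (𝒞 : MarkovCategory o ℓ e) where
  open Signature Σ
  open MarkovCategory 𝒞
  private module S = Syntax Σ

  module Extend (ob : Type → Ob)
                (ch : ∀ q → Wiring.⟦_⟧ 𝒞 ob (⨂ (ins q)) ⇒ Wiring.⟦_⟧ 𝒞 ob (⨂ (outs q))) where
    open Wiring 𝒞 ob using (⟦_⟧)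

    ⟦_⟧₁ : ∀ {A B} → A S.⇒ B → ⟦ A ⟧ ⇒ ⟦ B ⟧
    ⟦ S.gen q ⟧₁   = ch q
    ⟦ S.id ⟧₁      = id
    ⟦ f S.∘ g ⟧₁   = ⟦ f ⟧₁ ∘ ⟦ g ⟧₁
    ⟦ f S.⊗₁ g ⟧₁  = ⟦ f ⟧₁ ⊗₁ ⟦ g ⟧₁
    ⟦ S.α⇒ ⟧₁      = α⇒
    ⟦ S.α⇐ ⟧₁      = α⇐
    ⟦ S.λ⇒ ⟧₁      = λ⇒
    ⟦ S.λ⇐ ⟧₁      = λ⇐
    ⟦ S.ρ⇒ ⟧₁      = ρ⇒
    ⟦ S.ρ⇐ ⟧₁      = ρ⇐
    ⟦ S.σ ⟧₁       = σ
    ⟦ S.copy ⟧₁    = copy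
    ⟦ S.discard ⟧₁ = discard

    ⟦⟧-resp-≈ : ∀ {A B} {f g : A S.⇒ B} → f S.≈ g → ⟦ f ⟧₁ ≈ ⟦ g ⟧₁
    ⟦⟧-resp-≈ S.≈-refl           = ≈.refl
    ⟦⟧-resp-≈ (S.≈-sym p)        = ≈.sym (⟦⟧-resp-≈ p)
    ⟦⟧-resp-≈ (S.≈-trans p q)    = ≈.trans (⟦⟧-resp-≈ p) (⟦⟧-resp-≈ q)
    ⟦⟧-resp-≈ (S.∘-resp-≈ p q)   = ∘-resp-≈ (⟦⟧-resp-≈ p) (⟦⟧-resp-≈ q)
    ⟦⟧-resp-≈ S.identityˡ        = identityˡ
    ⟦⟧-resp-≈ S.identityʳ        = identityʳ
    ⟦⟧-resp-≈ S.assoc            = assoc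
    ⟦⟧-resp-≈ (S.⊗-resp-≈ p q)   = ⊗-resp-≈ (⟦⟧-resp-≈ p) (⟦⟧-resp-≈ q)
    ⟦⟧-resp-≈ S.⊗-id             = ⊗-id
    ⟦⟧-resp-≈ S.⊗-∘              = ⊗-∘
    ⟦⟧-resp-≈ S.α-isoˡ           = α-isoˡ
    ⟦⟧-resp-≈ S.α-isoʳ           = α-isoʳ
    ⟦⟧-resp-≈ S.λ-isoˡ           = λ-isoˡ
    ⟦⟧-resp-≈ S.λ-isoʳ           = λ-isoʳ
    ⟦⟧-resp-≈ S.ρ-isoˡ           = ρ-isoˡ
    ⟦⟧-resp-≈ S.ρ-isoʳ           = ρ-isoʳ
    ⟦⟧-resp-≈ S.σ-inv            = σ-inv
    ⟦⟧-resp-≈ S.α-natural        = α-natural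
    ⟦⟧-resp-≈ S.λ-natural        = λ-natural
    ⟦⟧-resp-≈ S.ρ-natural        = ρ-natural
    ⟦⟧-resp-≈ S.σ-natural        = σ-natural
    ⟦⟧-resp-≈ S.triangle         = triangle
    ⟦⟧-resp-≈ S.pentagon         = pentagon
    ⟦⟧-resp-≈ S.hexagon          = hexagon
    ⟦⟧-resp-≈ (S.discard-unique f) = discard-unique ⟦ f ⟧₁
    ⟦⟧-resp-≈ S.copy-assoc       = copy-assoc
    ⟦⟧-resp-≈ S.copy-comm        = copy-comm
    ⟦⟧-resp-≈ S.copy-unit        = copy-unit
    ⟦⟧-resp-≈ S.copy-⊗           = copy-⊗

    private
      id-deterministic : ∀ {A} → Deterministic (id {A})
      id-deterministic = ≈.trans identityʳ (≈.sym (≈.trans (∘-resp-≈ ⊗-id ≈.refl) identityˡ))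

      drop : ∀ {X A B} {f : A ⊗₀ B ⇒ X} → f ∘ (id ∘ (id ⊗₁ id)) ≈ f
      drop = ≈.trans (∘-resp-≈ ≈.refl (≈.trans identityˡ ⊗-id)) identityʳ

    extend : Model Σ 𝒞
    extend = record
      { F₀ = ⟦_⟧ ; F₁ = ⟦_⟧₁ ; F-resp-≈ = ⟦⟧-resp-≈
      ; identity = ≈.refl ; homomorphism = ≈.refl
      ; ε = id ; ε⁻¹ = id ; μ = id ; μ⁻¹ = id
      ; ε-isoˡ = identityˡ ; ε-isoʳ = identityˡ ; μ-isoˡ = identityˡ ; μ-isoʳ = identityˡ
      ; μ-natural     = ≈.trans identityˡ (≈.sym identityʳ)
      ; associativity = ≈.trans drop (≈.sym (≈.trans identityˡ
                          (≈.trans (∘-resp-≈ ⊗-id ≈.refl) identityˡ)))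
      ; unitalityˡ = drop
      ; unitalityʳ = drop
      ; braided    = ≈.trans identityʳ (≈.sym identityˡ)
      ; copy-preserving = ≈.sym identityˡ
      ; ε-deterministic = id-deterministic
      ; μ-deterministic = id-deterministic
      }

elems : Subset n → List (Fin n)
elems S = filter (_∈? S) (allFin _)

∈-elems⁺ : ∀ {S : Subset n} {x} → x ∈ S → x ∈ˡ elems S
∈-elems⁺ {S = S} {x} = ∈-filter⁺ (_∈? S) (∈-allFin x)

∈-elems⁻ : ∀ {S : Subset n} {x} → x ∈ˡ elems S → x ∈ S
∈-elems⁻ {n} {S} i = proj₂ (∈-filter⁻ (_∈? S) {xs = allFin n} i)

elems-distinct : (S : Subset n) → Distinct (⨂ (elems S))
elems-distinct {n} S = ⨂-distinct (unique-filter⁺ (_∈? S) (unique-allFin⁺ n))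
  where
  ⨂-distinct : ∀ {xs : List (Fin n)} → Unique xs → Distinct (⨂ xs)
  ⨂-distinct (_ ∷ _) x (left here) (left here) = refl
  ⨂-distinct (x∉ ∷ _) x (left here) (right j) = ⊥-elim (All.lookup x∉ (at⁻¹ j) refl)
  ⨂-distinct (x∉ ∷ _) x (right i) (left here) = ⊥-elim (All.lookup x∉ (at⁻¹ i) refl)
  ⨂-distinct (_ ∷ u) x (right i) (right j) = cong right (⨂-distinct u x i j)

vars : Obj (Fin n) → Subset n
vars I       = ⊥
vars (var x) = ⁅ x ⁆
vars (A ⊗ B) = vars A ∪ vars B

∈-vars⁺ : ∀ {A : Obj (Fin n)} {x} → x ∈ᵗ A → x ∈ vars A
∈-vars⁺ here      = x∈⁅x⁆ _
∈-vars⁺ (left i)  = p⊆p∪q _ (∈-vars⁺ i)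
∈-vars⁺ (right i) = q⊆p∪q _ _ (∈-vars⁺ i)

∈-vars⁻ : ∀ {A : Obj (Fin n)} {x} → x ∈ vars A → x ∈ᵗ A
∈-vars⁻ {A = I}     i = ⊥-elim (∉⊥ i)
∈-vars⁻ {A = var y} i with refl ← x∈⁅y⁆⇒x≡y y i = here
∈-vars⁻ {A = A ⊗ B} i with x∈p∪q⁻ (vars A) (vars B) i
... | inj₁ j = left (∈-vars⁻ j)
... | inj₂ j = right (∈-vars⁻ j)

vars-elems : (S : Subset n) → vars (⨂ (elems S)) ≡ S
vars-elems S = ⊆-antisym
  (λ i → ∈-elems⁻ (at⁻¹ (∈-vars⁻ i)))
  (λ i → ∈-vars⁺ (at (∈-elems⁺ i)))

vars-bind : ∀ {m} (f : Fin m → Obj (Fin n)) xs →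
            vars (bind f (⨂ xs)) ≡ ⋃ (map (vars ∘ᶠ f) xs)
vars-bind f []       = refl
vars-bind f (x ∷ xs) = cong (vars (f x) ∪_) (vars-bind f xs)

-- Objects with distinct factors are lists of distinct variables, so two of
-- them with the same variables are identified in exactly one way.

by-name : {A B : Obj (Fin n)} → vars B ≡ vars A → Rewiring A B
by-name eq x i = ∈-vars⁻ (subst (x ∈_) eq (∈-vars⁺ i))

arrange : {A B : Obj (Fin n)} → Distinct A → Distinct B → vars A ≡ vars B → Arrangement A B
arrange dA dB eq x = mk↔ₛ′ (by-name eq x) (by-name (sym eq) x) (λ _ → dB x _ _) (λ _ → dA x _ _)

module _ {nL nH : ℕ} (π : Fin nH → Subset nL) where

  image : Subset nH → Subset nL
  image S = ⋃ (map π (elems S))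

vars-image : ∀ {nL nH} (f : Fin nH → Obj (Fin nL)) (S : Subset nH) →
             vars (bind f (⨂ (elems S))) ≡ vars (⨂ (elems (image (vars ∘ᶠ f) S)))
vars-image f S = trans (vars-bind f (elems S)) (sym (vars-elems _))

-- X i and U i are the objects of the i-th endogenous and exogenous variable;
-- the edges are i → j for i ∈ Pa j, together with Uᵢ → Xᵢ.

record FCM (𝒞 : MarkovCategory o ℓ e) : Set (o ⊔ ℓ ⊔ e) where
  open MarkovCategory 𝒞
  field
    size    : ℕ
    Pa      : Fin size → Subset size
    acyclic : ∀ i → ¬ TransClosure (λ j k → j ∈ Pa k) i i
    X       : Fin size → Ob
    U       : Fin size → Ob

  open Wiring 𝒞 X public
  module Exo = Wiring 𝒞 U

  field
    state : ∀ i → unit ⇒ U i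
    mech  : ∀ i → ⟦ ⨂ (elems (Pa i)) ⟧ ⊗₀ U i ⇒ X i
    mech-deterministic : ∀ i → Deterministic (mech i)

module TopologicalOrder {n : ℕ} (Pa : Fin n → Subset n)
                        (acyclic : ∀ i → ¬ TransClosure (λ j k → j ∈ Pa k) i i) where

  open DecMembership (Fin._≟_ {n}) using () renaming (_∈?_ to _∈ˡ?_)

  data Ordering : List (Fin n) → Set where
    []  : Ordering []
    add : ∀ {is} i → (∀ {j} → j ∈ Pa i → j ∈ˡ is) → Ordering is → Ordering (i ∷ is)

  private
    _⊏_ : Fin n → Fin n → Set
    j ⊏ k = j ∈ Pa k

    wf : WellFounded _⊏_
    wf = wellFounded⁻ _⊏_ (spo-wellFounded record
      { isEquivalence = isEquivalence
      ; irrefl = λ { refl c → acyclic _ c }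
      ; trans = transitive _⊏_
      ; <-resp-≈ = (λ { refl c → c }) , (λ { refl c → c })
      })

    Extension : List (Fin n) → (List (Fin n) → Set) → Set
    Extension is P = Σ[ js ∈ List (Fin n) ] Ordering js × (∀ {k} → k ∈ˡ is → k ∈ˡ js) × P js

    Visit : Fin n → Set
    Visit k = ∀ {is} → Ordering is → Extension is (k ∈ˡ_)

    visitAll : ∀ ks → (∀ k → k ∈ˡ ks → Visit k) → ∀ {is} → Ordering is →
               Extension is (λ js → ∀ {k} → k ∈ˡ ks → k ∈ˡ js)
    visitAll []       v t = _ , t , (λ k∈ → k∈) , λ ()
    visitAll (k ∷ ks) v t with v k (here refl) t
    ... | js , u , is⊆js , k∈js with visitAll ks (λ k′ k′∈ → v k′ (there k′∈)) u
    ...   | js′ , u′ , js⊆js′ , ks⊆js′ =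
      js′ , u′ , (λ i∈ → js⊆js′ (is⊆js i∈)) , λ { (here refl) → js⊆js′ k∈js ; (there i∈) → ks⊆js′ i∈ }

    visit : ∀ i → Acc _⊏_ i → Visit i
    visit i (acc rs) t with visitAll (elems (Pa i)) (λ k k∈ → visit k (rs (∈-elems⁻ k∈))) t
    ... | js , u , is⊆js , ps⊆js with i ∈ˡ? js
    ...   | yes i∈ = js , u , is⊆js , i∈
    ...   | no  _  = i ∷ js , add i (λ j∈ → ps⊆js (∈-elems⁺ j∈)) u , (λ k∈ → there (is⊆js k∈)) , here refl

    total : Extension [] (λ js → ∀ {k} → k ∈ˡ allFin n → k ∈ˡ js)
    total = visitAll (allFin n) (λ k _ → visit k (wf k)) []

  order : List (Fin n)
  order = proj₁ total

  ordering : Ordering order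
  ordering = proj₁ (proj₂ total)

  order-complete : ∀ i → i ∈ˡ order
  order-complete i = proj₂ (proj₂ (proj₂ total)) (∈-allFin i)

module Interventions {𝒞 : MarkovCategory o ℓ e} (M : FCM 𝒞) where
  open MarkovCategory 𝒞
  open FCM M
  open TopologicalOrder Pa acyclic

  Uₜ : Ob
  Uₜ = Exo.⟦ ⨂ (allFin size) ⟧

  λs : unit ⇒ Uₜ
  λs = go (allFin size)
    where
    go : ∀ is → unit ⇒ Exo.⟦ ⨂ is ⟧
    go []       = id
    go (i ∷ is) = (state i ⊗₁ go is) ∘ λ⇐

  module _ (S : Subset size) where

    -- The value of Xᵢ given the inputs U, S and the values of variables `is`
    -- among which the parents of Xᵢ are: an intervened variable is read from
    -- the inputs, its mechanism being deleted.

    value : ∀ is i → (∀ {j} → j ∈ Pa i → j ∈ˡ is) →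
            (Uₜ ⊗₀ ⟦ ⨂ (elems S) ⟧) ⊗₀ ⟦ ⨂ is ⟧ ⇒ X i
    value is i pa with i ∈? S
    ... | yes i∈S = proj (at (∈-elems⁺ i∈S)) ∘ (snd ∘ fst)
    ... | no  _   = mech i ∘
      ((wire (⨂ is) (⨂ (elems (Pa i))) (λ j k → at (pa (∈-elems⁻ (at⁻¹ k)))) ∘ snd) ⊗₁
       (Exo.proj (at (∈-allFin i)) ∘ (fst ∘ fst))) ∘ copy

    -- The network in which the mechanism of each variable of `is` outside S
    -- occurs once, with all inputs and values copied to the output.

    network : ∀ {is} → Ordering is →
              Uₜ ⊗₀ ⟦ ⨂ (elems S) ⟧ ⇒ (Uₜ ⊗₀ ⟦ ⨂ (elems S) ⟧) ⊗₀ ⟦ ⨂ is ⟧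
    network []           = ρ⇐
    network (add {is} i pa t) =
      (α⇒ ∘ (σ ⊗₁ id) ∘ α⇐) ∘ (value is i pa ⊗₁ id) ∘ copy ∘ network t

    Do : (Y : Subset size) → Uₜ ⊗₀ ⟦ ⨂ (elems S) ⟧ ⇒ ⟦ ⨂ (elems Y) ⟧
    Do Y = wire (⨂ order) (⨂ (elems Y)) (λ j _ → at (order-complete j)) ∘ snd ∘ network ordering

-- query Ys Xs stands for [Y₁|X₁,…,Yₘ|Xₘ].

record CFQuery (n : ℕ) : Set where
  constructor query
  field
    {arity} : ℕ
    Ys Xs   : Vec (Subset n) arity

concatElems : ∀ {m} → Vec (Subset n) m → List (Fin n)
concatElems []       = []
concatElems (S ∷ Ss) = elems S ++ concatElems Ss

CF : ℕ → Signature
CF n = record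
  { Type  = Fin n
  ; Query = CFQuery n
  ; ins   = λ q → concatElems (CFQuery.Xs q)
  ; outs  = λ q → concatElems (CFQuery.Ys q)
  }

module Semantics {𝒞 : MarkovCategory o ℓ e} (M : FCM 𝒞) where
  open MarkovCategory 𝒞
  open FCM M
  open Interventions M

  power : ℕ → Ob
  power zero    = unit
  power (suc m) = Uₜ ⊗₀ power m

  copies : ∀ m → Uₜ ⇒ power m
  copies zero    = discard
  copies (suc m) = (id ⊗₁ copies m) ∘ copy

  Args : ∀ {m} → Vec (Subset size) m → Ob
  Args []       = unit
  Args (X ∷ Xs) = (Uₜ ⊗₀ ⟦ ⨂ (elems X) ⟧) ⊗₀ Args Xs

  distribute : ∀ {m} (Xs : Vec (Subset size) m) → power m ⊗₀ ⟦ ⨂ (concatElems Xs) ⟧ ⇒ Args Xs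
  distribute []       = λ⇒
  distribute (X ∷ Xs) =
    (id ⊗₁ distribute Xs) ∘ interchange ∘ (id ⊗₁ split (elems X) (concatElems Xs))

  parallel : ∀ {m} (Ys Xs : Vec (Subset size) m) → Args Xs ⇒ ⟦ ⨂ (concatElems Ys) ⟧
  parallel []       []       = id
  parallel (Y ∷ Ys) (X ∷ Xs) = join (elems Y) (concatElems Ys) ∘ (Do X Y ⊗₁ parallel Ys Xs)

  channel : (q : CFQuery size) →
            ⟦ ⨂ (concatElems (CFQuery.Xs q)) ⟧ ⇒ ⟦ ⨂ (concatElems (CFQuery.Ys q)) ⟧
  channel (query {m} Ys Xs) =
    parallel Ys Xs ∘ distribute Xs ∘ ((copies m ∘ λs) ⊗₁ id) ∘ λ⇐

  model : Model (CF size) 𝒞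
  model = Extend.extend (CF size) 𝒞 X channel

-- The canonical isomorphism between the value of a functor at a formal tensor
-- product and the tensor product of its values at the factors.

module _ {Σ Σ′ : Signature} (π : Functor (Free Σ) (Free Σ′)) where
  open Functor π
  open MarkovCategory (Free Σ′)

  onTypes : Signature.Type Σ → Obj (Signature.Type Σ′)
  onTypes t = F₀ (var t)

  unpack : ∀ A → F₀ A ⇒ bind onTypes A
  unpack I       = ε⁻¹
  unpack (var t) = id
  unpack (A ⊗ B) = (unpack A ⊗₁ unpack B) ∘ μ⁻¹

  -- π sends the generator q to the generator q′, under the given
  -- identifications of π (ins q) with ins q′ and of π (outs q) with outs q′.

  Sends : (q : Signature.Query Σ) (q′ : Signature.Query Σ′) →
          Arrangement (bind onTypes (⨂ (Signature.ins Σ q))) (⨂ (Signature.ins Σ′ q′)) →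
          Arrangement (bind onTypes (⨂ (Signature.outs Σ q))) (⨂ (Signature.outs Σ′ q′)) →
          Set
  Sends q q′ aᵢ aₒ =
    wire _ _ (Arr.from aₒ) ∘ (unpack _ ∘ F₁ (Syntax.gen q)) ≈
    Syntax.gen q′ ∘ (wire _ _ (Arr.from aᵢ) ∘ unpack _)
    where open FreeWiring Σ′

record DownwardAbstraction {𝒞 : MarkovCategory o ℓ e} {ΣL ΣH : Signature}
                           (L : Model ΣL 𝒞) (H : Model ΣH 𝒞) : Set (o ⊔ ℓ ⊔ e) where
  open MarkovCategory 𝒞 using (Epic)
  field
    π : Functor (Free ΣH) (Free ΣL)
    π-queries : ∀ q → ∃[ q′ ] ∃[ aᵢ ] ∃[ aₒ ] Sends π q q′ aᵢ aₒ
    τ : NaturalTransformation (L ∘F π) H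
    τ-epic : ∀ A → Epic (NaturalTransformation.η τ A)

module _ {nL nH : ℕ} (f : Fin nH → Obj (Fin nL))
         (distinct : ∀ S → Distinct (bind f (⨂ (elems S)))) where

  arrangeAll : ∀ {m} (Ss : Vec (Subset nH) m) →
               Arrangement (bind f (⨂ (concatElems Ss)))
                           (⨂ (concatElems (Vec.map (image (vars ∘ᶠ f)) Ss)))
  arrangeAll []       = Arr.idₐ
  arrangeAll (S ∷ Ss) =
    Arr.transₐ (Arr.bind-⨂-++ f (elems S) (concatElems Ss))
      (Arr.transₐ
        (Arr._⊗ₐ_ (arrange (distinct S) (elems-distinct _) (vars-image f S)) (arrangeAll Ss))
        (Arr.symₐ (Arr.⨂-++ (elems (image (vars ∘ᶠ f) S)) _)))

module _ {𝒞 : MarkovCategory o ℓ e} (L H : FCM 𝒞) where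
  open MarkovCategory 𝒞
  private
    module L = FCM L
    module H = FCM H
    ⟦L⟧ = Semantics.model L
    ⟦H⟧ = Semantics.model H

  mapQuery : (Subset H.size → Subset L.size) → CFQuery H.size → CFQuery L.size
  mapQuery g (query Ys Xs) = query (Vec.map g Ys) (Vec.map g Xs)

  -- `sets` says that each π(S) is a set of variables, as is presupposed in
  -- writing the query [π(Y₁)|π(X₁),…,π(Yₘ)|π(Xₘ)].

  record CounterfactualDownward : Set (o ⊔ ℓ ⊔ e) where
    field
      downward : DownwardAbstraction ⟦L⟧ ⟦H⟧
    open DownwardAbstraction downward public

    π-var : Fin H.size → Obj (Fin L.size)
    π-var = onTypes π

    π-set : Fin H.size → Subset L.size
    π-set x = vars (π-var x)

    field
      sets : ∀ S → Distinct (bind π-var (⨂ (elems S)))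
      on-queries : ∀ q → Sends π q (mapQuery (image π-set) q)
                           (arrangeAll π-var sets (CFQuery.Xs q))
                           (arrangeAll π-var sets (CFQuery.Ys q))

  -- Functors out of a free Markov category being determined by their values
  -- on types and queries up to isomorphism only, (π , τ) and (π′ , τ′) count as
  -- equal when π ≅ π′ compatibly with τ and τ′, by an isomorphism which at each
  -- variable identifies π(X) and π′(X) as the same set of variables.

  record _≈ᴰ_ (D D′ : CounterfactualDownward) : Set (o ⊔ ℓ ⊔ e) where
    private
      module D  = CounterfactualDownward D
      module D′ = CounterfactualDownward D′
    field
      same-sets : ∀ x → D.π-set x ≡ D′.π-set x
      θ         : NaturalIsomorphism D.π D′.π
    open NaturalIsomorphism θ
    open FreeWiring (CF L.size) using () renaming (wire to wireᴸ)
    field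
      θ-var : ∀ x → MarkovCategory._≈_ (Free (CF L.size))
                      (η (var x)) (wireᴸ (D.π-var x) (D′.π-var x) (by-name (sym (same-sets x))))
      θ-τ   : ∀ A → NaturalTransformation.η D′.τ A ∘ Functor.F₁ ⟦L⟧ (η A)
                      ≈ NaturalTransformation.η D.τ A

  record OnVariables : Set ℓ where
    field
      π : Fin H.size → Subset L.size
      τ : ∀ x → L.⟦ ⨂ (elems (π x)) ⟧ ⇒ H.X x

    π-obj : Fin H.size → Obj (Fin L.size)
    π-obj x = ⨂ (elems (π x))

    τ⨂ : ∀ A → L.⟦ bind π-obj A ⟧ ⇒ H.⟦ A ⟧
    τ⨂ I       = id
    τ⨂ (var x) = τ x
    τ⨂ (A ⊗ B) = τ⨂ A ⊗₁ τ⨂ B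

    -- The sets π(x), x ∈ S, being disjoint, this precedes the tensor product
    -- of the τ x by the permutation from ⋃ π(x) to the tensor product of the π(x).

    τS : ∀ S → L.⟦ ⨂ (elems (image π S)) ⟧ ⇒ H.⟦ ⨂ (elems S) ⟧
    τS S = τ⨂ (⨂ (elems S)) ∘ L.wire A B (by-name eq)
      where
      A B : Obj (Fin L.size)
      A = ⨂ (elems (image π S))
      B = bind π-obj (⨂ (elems S))

      eq : vars B ≡ vars A
      eq = trans (vars-bind π-obj (elems S))
             (trans (cong ⋃ (map-vars (elems S))) (sym (vars-elems (image π S))))
        where
        map-vars : ∀ xs → map (vars ∘ᶠ π-obj) xs ≡ map π xs
        map-vars []       = refl
        map-vars (x ∷ xs) = cong₂ _∷_ (vars-elems (π x)) (map-vars xs)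

    τSs : ∀ {m} (Ss : Vec (Subset H.size) m) →
          L.⟦ ⨂ (concatElems (Vec.map (image π) Ss)) ⟧ ⇒ H.⟦ ⨂ (concatElems Ss) ⟧
    τSs []       = id
    τSs (S ∷ Ss) = H.join (elems S) (concatElems Ss) ∘
                   (τS S ⊗₁ τSs Ss) ∘
                   L.split (elems (image π S)) (concatElems (Vec.map (image π) Ss))

  record CounterfactualAbstraction : Set (o ⊔ ℓ ⊔ e) where
    field
      onVariables : OnVariables
    open OnVariables onVariables public
    field
      disjoint      : ∀ {x y} → x ≢ y → Empty (π x ∩ π y)
      deterministic : ∀ x → Deterministic (τ x)
      epic          : ∀ A → Epic (τ⨂ A)
      consistent    : ∀ q →
        τSs (CFQuery.Ys q) ∘ Semantics.channel L (mapQuery (image π) q)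
          ≈ Semantics.channel H q ∘ τSs (CFQuery.Xs q)

  record _≈ⱽ_ (a b : OnVariables) : Set e where
    private
      module a = OnVariables a
      module b = OnVariables b
    field
      same-π : ∀ x → a.π x ≡ b.π x
      same-τ : ∀ x → subst (λ S → L.⟦ ⨂ (elems S) ⟧ ⇒ H.X x) (same-π x) (a.τ x) ≈ b.τ x

  _≈ᴬ_ : CounterfactualAbstraction → CounterfactualAbstraction → Set e
  A ≈ᴬ B = CounterfactualAbstraction.onVariables A ≈ⱽ CounterfactualAbstraction.onVariables B

  restrictToVariables : CounterfactualDownward → OnVariables
  restrictToVariables D = record
    { π = π-set
    ; τ = λ x → NaturalTransformation.η τ (var x) ∘
                L.wire (⨂ (elems (π-set x))) (π-var x) (by-name (sym (vars-elems (π-set x))))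
    }
    where open CounterfactualDownward D

module Submission where

open import Defs
open import Level using (Level)
open import Data.Empty using (⊥-elim)
open import Data.Fin.Base using (Fin)
open import Data.Fin.Subset using (Subset; _∪_; _∩_; ⁅_⁆; ⋃; Empty)
open import Data.Fin.Subset.Properties using (_∈?_; x∈⁅x⁆; x∈p∪q⁺; x∈p∩q⁻; x∈p∩q⁺)
import Data.Fin.Properties as Fin
open import Data.List.Base using ([]; _∷_; _++_)
open import Data.List.Membership.Propositional using () renaming (_∈_ to _∈ˡ_)
open import Data.List.Properties using (map-cong)
import Data.List.Relation.Unary.All as All
open import Data.List.Relation.Unary.AllPairs using ([]; _∷_)
open import Data.List.Relation.Unary.Unique.Propositional using (Unique)
open import Data.List.Relation.Unary.Unique.Propositional.Properties using (filter⁺; allFin⁺)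
open import Data.Nat.Base using (ℕ)
open import Data.Product using (Σ-syntax; _×_; _,_; proj₁; proj₂)
open import Data.Sum using (inj₁; inj₂)
open import Data.Vec.Base as Vec using (Vec; []; _∷_)
open import Data.Vec.Relation.Binary.Pointwise.Inductive using (Pointwise; []; _∷_)
open import Function.Base using () renaming (_∘_ to _∘ᶠ_)
open import Function.Bundles using (module Inverse)
open import Function.Definitions using (Congruent; Bijective)
open import Relation.Binary.PropositionalEquality
  using (_≡_; _≢_; refl; sym; trans; cong; cong₂; subst)
open import Relation.Binary.PropositionalEquality.WithK using (≡-irrelevant)
open import Relation.Nullary using (yes; no)

-- A monoidal family of maps between two functors out of a free Markov category
-- is determined by its components at the types, and it is natural as soon as its
-- components are deterministic and it is natural at the generators.  Once π(q) is
-- identified with the query on the image sets, naturality of τ at the query q is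
-- the consistency equation at q; this yields both the restriction and its surjectivity.
-- If two downward abstractions agree on variables, the permutations matching π(X) with
-- π′(X) by name extend to a monoidal family π ⇒ π′, natural by the same criterion.
--
-- The identifications are all permutations of wires.  Deterministic maps into a tensor
-- product being determined by their projections, wires compose as functions on positions,
-- and any two wires out of an object with distinct factors agree.

-- A strong monoidal `π` yields objects `π(X)` with factors in an arbitrary order and bracketing,
-- and `π(S)` is only isomorphic to the tensor product of the `π(X)`, while the query on the image
-- sets lists its variables in the fixed order of `elems`. Every statement about a query therefore
-- passes through `unpack` followed by a permutation; these being invertible, they can be cancelled
-- when naturality is turned into consistency. Within one set the variables are distinct, so names
-- determine the permutation. A query may however mention a variable in several of its sets, and
-- there names determine nothing: the identification has to be built, and compared, block by block.
-- For surjectivity, `π` exists by freeness once each query is given an image: the image query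
-- conjugated by these permutations. Its restriction has sets that equal the original ones only up
-- to a proof, so transports along equalities of sets are rewritten as wires and handled by the same
-- calculus.

private
  variable
    o ℓ e : Level
    T T′ : Set
    nL nH : ℕ

-- Markov categories: deterministic maps into A ⊗ B are pairs

module MarkovProperties (𝒞 : MarkovCategory o ℓ e) where
  open MarkovCategory 𝒞
  open ≈-Reasoning

  private
    variable
      A B C D Z Z′ : Ob

  infixr 4 _⟩∘⟨_ refl⟩∘⟨_ _⟩⊗⟨_
  infixl 5 _⟩∘⟨refl

  _⟩∘⟨_ : {f h : B ⇒ C} {g i : A ⇒ B} → f ≈ h → g ≈ i → f ∘ g ≈ h ∘ i
  _⟩∘⟨_ = ∘-resp-≈

  refl⟩∘⟨_ : {f : B ⇒ C} {g i : A ⇒ B} → g ≈ i → f ∘ g ≈ f ∘ i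
  refl⟩∘⟨_ = ∘-resp-≈ ≈.refl

  _⟩∘⟨refl : {f h : B ⇒ C} {g : A ⇒ B} → f ≈ h → f ∘ g ≈ h ∘ g
  p ⟩∘⟨refl = ∘-resp-≈ p ≈.refl

  _⟩⊗⟨_ : {f h : A ⇒ B} {g i : C ⇒ D} → f ≈ h → g ≈ i → f ⊗₁ g ≈ h ⊗₁ i
  _⟩⊗⟨_ = ⊗-resp-≈

  ≈-reflexive : {f g : A ⇒ B} → f ≡ g → f ≈ g
  ≈-reflexive refl = ≈.refl

  pullˡ : {f : Z ⇒ A} {g : A ⇒ B} {h : B ⇒ C} {k : A ⇒ C} → h ∘ g ≈ k → h ∘ (g ∘ f) ≈ k ∘ f
  pullˡ p = ≈.trans (≈.sym assoc) (p ⟩∘⟨refl)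

  pushˡ : {f : Z ⇒ A} {g : A ⇒ B} {h : B ⇒ C} {k : A ⇒ C} → k ≈ h ∘ g → k ∘ f ≈ h ∘ (g ∘ f)
  pushˡ p = ≈.trans (p ⟩∘⟨refl) assoc

  pullʳ : {f : Z ⇒ A} {g : A ⇒ B} {h : B ⇒ C} {k : Z ⇒ B} → g ∘ f ≈ k → (h ∘ g) ∘ f ≈ h ∘ k
  pullʳ p = ≈.trans assoc (refl⟩∘⟨ p)

  extendʳ : {f : Z ⇒ A} {g : A ⇒ B} {h : B ⇒ C} {g′ : A ⇒ D} {h′ : D ⇒ C} →
            h ∘ g ≈ h′ ∘ g′ → h ∘ (g ∘ f) ≈ h′ ∘ (g′ ∘ f)
  extendʳ p = ≈.trans (pullˡ p) assoc

  cancelˡ : {f : Z ⇒ A} {g : A ⇒ B} {h : B ⇒ A} → h ∘ g ≈ id → h ∘ (g ∘ f) ≈ f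
  cancelˡ p = ≈.trans (pullˡ p) identityˡ

  cancelʳ : {f : A ⇒ C} {g : A ⇒ B} {h : B ⇒ A} → h ∘ g ≈ id → (f ∘ h) ∘ g ≈ f
  cancelʳ p = ≈.trans (pullʳ p) identityʳ

  isoEpic : {f : A ⇒ B} {f⁻¹ : B ⇒ A} → f ∘ f⁻¹ ≈ id → Epic f
  isoEpic {f = f} {f⁻¹} p g h q = begin
    g                ≈⟨ cancelʳ p ⟨
    (g ∘ f) ∘ f⁻¹    ≈⟨ q ⟩∘⟨refl ⟩
    (h ∘ f) ∘ f⁻¹    ≈⟨ cancelʳ p ⟩
    h                ∎

  isoMonic : {f : A ⇒ B} {f⁻¹ : B ⇒ A} → f⁻¹ ∘ f ≈ id → {g h : Z ⇒ A} → f ∘ g ≈ f ∘ h → g ≈ h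
  isoMonic {f = f} {f⁻¹} p {g} {h} q = begin
    g                ≈⟨ cancelˡ p ⟨
    f⁻¹ ∘ (f ∘ g)    ≈⟨ refl⟩∘⟨ q ⟩
    f⁻¹ ∘ (f ∘ h)    ≈⟨ cancelˡ p ⟩
    h                ∎

  ∘-epic : {f : B ⇒ C} {g : A ⇒ B} → Epic f → Epic g → Epic (f ∘ g)
  ∘-epic p q h k r = p h k (q _ _ (≈.trans assoc (≈.trans r (≈.sym assoc))))

  Epic-resp-≈ : {f g : A ⇒ B} → f ≈ g → Epic f → Epic g
  Epic-resp-≈ p q h k r = q h k (≈.trans (refl⟩∘⟨ p) (≈.trans r (refl⟩∘⟨ ≈.sym p)))

  ⊗-square : ∀ {A′ B′ C′ D′} {f : A ⇒ B} {g : B ⇒ D} {h : A ⇒ C} {k : C ⇒ D}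
             {f′ : A′ ⇒ B′} {g′ : B′ ⇒ D′} {h′ : A′ ⇒ C′} {k′ : C′ ⇒ D′} →
             g ∘ f ≈ k ∘ h → g′ ∘ f′ ≈ k′ ∘ h′ → (g ⊗₁ g′) ∘ (f ⊗₁ f′) ≈ (k ⊗₁ k′) ∘ (h ⊗₁ h′)
  ⊗-square p q = ≈.trans (≈.sym ⊗-∘) (≈.trans (p ⟩⊗⟨ q) ⊗-∘)

  idˡ-square : {f : A ⇒ B} → id ∘ f ≈ f ∘ id
  idˡ-square = ≈.trans identityˡ (≈.sym identityʳ)

  idʳ-square : {f : A ⇒ B} → f ∘ id ≈ id ∘ f
  idʳ-square = ≈.sym idˡ-square

  ⊗-swap : {f : A ⇒ B} {g : C ⇒ D} → (f ⊗₁ id) ∘ (id ⊗₁ g) ≈ (id ⊗₁ g) ∘ (f ⊗₁ id)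
  ⊗-swap = ⊗-square idʳ-square idˡ-square

  ⊗-∘ˡ : {f : B ⇒ C} {g : A ⇒ B} → (f ∘ g) ⊗₁ id {Z} ≈ (f ⊗₁ id) ∘ (g ⊗₁ id)
  ⊗-∘ˡ = ≈.trans (≈.refl ⟩⊗⟨ ≈.sym identityˡ) ⊗-∘

  ⊗-∘ʳ : {f : B ⇒ C} {g : A ⇒ B} → id {Z} ⊗₁ (f ∘ g) ≈ (id ⊗₁ f) ∘ (id ⊗₁ g)
  ⊗-∘ʳ = ≈.trans (≈.sym identityˡ ⟩⊗⟨ ≈.refl) ⊗-∘

  ⊗-splitʳ : {f : A ⇒ B} {g : C ⇒ D} → f ⊗₁ g ≈ (f ⊗₁ id) ∘ (id ⊗₁ g)
  ⊗-splitʳ = ≈.trans (≈.sym identityʳ ⟩⊗⟨ ≈.sym identityˡ) ⊗-∘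

  ⊗-splitˡ : {f : A ⇒ B} {g : C ⇒ D} → f ⊗₁ g ≈ (id ⊗₁ g) ∘ (f ⊗₁ id)
  ⊗-splitˡ = ≈.trans ⊗-splitʳ ⊗-swap

  ⊗-inverse : {f : A ⇒ B} {f⁻¹ : B ⇒ A} {g : C ⇒ D} {g⁻¹ : D ⇒ C} →
              f⁻¹ ∘ f ≈ id → g⁻¹ ∘ g ≈ id → (f⁻¹ ⊗₁ g⁻¹) ∘ (f ⊗₁ g) ≈ id
  ⊗-inverse p q = ≈.trans (≈.sym ⊗-∘) (≈.trans (p ⟩⊗⟨ q) ⊗-id)

  conjugate : {f : A ⇒ B} {f⁻¹ : B ⇒ A} {g : C ⇒ D} {g⁻¹ : D ⇒ C} {h : A ⇒ C} {k : B ⇒ D} →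
              f ∘ f⁻¹ ≈ id → g⁻¹ ∘ g ≈ id → g ∘ h ≈ k ∘ f → h ∘ f⁻¹ ≈ g⁻¹ ∘ k
  conjugate {f = f} {f⁻¹} {g} {g⁻¹} {h} {k} p q r = begin
    h ∘ f⁻¹                ≈⟨ cancelˡ q ⟨
    g⁻¹ ∘ (g ∘ (h ∘ f⁻¹))  ≈⟨ refl⟩∘⟨ extendʳ r ⟩
    g⁻¹ ∘ (k ∘ (f ∘ f⁻¹))  ≈⟨ refl⟩∘⟨ ≈.trans (refl⟩∘⟨ p) identityʳ ⟩
    g⁻¹ ∘ k                ∎

  α⇐-natural : {f : A ⇒ Z} {g : B ⇒ C} {h : D ⇒ Z′} →
               α⇐ ∘ (f ⊗₁ (g ⊗₁ h)) ≈ ((f ⊗₁ g) ⊗₁ h) ∘ α⇐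
  α⇐-natural = ≈.sym (conjugate α-isoʳ α-isoˡ α-natural)

  -- The remaining unit coherences, after Kelly.

  unit⊗-faithful : {f g : A ⇒ B} → id {unit} ⊗₁ f ≈ id ⊗₁ g → f ≈ g
  unit⊗-faithful {f = f} {g} p = isoEpic λ-isoʳ f g
    (≈.trans (≈.sym λ-natural) (≈.trans (refl⟩∘⟨ p) λ-natural))

  ⊗unit-faithful : {f g : A ⇒ B} → f ⊗₁ id {unit} ≈ g ⊗₁ id → f ≈ g
  ⊗unit-faithful {f = f} {g} p = isoEpic ρ-isoʳ f g
    (≈.trans (≈.sym ρ-natural) (≈.trans (refl⟩∘⟨ p) ρ-natural))

  -- After tensoring with the unit and precomposing with invertible associators, the equation
  -- follows from the pentagon and two triangles; both operations can be undone.
  λ-⊗ : λ⇒ {A ⊗₀ B} ∘ α⇒ ≈ λ⇒ ⊗₁ id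
  λ-⊗ = unit⊗-faithful (isoEpic (≈.trans (pullʳ (cancelˡ (⊗-inverse α-isoʳ identityˡ))) α-isoʳ) _ _ (begin
    (id ⊗₁ (λ⇒ ∘ α⇒)) ∘ (α⇒ ∘ (α⇒ ⊗₁ id))          ≈⟨ pushˡ ⊗-∘ʳ ⟩
    (id ⊗₁ λ⇒) ∘ ((id ⊗₁ α⇒) ∘ (α⇒ ∘ (α⇒ ⊗₁ id)))  ≈⟨ refl⟩∘⟨ pentagon ⟩
    (id ⊗₁ λ⇒) ∘ (α⇒ ∘ α⇒)                         ≈⟨ pullˡ triangle ⟩
    (ρ⇒ ⊗₁ id) ∘ α⇒                                ≈⟨ (≈.refl ⟩⊗⟨ ≈.sym ⊗-id) ⟩∘⟨refl ⟩
    (ρ⇒ ⊗₁ (id ⊗₁ id)) ∘ α⇒                        ≈⟨ α-natural ⟨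
    α⇒ ∘ ((ρ⇒ ⊗₁ id) ⊗₁ id)                        ≈⟨ refl⟩∘⟨ (≈.sym triangle ⟩⊗⟨ ≈.refl) ⟩
    α⇒ ∘ (((id ⊗₁ λ⇒) ∘ α⇒) ⊗₁ id)                 ≈⟨ refl⟩∘⟨ ⊗-∘ˡ ⟩
    α⇒ ∘ (((id ⊗₁ λ⇒) ⊗₁ id) ∘ (α⇒ ⊗₁ id))         ≈⟨ extendʳ α-natural ⟩
    (id ⊗₁ (λ⇒ ⊗₁ id)) ∘ (α⇒ ∘ (α⇒ ⊗₁ id))         ∎))

  ρ-⊗ : (id ⊗₁ ρ⇒) ∘ α⇒ ≈ ρ⇒ {A ⊗₀ B}
  ρ-⊗ = ⊗unit-faithful (isoMonic α-isoˡ (begin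
    α⇒ ∘ (((id ⊗₁ ρ⇒) ∘ α⇒) ⊗₁ id)                 ≈⟨ refl⟩∘⟨ ⊗-∘ˡ ⟩
    α⇒ ∘ (((id ⊗₁ ρ⇒) ⊗₁ id) ∘ (α⇒ ⊗₁ id))         ≈⟨ extendʳ α-natural ⟩
    (id ⊗₁ (ρ⇒ ⊗₁ id)) ∘ (α⇒ ∘ (α⇒ ⊗₁ id))         ≈⟨ (≈.refl ⟩⊗⟨ ≈.sym triangle) ⟩∘⟨refl ⟩
    (id ⊗₁ ((id ⊗₁ λ⇒) ∘ α⇒)) ∘ (α⇒ ∘ (α⇒ ⊗₁ id))  ≈⟨ pushˡ ⊗-∘ʳ ⟩
    (id ⊗₁ (id ⊗₁ λ⇒)) ∘ ((id ⊗₁ α⇒) ∘ (α⇒ ∘ (α⇒ ⊗₁ id)))  ≈⟨ refl⟩∘⟨ pentagon ⟩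
    (id ⊗₁ (id ⊗₁ λ⇒)) ∘ (α⇒ ∘ α⇒)                 ≈⟨ extendʳ (≈.sym α-natural) ⟩
    α⇒ ∘ (((id ⊗₁ id) ⊗₁ λ⇒) ∘ α⇒)                 ≈⟨ refl⟩∘⟨ ≈.trans ((⊗-id ⟩⊗⟨ ≈.refl) ⟩∘⟨refl) triangle ⟩
    α⇒ ∘ (ρ⇒ ⊗₁ id)                                ∎))

  λ-σ : λ⇒ {A} ∘ σ ≈ ρ⇒
  λ-σ = ⊗unit-faithful (isoMonic σ-inv (begin
    σ ∘ ((λ⇒ ∘ σ) ⊗₁ id)                   ≈⟨ refl⟩∘⟨ ⊗-∘ˡ ⟩
    σ ∘ ((λ⇒ ⊗₁ id) ∘ (σ ⊗₁ id))           ≈⟨ refl⟩∘⟨ ≈.sym (pullˡ λ-⊗) ⟩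
    σ ∘ (λ⇒ ∘ (α⇒ ∘ (σ ⊗₁ id)))            ≈⟨ extendʳ (≈.sym λ-natural) ⟩
    λ⇒ ∘ ((id ⊗₁ σ) ∘ (α⇒ ∘ (σ ⊗₁ id)))    ≈⟨ refl⟩∘⟨ hexagon ⟩
    λ⇒ ∘ (α⇒ ∘ (σ ∘ α⇒))                   ≈⟨ pullˡ λ-⊗ ⟩
    (λ⇒ ⊗₁ id) ∘ (σ ∘ α⇒)                  ≈⟨ extendʳ (≈.sym σ-natural) ⟩
    σ ∘ ((id ⊗₁ λ⇒) ∘ α⇒)                  ≈⟨ refl⟩∘⟨ triangle ⟩
    σ ∘ (ρ⇒ ⊗₁ id)                         ∎))

  terminal : {f g : A ⇒ unit} → f ≈ g
  terminal = ≈.trans (discard-unique _) (≈.sym (discard-unique _))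

  -- Marginals of tensor products and of copies

  fst-⊗ : {f : A ⇒ B} {g : C ⇒ D} → fst ∘ (f ⊗₁ g) ≈ f ∘ fst
  fst-⊗ {f = f} {g} = begin
    (ρ⇒ ∘ (id ⊗₁ discard)) ∘ (f ⊗₁ g)  ≈⟨ pullʳ (≈.sym ⊗-∘) ⟩
    ρ⇒ ∘ ((id ∘ f) ⊗₁ (discard ∘ g))   ≈⟨ refl⟩∘⟨ (identityˡ ⟩⊗⟨ terminal) ⟩
    ρ⇒ ∘ (f ⊗₁ discard)                ≈⟨ refl⟩∘⟨ ⊗-splitʳ ⟩
    ρ⇒ ∘ ((f ⊗₁ id) ∘ (id ⊗₁ discard)) ≈⟨ extendʳ ρ-natural ⟩
    f ∘ fst                            ∎

  snd-⊗ : {f : A ⇒ B} {g : C ⇒ D} → snd ∘ (f ⊗₁ g) ≈ g ∘ snd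
  snd-⊗ {f = f} {g} = begin
    (λ⇒ ∘ (discard ⊗₁ id)) ∘ (f ⊗₁ g)  ≈⟨ pullʳ (≈.sym ⊗-∘) ⟩
    λ⇒ ∘ ((discard ∘ f) ⊗₁ (id ∘ g))   ≈⟨ refl⟩∘⟨ (terminal ⟩⊗⟨ identityˡ) ⟩
    λ⇒ ∘ (discard ⊗₁ g)                ≈⟨ refl⟩∘⟨ ⊗-splitˡ ⟩
    λ⇒ ∘ ((id ⊗₁ g) ∘ (discard ⊗₁ id)) ≈⟨ extendʳ λ-natural ⟩
    g ∘ snd                            ∎

  snd-σ : snd ∘ σ {A} {B} ≈ fst
  snd-σ = ≈.trans (pullʳ (≈.sym σ-natural)) (pullˡ λ-σ)

  fst-σ : fst ∘ σ {A} {B} ≈ snd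
  fst-σ = ≈.trans (≈.sym snd-σ ⟩∘⟨refl) (cancelʳ σ-inv)

  snd-copy : snd ∘ copy {A} ≈ id
  snd-copy = ≈.trans assoc copy-unit

  fst-copy : fst ∘ copy {A} ≈ id
  fst-copy = ≈.trans (≈.sym snd-σ ⟩∘⟨refl) (≈.trans (pullʳ copy-comm) snd-copy)

  snd-α : snd ∘ α⇒ {A} {B} {C} ≈ snd ⊗₁ id
  snd-α = begin
    (λ⇒ ∘ (discard ⊗₁ id)) ∘ α⇒          ≈⟨ pullʳ ((≈.refl ⟩⊗⟨ ≈.sym ⊗-id) ⟩∘⟨refl) ⟩
    λ⇒ ∘ ((discard ⊗₁ (id ⊗₁ id)) ∘ α⇒)  ≈⟨ refl⟩∘⟨ ≈.sym α-natural ⟩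
    λ⇒ ∘ (α⇒ ∘ ((discard ⊗₁ id) ⊗₁ id))  ≈⟨ pullˡ λ-⊗ ⟩
    (λ⇒ ⊗₁ id) ∘ ((discard ⊗₁ id) ⊗₁ id) ≈⟨ ⊗-∘ˡ ⟨
    snd ⊗₁ id                            ∎

  fst-α : (id ⊗₁ fst) ∘ α⇒ {A} {B} {C} ≈ fst
  fst-α = begin
    (id ⊗₁ (ρ⇒ ∘ (id ⊗₁ discard))) ∘ α⇒           ≈⟨ pushˡ ⊗-∘ʳ ⟩
    (id ⊗₁ ρ⇒) ∘ ((id ⊗₁ (id ⊗₁ discard)) ∘ α⇒)   ≈⟨ refl⟩∘⟨ ≈.sym α-natural ⟩
    (id ⊗₁ ρ⇒) ∘ (α⇒ ∘ ((id ⊗₁ id) ⊗₁ discard))   ≈⟨ pullˡ ρ-⊗ ⟩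
    ρ⇒ ∘ ((id ⊗₁ id) ⊗₁ discard)                  ≈⟨ refl⟩∘⟨ (⊗-id ⟩⊗⟨ ≈.refl) ⟩
    fst                                           ∎

  mid-α : (id ⊗₁ snd) ∘ α⇒ {A} {B} {C} ≈ fst ⊗₁ id
  mid-α = begin
    (id ⊗₁ (λ⇒ ∘ (discard ⊗₁ id))) ∘ α⇒           ≈⟨ pushˡ ⊗-∘ʳ ⟩
    (id ⊗₁ λ⇒) ∘ ((id ⊗₁ (discard ⊗₁ id)) ∘ α⇒)   ≈⟨ refl⟩∘⟨ ≈.sym α-natural ⟩
    (id ⊗₁ λ⇒) ∘ (α⇒ ∘ ((id ⊗₁ discard) ⊗₁ id))   ≈⟨ pullˡ triangle ⟩
    (ρ⇒ ⊗₁ id) ∘ ((id ⊗₁ discard) ⊗₁ id)          ≈⟨ ⊗-∘ˡ ⟨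
    fst ⊗₁ id                                     ∎

  private
    middle : B ⊗₀ (C ⊗₀ D) ⇒ C ⊗₀ (B ⊗₀ D)
    middle = α⇒ ∘ ((σ ⊗₁ id) ∘ α⇐)

    snd-middle : snd ∘ middle {B} {C} {D} ≈ id ⊗₁ snd
    snd-middle = begin
      snd ∘ (α⇒ ∘ ((σ ⊗₁ id) ∘ α⇐))  ≈⟨ pullˡ snd-α ⟩
      (snd ⊗₁ id) ∘ ((σ ⊗₁ id) ∘ α⇐) ≈⟨ pullˡ (≈.trans (≈.sym ⊗-∘ˡ) (snd-σ ⟩⊗⟨ ≈.refl)) ⟩
      (fst ⊗₁ id) ∘ α⇐               ≈⟨ ≈.sym mid-α ⟩∘⟨refl ⟩
      ((id ⊗₁ snd) ∘ α⇒) ∘ α⇐        ≈⟨ cancelʳ α-isoʳ ⟩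
      id ⊗₁ snd                      ∎

    mid-middle : (id ⊗₁ snd) ∘ middle {B} {C} {D} ≈ snd
    mid-middle = begin
      (id ⊗₁ snd) ∘ (α⇒ ∘ ((σ ⊗₁ id) ∘ α⇐))  ≈⟨ pullˡ mid-α ⟩
      (fst ⊗₁ id) ∘ ((σ ⊗₁ id) ∘ α⇐)         ≈⟨ pullˡ (≈.trans (≈.sym ⊗-∘ˡ) (fst-σ ⟩⊗⟨ ≈.refl)) ⟩
      (snd ⊗₁ id) ∘ α⇐                       ≈⟨ ≈.sym snd-α ⟩∘⟨refl ⟩
      (snd ∘ α⇒) ∘ α⇐                        ≈⟨ cancelʳ α-isoʳ ⟩
      snd                                    ∎

  -- With `copy-⊗`, this yields determinism of `fst`; its two companions yield determinism of `snd`
  -- and the equation `⟨fst,snd⟩`.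
  fst⊗fst-interchange : (fst ⊗₁ fst) ∘ interchange {A} {B} {C} {D} ≈ fst
  fst⊗fst-interchange = begin
    (fst ⊗₁ fst) ∘ (α⇐ ∘ ((id ⊗₁ middle) ∘ α⇒))
      ≈⟨ pullˡ first ⟩
    (id ⊗₁ (fst ∘ snd)) ∘ ((id ⊗₁ middle) ∘ α⇒)
      ≈⟨ pullˡ (≈.trans (≈.sym ⊗-∘ʳ) (≈.refl ⟩⊗⟨ ≈.trans (pullʳ snd-middle) (≈.trans fst-⊗ identityˡ))) ⟩
    (id ⊗₁ fst) ∘ α⇒
      ≈⟨ fst-α ⟩
    fst ∎
    where
    first : (fst ⊗₁ fst) ∘ α⇐ {A} {B} {C ⊗₀ D} ≈ id ⊗₁ (fst ∘ snd)
    first = begin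
      (fst ⊗₁ fst) ∘ α⇐                          ≈⟨ pushˡ ⊗-splitʳ ⟩
      (fst ⊗₁ id) ∘ ((id ⊗₁ fst) ∘ α⇐)           ≈⟨ ≈.sym mid-α ⟩∘⟨ (≈.sym ⊗-id ⟩⊗⟨ ≈.refl) ⟩∘⟨refl ⟩
      ((id ⊗₁ snd) ∘ α⇒) ∘ (((id ⊗₁ id) ⊗₁ fst) ∘ α⇐)  ≈⟨ pullʳ (extendʳ α-natural) ⟩
      (id ⊗₁ snd) ∘ ((id ⊗₁ (id ⊗₁ fst)) ∘ (α⇒ ∘ α⇐))  ≈⟨ refl⟩∘⟨ ≈.trans (refl⟩∘⟨ α-isoʳ) identityʳ ⟩
      (id ⊗₁ snd) ∘ (id ⊗₁ (id ⊗₁ fst))                ≈⟨ ≈.trans (≈.sym ⊗-∘ʳ) (≈.refl ⟩⊗⟨ snd-⊗) ⟩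
      id ⊗₁ (fst ∘ snd)                                ∎

  snd⊗snd-interchange : (snd ⊗₁ snd) ∘ interchange {A} {B} {C} {D} ≈ snd
  snd⊗snd-interchange = begin
    (snd ⊗₁ snd) ∘ (α⇐ ∘ ((id ⊗₁ middle) ∘ α⇒))         ≈⟨ pushˡ ⊗-splitˡ ⟩
    (id ⊗₁ snd) ∘ ((snd ⊗₁ id) ∘ (α⇐ ∘ ((id ⊗₁ middle) ∘ α⇒)))
      ≈⟨ refl⟩∘⟨ pullˡ (≈.trans (≈.sym snd-α ⟩∘⟨refl) (cancelʳ α-isoʳ)) ⟩
    (id ⊗₁ snd) ∘ (snd ∘ ((id ⊗₁ middle) ∘ α⇒))         ≈⟨ refl⟩∘⟨ extendʳ snd-⊗ ⟩
    (id ⊗₁ snd) ∘ (middle ∘ (snd ∘ α⇒))                 ≈⟨ pullˡ mid-middle ⟩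
    snd ∘ (snd ∘ α⇒)                                    ≈⟨ refl⟩∘⟨ snd-α ⟩
    snd ∘ (snd ⊗₁ id)                                   ≈⟨ ≈.trans snd-⊗ identityˡ ⟩
    snd                                                 ∎

  fst⊗snd-interchange : (fst ⊗₁ snd) ∘ interchange {A} {B} {C} {D} ≈ fst ⊗₁ snd
  fst⊗snd-interchange = begin
    (fst ⊗₁ snd) ∘ (α⇐ ∘ ((id ⊗₁ middle) ∘ α⇒))         ≈⟨ pushˡ ⊗-splitˡ ⟩
    (id ⊗₁ snd) ∘ ((fst ⊗₁ id) ∘ (α⇐ ∘ ((id ⊗₁ middle) ∘ α⇒)))
      ≈⟨ refl⟩∘⟨ pullˡ (≈.trans (≈.sym mid-α ⟩∘⟨refl) (cancelʳ α-isoʳ)) ⟩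
    (id ⊗₁ snd) ∘ ((id ⊗₁ snd) ∘ ((id ⊗₁ middle) ∘ α⇒))
      ≈⟨ refl⟩∘⟨ pullˡ (≈.trans (≈.sym ⊗-∘ʳ) (≈.refl ⟩⊗⟨ snd-middle)) ⟩
    (id ⊗₁ snd) ∘ ((id ⊗₁ (id ⊗₁ snd)) ∘ α⇒)
      ≈⟨ pullˡ (≈.trans (≈.sym ⊗-∘ʳ) (≈.refl ⟩⊗⟨ snd-⊗)) ⟩
    (id ⊗₁ (snd ∘ snd)) ∘ α⇒                             ≈⟨ ≈.trans (⊗-∘ʳ ⟩∘⟨refl) (pullʳ mid-α) ⟩
    (id ⊗₁ snd) ∘ (fst ⊗₁ id)                            ≈⟨ ⊗-splitˡ ⟨
    fst ⊗₁ snd                                           ∎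

  interchange-natural : ∀ {A′ B′ C′ D′} {f : A ⇒ A′} {g : B ⇒ B′} {h : C ⇒ C′} {k : D ⇒ D′} →
    interchange ∘ ((f ⊗₁ g) ⊗₁ (h ⊗₁ k)) ≈ ((f ⊗₁ h) ⊗₁ (g ⊗₁ k)) ∘ interchange
  interchange-natural {f = f} {g} {h} {k} = begin
    (α⇐ ∘ ((id ⊗₁ middle) ∘ α⇒)) ∘ ((f ⊗₁ g) ⊗₁ (h ⊗₁ k))  ≈⟨ pullʳ (pullʳ α-natural) ⟩
    α⇐ ∘ ((id ⊗₁ middle) ∘ ((f ⊗₁ (g ⊗₁ (h ⊗₁ k))) ∘ α⇒))  ≈⟨ refl⟩∘⟨ extendʳ second ⟩
    α⇐ ∘ ((f ⊗₁ (h ⊗₁ (g ⊗₁ k))) ∘ ((id ⊗₁ middle) ∘ α⇒))  ≈⟨ extendʳ α⇐-natural ⟩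
    ((f ⊗₁ h) ⊗₁ (g ⊗₁ k)) ∘ interchange                   ∎
    where
    middle-natural : middle ∘ (g ⊗₁ (h ⊗₁ k)) ≈ (h ⊗₁ (g ⊗₁ k)) ∘ middle
    middle-natural = begin
      (α⇒ ∘ ((σ ⊗₁ id) ∘ α⇐)) ∘ (g ⊗₁ (h ⊗₁ k))    ≈⟨ pullʳ (pullʳ α⇐-natural) ⟩
      α⇒ ∘ ((σ ⊗₁ id) ∘ (((g ⊗₁ h) ⊗₁ k) ∘ α⇐))
        ≈⟨ refl⟩∘⟨ extendʳ (⊗-square σ-natural idˡ-square) ⟩
      α⇒ ∘ (((h ⊗₁ g) ⊗₁ k) ∘ ((σ ⊗₁ id) ∘ α⇐))    ≈⟨ extendʳ α-natural ⟩
      (h ⊗₁ (g ⊗₁ k)) ∘ (α⇒ ∘ ((σ ⊗₁ id) ∘ α⇐))    ∎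

    second : (id ⊗₁ middle) ∘ (f ⊗₁ (g ⊗₁ (h ⊗₁ k))) ≈ (f ⊗₁ (h ⊗₁ (g ⊗₁ k))) ∘ (id ⊗₁ middle)
    second = ⊗-square idˡ-square middle-natural

  -- Closure properties of deterministic channels

  Deterministic-resp-≈ : {f g : A ⇒ B} → f ≈ g → Deterministic f → Deterministic g
  Deterministic-resp-≈ p d =
    ≈.trans (refl⟩∘⟨ ≈.sym p) (≈.trans d ((p ⟩⊗⟨ p) ⟩∘⟨refl))

  id-deterministic : Deterministic (id {A})
  id-deterministic = ≈.trans identityʳ (≈.sym (≈.trans (⊗-id ⟩∘⟨refl) identityˡ))

  ∘-deterministic : {f : B ⇒ C} {g : A ⇒ B} → Deterministic f → Deterministic g → Deterministic (f ∘ g)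
  ∘-deterministic {f = f} {g} p q = begin
    copy ∘ (f ∘ g)                ≈⟨ extendʳ p ⟩
    (f ⊗₁ f) ∘ (copy ∘ g)         ≈⟨ refl⟩∘⟨ q ⟩
    (f ⊗₁ f) ∘ ((g ⊗₁ g) ∘ copy)  ≈⟨ pullˡ (≈.sym ⊗-∘) ⟩
    ((f ∘ g) ⊗₁ (f ∘ g)) ∘ copy   ∎

  ⊗-deterministic : {f : A ⇒ B} {g : C ⇒ D} → Deterministic f → Deterministic g → Deterministic (f ⊗₁ g)
  ⊗-deterministic {f = f} {g} p q = begin
    copy ∘ (f ⊗₁ g)                                        ≈⟨ copy-⊗ ⟩∘⟨refl ⟩
    (interchange ∘ (copy ⊗₁ copy)) ∘ (f ⊗₁ g)
      ≈⟨ pullʳ (⊗-square p q) ⟩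
    interchange ∘ (((f ⊗₁ f) ⊗₁ (g ⊗₁ g)) ∘ (copy ⊗₁ copy)) ≈⟨ extendʳ interchange-natural ⟩
    ((f ⊗₁ g) ⊗₁ (f ⊗₁ g)) ∘ (interchange ∘ (copy ⊗₁ copy)) ≈⟨ refl⟩∘⟨ ≈.sym copy-⊗ ⟩
    ((f ⊗₁ g) ⊗₁ (f ⊗₁ g)) ∘ copy                          ∎

  inverse-deterministic : {f : A ⇒ B} {f⁻¹ : B ⇒ A} → f⁻¹ ∘ f ≈ id → f ∘ f⁻¹ ≈ id →
                          Deterministic f → Deterministic f⁻¹
  inverse-deterministic p q d = conjugate q (⊗-inverse p p) (≈.sym d)

  fst-deterministic : Deterministic (fst {A} {B})
  fst-deterministic = ≈.sym (begin
    (fst ⊗₁ fst) ∘ copy                           ≈⟨ refl⟩∘⟨ copy-⊗ ⟩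
    (fst ⊗₁ fst) ∘ (interchange ∘ (copy ⊗₁ copy)) ≈⟨ pullˡ fst⊗fst-interchange ⟩
    fst ∘ (copy ⊗₁ copy)                          ≈⟨ fst-⊗ ⟩
    copy ∘ fst                                    ∎)

  snd-deterministic : Deterministic (snd {A} {B})
  snd-deterministic = ≈.sym (begin
    (snd ⊗₁ snd) ∘ copy                           ≈⟨ refl⟩∘⟨ copy-⊗ ⟩
    (snd ⊗₁ snd) ∘ (interchange ∘ (copy ⊗₁ copy)) ≈⟨ pullˡ snd⊗snd-interchange ⟩
    snd ∘ (copy ⊗₁ copy)                          ≈⟨ snd-⊗ ⟩
    copy ∘ snd                                    ∎)

  -- `unit ⊗₀ unit` is isomorphic to `unit`, hence terminal as well.
  discard-deterministic : Deterministic (discard {A})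
  discard-deterministic = isoMonic λ-isoˡ terminal

  -- Both sides make four copies of one value, and by `copy-⊗` they differ by a swap of the middle
  -- two. Coassociativity presents those two as one copy, and there commutativity absorbs the swap.
  copy-deterministic : Deterministic (copy {A})
  copy-deterministic = ≈.sym (isoMonic α-isoˡ (begin
    α⇒ ∘ ((copy ⊗₁ copy) ∘ copy)                            ≈⟨ coassociated ⟩
    (id ⊗₁ ((id ⊗₁ copy) ∘ copy)) ∘ copy                    ≈⟨ (≈.refl ⟩⊗⟨ ≈.sym middle-copies) ⟩∘⟨refl ⟩
    (id ⊗₁ (middle ∘ ((id ⊗₁ copy) ∘ copy))) ∘ copy         ≈⟨ pushˡ ⊗-∘ʳ ⟩
    (id ⊗₁ middle) ∘ ((id ⊗₁ ((id ⊗₁ copy) ∘ copy)) ∘ copy) ≈⟨ refl⟩∘⟨ ≈.sym coassociated ⟩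
    (id ⊗₁ middle) ∘ (α⇒ ∘ ((copy ⊗₁ copy) ∘ copy))         ≈⟨ cancelˡ α-isoʳ ⟨
    α⇒ ∘ (α⇐ ∘ ((id ⊗₁ middle) ∘ (α⇒ ∘ ((copy ⊗₁ copy) ∘ copy))))
      ≈⟨ refl⟩∘⟨ ≈.trans (refl⟩∘⟨ ≈.sym assoc) (≈.sym assoc) ⟩
    α⇒ ∘ (interchange ∘ ((copy ⊗₁ copy) ∘ copy))            ≈⟨ refl⟩∘⟨ pullˡ (≈.sym copy-⊗) ⟩
    α⇒ ∘ (copy ∘ copy)                                      ∎))
    where
    coassociated : α⇒ ∘ ((copy ⊗₁ copy) ∘ copy {A}) ≈ (id ⊗₁ ((id ⊗₁ copy) ∘ copy)) ∘ copy
    coassociated = begin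
      α⇒ ∘ ((copy ⊗₁ copy) ∘ copy)                    ≈⟨ refl⟩∘⟨ pushˡ ⊗-splitˡ ⟩
      α⇒ ∘ ((id ⊗₁ copy) ∘ ((copy ⊗₁ id) ∘ copy))     ≈⟨ refl⟩∘⟨ (≈.sym ⊗-id ⟩⊗⟨ ≈.refl) ⟩∘⟨refl ⟩
      α⇒ ∘ (((id ⊗₁ id) ⊗₁ copy) ∘ ((copy ⊗₁ id) ∘ copy))  ≈⟨ extendʳ α-natural ⟩
      (id ⊗₁ (id ⊗₁ copy)) ∘ (α⇒ ∘ ((copy ⊗₁ id) ∘ copy))  ≈⟨ refl⟩∘⟨ copy-assoc ⟩
      (id ⊗₁ (id ⊗₁ copy)) ∘ ((id ⊗₁ copy) ∘ copy)    ≈⟨ pullˡ (≈.sym ⊗-∘ʳ) ⟩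
      (id ⊗₁ ((id ⊗₁ copy) ∘ copy)) ∘ copy            ∎

    middle-copies : middle ∘ ((id ⊗₁ copy) ∘ copy {A}) ≈ (id ⊗₁ copy) ∘ copy
    middle-copies = begin
      (α⇒ ∘ ((σ ⊗₁ id) ∘ α⇐)) ∘ ((id ⊗₁ copy) ∘ copy)         ≈⟨ refl⟩∘⟨ ≈.sym copy-assoc ⟩
      (α⇒ ∘ ((σ ⊗₁ id) ∘ α⇐)) ∘ (α⇒ ∘ ((copy ⊗₁ id) ∘ copy))  ≈⟨ pullʳ (pullʳ (cancelˡ α-isoˡ)) ⟩
      α⇒ ∘ ((σ ⊗₁ id) ∘ ((copy ⊗₁ id) ∘ copy))
        ≈⟨ refl⟩∘⟨ pullˡ (≈.trans (≈.sym ⊗-∘ˡ) (copy-comm ⟩⊗⟨ ≈.refl)) ⟩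
      α⇒ ∘ ((copy ⊗₁ id) ∘ copy)                              ≈⟨ copy-assoc ⟩
      (id ⊗₁ copy) ∘ copy                                     ∎

  -- Pairing into a tensor product

  infix 11 ⟨_,_⟩

  ⟨_,_⟩ : Z ⇒ A → Z ⇒ B → Z ⇒ A ⊗₀ B
  ⟨ f , g ⟩ = (f ⊗₁ g) ∘ copy

  fst-⟨⟩ : {f : Z ⇒ A} {g : Z ⇒ B} → fst ∘ ⟨ f , g ⟩ ≈ f
  fst-⟨⟩ = ≈.trans (extendʳ fst-⊗) (≈.trans (refl⟩∘⟨ fst-copy) identityʳ)

  snd-⟨⟩ : {f : Z ⇒ A} {g : Z ⇒ B} → snd ∘ ⟨ f , g ⟩ ≈ g
  snd-⟨⟩ = ≈.trans (extendʳ snd-⊗) (≈.trans (refl⟩∘⟨ snd-copy) identityʳ)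

  ⟨⟩-resp-≈ : {f f′ : Z ⇒ A} {g g′ : Z ⇒ B} → f ≈ f′ → g ≈ g′ → ⟨ f , g ⟩ ≈ ⟨ f′ , g′ ⟩
  ⟨⟩-resp-≈ p q = (p ⟩⊗⟨ q) ⟩∘⟨refl

  ⟨⟩-∘ : {f : Z ⇒ A} {g : Z ⇒ B} {h : Z′ ⇒ Z} → Deterministic h → ⟨ f , g ⟩ ∘ h ≈ ⟨ f ∘ h , g ∘ h ⟩
  ⟨⟩-∘ d = ≈.trans (pullʳ d) (pullˡ (≈.sym ⊗-∘))

  ⊗-⟨⟩ : {f : Z ⇒ A} {g : Z ⇒ B} {h : A ⇒ C} {k : B ⇒ D} →
         (h ⊗₁ k) ∘ ⟨ f , g ⟩ ≈ ⟨ h ∘ f , k ∘ g ⟩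
  ⊗-⟨⟩ = pullˡ (≈.sym ⊗-∘)

  ⟨⟩-deterministic : {f : Z ⇒ A} {g : Z ⇒ B} → Deterministic f → Deterministic g → Deterministic ⟨ f , g ⟩
  ⟨⟩-deterministic p q = ∘-deterministic (⊗-deterministic p q) copy-deterministic

  ⟨fst,snd⟩ : ⟨ fst , snd ⟩ ≈ id {A ⊗₀ B}
  ⟨fst,snd⟩ = begin
    (fst ⊗₁ snd) ∘ copy                           ≈⟨ refl⟩∘⟨ copy-⊗ ⟩
    (fst ⊗₁ snd) ∘ (interchange ∘ (copy ⊗₁ copy)) ≈⟨ pullˡ fst⊗snd-interchange ⟩
    (fst ⊗₁ snd) ∘ (copy ⊗₁ copy)                 ≈⟨ ⊗-inverse fst-copy snd-copy ⟩
    id                                            ∎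

  -- Determinism lets the single `h` before the copy be traded for the two after it.
  ⟨⟩-unique : {h : Z ⇒ A ⊗₀ B} → Deterministic h → ⟨ fst ∘ h , snd ∘ h ⟩ ≈ h
  ⟨⟩-unique d = ≈.trans (≈.sym (⟨⟩-∘ d)) (≈.trans (⟨fst,snd⟩ ⟩∘⟨refl) identityˡ)

-- Wires compose as rewirings

module FreeWires (Σ : Signature) where
  open MarkovCategory (Free Σ)
  open MarkovProperties (Free Σ)
  open FreeWiring Σ
  open ≈-Reasoning

  private
    variable
      A A′ B B′ C Z : Ob

  proj-deterministic : ∀ {x} (i : x ∈ᵗ A) → Deterministic (proj i)
  proj-deterministic here      = id-deterministic
  proj-deterministic (left i)  = ∘-deterministic (proj-deterministic i) fst-deterministic
  proj-deterministic (right i) = ∘-deterministic (proj-deterministic i) snd-deterministic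

  wire-deterministic : ∀ B (r : Rewiring A B) → Deterministic (wire A B r)
  wire-deterministic I        r = discard-deterministic
  wire-deterministic (var x)  r = proj-deterministic (r x here)
  wire-deterministic (B ⊗ B′) r = ⟨⟩-deterministic (wire-deterministic B _) (wire-deterministic B′ _)

  proj-wire : ∀ {x} (r : Rewiring A B) (i : x ∈ᵗ B) → proj i ∘ wire A B r ≈ proj (r x i)
  proj-wire r here      = identityˡ
  proj-wire r (left i)  = ≈.trans (pullʳ fst-⟨⟩) (proj-wire _ i)
  proj-wire r (right i) = ≈.trans (pullʳ snd-⟨⟩) (proj-wire _ i)

  -- Fails without determinism: a joint state is not determined by its marginals.
  proj-jointly-monic : ∀ B {h k : Z ⇒ B} → Deterministic h → Deterministic k →
                       (∀ x (i : x ∈ᵗ B) → proj i ∘ h ≈ proj i ∘ k) → h ≈ k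
  proj-jointly-monic I        dh dk p = terminal
  proj-jointly-monic (var x)  dh dk p = ≈.trans (≈.sym identityˡ) (≈.trans (p x here) identityˡ)
  proj-jointly-monic (B ⊗ B′) {h} {k} dh dk p = begin
    h                         ≈⟨ ⟨⟩-unique dh ⟨
    ⟨ fst ∘ h , snd ∘ h ⟩     ≈⟨ ⟨⟩-resp-≈
      (proj-jointly-monic B (∘-deterministic fst-deterministic dh) (∘-deterministic fst-deterministic dk)
        (λ x i → ≈.trans (≈.sym assoc) (≈.trans (p x (left i)) assoc)))
      (proj-jointly-monic B′ (∘-deterministic snd-deterministic dh) (∘-deterministic snd-deterministic dk)
        (λ x i → ≈.trans (≈.sym assoc) (≈.trans (p x (right i)) assoc))) ⟩
    ⟨ fst ∘ k , snd ∘ k ⟩     ≈⟨ ⟨⟩-unique dk ⟩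
    k                         ∎

  -- The universal property of wires: each law below is proved by exhibiting a deterministic map and
  -- computing its projections.
  wire-unique : (r : Rewiring A B) {h : A ⇒ B} → Deterministic h →
                (∀ x (i : x ∈ᵗ B) → proj i ∘ h ≈ proj (r x i)) → h ≈ wire A B r
  wire-unique {B = B} r d p = proj-jointly-monic B d (wire-deterministic B r)
    (λ x i → ≈.trans (p x i) (≈.sym (proj-wire r i)))

  wire-cong : {r s : Rewiring A B} → (∀ x i → r x i ≡ s x i) → wire A B r ≈ wire A B s
  wire-cong {B = B} {r} {s} p = wire-unique s (wire-deterministic B r)
    (λ x i → ≈.trans (proj-wire r i) (≈-reflexive (cong proj (p x i))))

  wire-id : {r : Rewiring A A} → (∀ x i → r x i ≡ i) → wire A A r ≈ id
  wire-id {r = r} p = ≈.sym (wire-unique r id-deterministic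
    (λ x i → ≈.trans identityʳ (≈-reflexive (cong proj (sym (p x i))))))

  wire-∘ : {r : Rewiring A B} {s : Rewiring B C} {t : Rewiring A C} →
           (∀ x i → r x (s x i) ≡ t x i) → wire B C s ∘ wire A B r ≈ wire A C t
  wire-∘ {B = B} {C = C} {r} {s} {t} p = wire-unique t
    (∘-deterministic (wire-deterministic C s) (wire-deterministic B r))
    (λ x i → ≈.trans (pullˡ (proj-wire s i)) (≈.trans (proj-wire r (s x i)) (≈-reflexive (cong proj (p x i)))))

  wire-⊗ : {r : Rewiring A A′} {s : Rewiring B B′} {t : Rewiring (A ⊗ B) (A′ ⊗ B′)} →
           (∀ x i → t x (left i) ≡ left (r x i)) → (∀ x i → t x (right i) ≡ right (s x i)) →
           wire A A′ r ⊗₁ wire B B′ s ≈ wire (A ⊗ B) (A′ ⊗ B′) t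
  wire-⊗ {A′ = A′} {B′ = B′} {r} {s} {t} p q = wire-unique t
    (⊗-deterministic (wire-deterministic A′ r) (wire-deterministic B′ s)) λ where
      x (left i)  → ≈.trans (pullʳ fst-⊗)
        (≈.trans (pullˡ (proj-wire r i)) (≈-reflexive (cong proj (sym (p x i)))))
      x (right i) → ≈.trans (pullʳ snd-⊗)
        (≈.trans (pullˡ (proj-wire s i)) (≈-reflexive (cong proj (sym (q x i)))))

  wire-fst : {r : Rewiring A C} → wire A C r ∘ fst {A} {B} ≈ wire (A ⊗ B) C (λ x i → left (r x i))
  wire-fst {C = C} {r = r} = wire-unique _ (∘-deterministic (wire-deterministic C r) fst-deterministic)
    (λ x i → pullˡ (proj-wire r i))

  wire-snd : {r : Rewiring B C} → wire B C r ∘ snd {A} {B} ≈ wire (A ⊗ B) C (λ x i → right (r x i))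
  wire-snd {C = C} {r = r} = wire-unique _ (∘-deterministic (wire-deterministic C r) snd-deterministic)
    (λ x i → pullˡ (proj-wire r i))

  arrangement-isoˡ : (a : Arrangement A B) → wire B A (Arr.to a) ∘ wire A B (Arr.from a) ≈ id
  arrangement-isoˡ a =
    ≈.trans (wire-∘ (λ _ _ → refl)) (wire-id (λ x i → Inverse.strictlyInverseʳ (a x) i))

  wire-∘-distinct : Distinct A → {r : Rewiring A B} {s : Rewiring B C} {t : Rewiring A C} →
                    wire B C s ∘ wire A B r ≈ wire A C t
  wire-∘-distinct d = wire-∘ (λ x _ → d x _ _)

  wire-inverse-distinct : Distinct A → {r : Rewiring A B} {s : Rewiring B A} →
                          wire B A s ∘ wire A B r ≈ id
  wire-inverse-distinct d = ≈.trans (wire-∘-distinct d) (wire-id (λ _ _ → refl))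

-- Wires interpreted in a model

module _ (Σ : Signature) (𝒞 : MarkovCategory o ℓ e) where
  open Signature Σ
  open MarkovCategory 𝒞

  module Interpretation
    (ob : Type → Ob)
    (ch : ∀ q → Wiring.⟦_⟧ 𝒞 ob (⨂ (ins q)) ⇒ Wiring.⟦_⟧ 𝒞 ob (⨂ (outs q))) where
    open Extend Σ 𝒞 ob ch using (⟦_⟧₁)
    private
      module W = Wiring 𝒞 ob
      module FW = FreeWiring Σ

    ⟦proj⟧ : ∀ {x A} (i : x ∈ᵗ A) → ⟦ FW.proj i ⟧₁ ≡ W.proj i
    ⟦proj⟧ here      = refl
    ⟦proj⟧ (left i)  = cong (_∘ fst) (⟦proj⟧ i)
    ⟦proj⟧ (right i) = cong (_∘ snd) (⟦proj⟧ i)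

    -- The two definitions of `wire` have the same clauses. Hence laws of wires need proof only in
    -- the free category, and are carried to a model by `⟦⟧-resp-≈`.
    ⟦wire⟧ : ∀ A B (r : Rewiring A B) → ⟦ FW.wire A B r ⟧₁ ≡ W.wire A B r
    ⟦wire⟧ A I        r = refl
    ⟦wire⟧ A (var x)  r = ⟦proj⟧ (r x here)
    ⟦wire⟧ A (B ⊗ B′) r = cong₂ (λ f g → (f ⊗₁ g) ∘ copy) (⟦wire⟧ A B _) (⟦wire⟧ A B′ _)

-- Monoidal transformations between functors out of a free Markov category

module FunctorProperties {o ℓ e o′ ℓ′ e′} {𝒞 : MarkovCategory o ℓ e} {𝒟 : MarkovCategory o′ ℓ′ e′}
                         (F : Functor 𝒞 𝒟) where
  private module C = MarkovCategory 𝒞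
  open MarkovCategory 𝒟
  open Functor F

  F-inverse : ∀ {A B} {f : A C.⇒ B} {g : B C.⇒ A} → g C.∘ f C.≈ C.id → F₁ g ∘ F₁ f ≈ id
  F-inverse p = ≈.trans (≈.sym homomorphism) (≈.trans (F-resp-≈ p) identity)

  F-triangle : ∀ {A B C} {f : A C.⇒ B} {g : B C.⇒ C} {h : A C.⇒ C} →
               g C.∘ f C.≈ h → F₁ g ∘ F₁ f ≈ F₁ h
  F-triangle p = ≈.trans (≈.sym homomorphism) (F-resp-≈ p)

  F-square : ∀ {A B B′ C} {f : A C.⇒ B} {g : B C.⇒ C} {f′ : A C.⇒ B′} {g′ : B′ C.⇒ C} →
             g C.∘ f C.≈ g′ C.∘ f′ → F₁ g ∘ F₁ f ≈ F₁ g′ ∘ F₁ f′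
  F-square p = ≈.trans (F-triangle p) homomorphism

  open MarkovProperties 𝒟

  F-deterministic : ∀ {A B} {f : A C.⇒ B} → C.Deterministic f → Deterministic (F₁ f)
  F-deterministic {f = f} d = isoMonic μ-isoˡ (begin
    μ ∘ (copy ∘ F₁ f)               ≈⟨ pullˡ (≈.sym copy-preserving) ⟩
    F₁ C.copy ∘ F₁ f                ≈⟨ F-square d ⟩
    F₁ (f C.⊗₁ f) ∘ F₁ C.copy       ≈⟨ refl⟩∘⟨ copy-preserving ⟩
    F₁ (f C.⊗₁ f) ∘ (μ ∘ copy)      ≈⟨ extendʳ (≈.sym μ-natural) ⟩
    μ ∘ ((F₁ f ⊗₁ F₁ f) ∘ copy)     ∎)
    where open ≈-Reasoning

  F₀-unit-terminal : ∀ {Z} {f g : Z ⇒ F₀ C.unit} → f ≈ g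
  F₀-unit-terminal = isoMonic ε-isoʳ terminal

module TransformationOnTypes {Σ : Signature} {𝒟 : MarkovCategory o ℓ e} (F G : Functor (Free Σ) 𝒟)
  (t : ∀ x → MarkovCategory._⇒_ 𝒟 (Functor.F₀ F (var x)) (Functor.F₀ G (var x))) where
  open MarkovCategory 𝒟
  open MarkovProperties 𝒟
  open ≈-Reasoning
  private
    module F = Functor F
    module G = Functor G
    module FP = FunctorProperties F
    module GP = FunctorProperties G
    module S = Syntax Σ

  θ : ∀ A → F.F₀ A ⇒ G.F₀ A
  θ I       = G.ε ∘ F.ε⁻¹
  θ (var x) = t x
  θ (A ⊗ B) = G.μ ∘ ((θ A ⊗₁ θ B) ∘ F.μ⁻¹)

  θ-unit : θ I ∘ F.ε ≈ G.ε
  θ-unit = cancelʳ F.ε-isoˡ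

  θ-⊗ : ∀ {A B} → θ (A ⊗ B) ∘ F.μ ≈ G.μ ∘ (θ A ⊗₁ θ B)
  θ-⊗ = pullʳ (cancelʳ F.μ-isoˡ)

  Natural : ∀ {A B} → A S.⇒ B → Set e
  Natural {A} {B} f = θ B ∘ F.F₁ f ≈ G.F₁ f ∘ θ A

  module _ (t-deterministic : ∀ x → Deterministic (t x)) where

    θ-deterministic : ∀ A → Deterministic (θ A)
    θ-deterministic I       = ∘-deterministic G.ε-deterministic
      (inverse-deterministic F.ε-isoˡ F.ε-isoʳ F.ε-deterministic)
    θ-deterministic (var x) = t-deterministic x
    θ-deterministic (A ⊗ B) = ∘-deterministic G.μ-deterministic
      (∘-deterministic (⊗-deterministic (θ-deterministic A) (θ-deterministic B))
        (inverse-deterministic F.μ-isoˡ F.μ-isoʳ F.μ-deterministic))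

    module _ (gen-natural : ∀ q → Natural (S.gen q)) where

      private
        natural⁻¹ : ∀ {A B} {f : A S.⇒ B} {f⁻¹ : B S.⇒ A} → f⁻¹ S.∘ f S.≈ S.id → f S.∘ f⁻¹ S.≈ S.id →
                    Natural f → Natural f⁻¹
        natural⁻¹ p q n = conjugate (FP.F-inverse q) (GP.F-inverse p) (≈.sym n)

        cancel-epic : ∀ {A B Z} {f : A S.⇒ B} {m : Z ⇒ F.F₀ A} {n : F.F₀ A ⇒ Z} → m ∘ n ≈ id →
                      (θ B ∘ F.F₁ f) ∘ m ≈ (G.F₁ f ∘ θ A) ∘ m → Natural f
        cancel-epic p = isoEpic p _ _

      -- Induction on the term. Tensor products, associators, unitors and symmetries are treated
      -- after precomposition with the structure isomorphisms of `F`, where `θ-⊗` and `θ-unit`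
      -- reduce them to coherence of `F` and `G`. Copying is the case that uses determinism of `θ`;
      -- for discarding, `G.F₀ I` is terminal because it is isomorphic to the unit; inverse
      -- structure maps follow by conjugation.
      natural : ∀ {A B} (f : A S.⇒ B) → Natural f
      natural (S.gen q) = gen-natural q
      natural S.id      = ≈.trans (refl⟩∘⟨ F.identity)
        (≈.trans identityʳ (≈.trans (≈.sym identityˡ) (≈.sym G.identity ⟩∘⟨refl)))
      natural (g S.∘ f) = begin
        θ _ ∘ F.F₁ (g S.∘ f)        ≈⟨ refl⟩∘⟨ F.homomorphism ⟩
        θ _ ∘ (F.F₁ g ∘ F.F₁ f)     ≈⟨ extendʳ (natural g) ⟩
        G.F₁ g ∘ (θ _ ∘ F.F₁ f)     ≈⟨ refl⟩∘⟨ natural f ⟩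
        G.F₁ g ∘ (G.F₁ f ∘ θ _)     ≈⟨ pullˡ (≈.sym G.homomorphism) ⟩
        G.F₁ (g S.∘ f) ∘ θ _        ∎
      natural (f S.⊗₁ g) = cancel-epic F.μ-isoʳ (begin
        (θ _ ∘ F.F₁ (f S.⊗₁ g)) ∘ F.μ          ≈⟨ pullʳ (≈.sym F.μ-natural) ⟩
        θ _ ∘ (F.μ ∘ (F.F₁ f ⊗₁ F.F₁ g))       ≈⟨ extendʳ θ-⊗ ⟩
        G.μ ∘ ((θ _ ⊗₁ θ _) ∘ (F.F₁ f ⊗₁ F.F₁ g))
          ≈⟨ refl⟩∘⟨ ⊗-square (natural f) (natural g) ⟩
        G.μ ∘ ((G.F₁ f ⊗₁ G.F₁ g) ∘ (θ _ ⊗₁ θ _))  ≈⟨ extendʳ G.μ-natural ⟩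
        G.F₁ (f S.⊗₁ g) ∘ (G.μ ∘ (θ _ ⊗₁ θ _))     ≈⟨ pullʳ θ-⊗ ⟨
        (G.F₁ (f S.⊗₁ g) ∘ θ _) ∘ F.μ          ∎)
      natural (S.α⇒ {A} {B} {C}) = cancel-epic
        (≈.trans (pullʳ (cancelˡ (⊗-inverse F.μ-isoʳ identityˡ))) F.μ-isoʳ) (begin
        (θ _ ∘ F.F₁ S.α⇒) ∘ (F.μ ∘ (F.μ ⊗₁ id))               ≈⟨ pullʳ F.associativity ⟩
        θ _ ∘ (F.μ ∘ ((id ⊗₁ F.μ) ∘ α⇒))                      ≈⟨ extendʳ θ-⊗ ⟩
        G.μ ∘ ((θ A ⊗₁ θ (B ⊗ C)) ∘ ((id ⊗₁ F.μ) ∘ α⇒))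
          ≈⟨ refl⟩∘⟨ extendʳ (⊗-square idʳ-square θ-⊗) ⟩
        G.μ ∘ ((id ⊗₁ G.μ) ∘ ((θ A ⊗₁ (θ B ⊗₁ θ C)) ∘ α⇒))    ≈⟨ refl⟩∘⟨ (refl⟩∘⟨ ≈.sym α-natural) ⟩
        G.μ ∘ ((id ⊗₁ G.μ) ∘ (α⇒ ∘ ((θ A ⊗₁ θ B) ⊗₁ θ C)))    ≈⟨ ≈.trans (refl⟩∘⟨ ≈.sym assoc) (≈.sym assoc) ⟩
        (G.μ ∘ ((id ⊗₁ G.μ) ∘ α⇒)) ∘ ((θ A ⊗₁ θ B) ⊗₁ θ C)    ≈⟨ G.associativity ⟩∘⟨refl ⟨
        (G.F₁ S.α⇒ ∘ (G.μ ∘ (G.μ ⊗₁ id))) ∘ ((θ A ⊗₁ θ B) ⊗₁ θ C)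
          ≈⟨ pullʳ (pullʳ (⊗-square (≈.sym θ-⊗) idˡ-square)) ⟩
        G.F₁ S.α⇒ ∘ (G.μ ∘ ((θ (A ⊗ B) ⊗₁ θ C) ∘ (F.μ ⊗₁ id)))  ≈⟨ refl⟩∘⟨ extendʳ (≈.sym θ-⊗) ⟩
        G.F₁ S.α⇒ ∘ (θ _ ∘ (F.μ ∘ (F.μ ⊗₁ id)))               ≈⟨ assoc ⟨
        (G.F₁ S.α⇒ ∘ θ _) ∘ (F.μ ∘ (F.μ ⊗₁ id))               ∎)
      natural (S.λ⇒ {A}) = cancel-epic
        (≈.trans (pullʳ (cancelˡ (⊗-inverse F.ε-isoʳ identityˡ))) F.μ-isoʳ) (begin
        (θ A ∘ F.F₁ S.λ⇒) ∘ (F.μ ∘ (F.ε ⊗₁ id))          ≈⟨ pullʳ F.unitalityˡ ⟩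
        θ A ∘ λ⇒                                         ≈⟨ λ-natural ⟨
        λ⇒ ∘ (id ⊗₁ θ A)                                 ≈⟨ G.unitalityˡ ⟩∘⟨refl ⟨
        (G.F₁ S.λ⇒ ∘ (G.μ ∘ (G.ε ⊗₁ id))) ∘ (id ⊗₁ θ A)
          ≈⟨ pullʳ (pullʳ (⊗-square (≈.trans identityʳ (≈.sym θ-unit)) idˡ-square)) ⟩
        G.F₁ S.λ⇒ ∘ (G.μ ∘ ((θ I ⊗₁ θ A) ∘ (F.ε ⊗₁ id))) ≈⟨ refl⟩∘⟨ extendʳ (≈.sym θ-⊗) ⟩
        G.F₁ S.λ⇒ ∘ (θ _ ∘ (F.μ ∘ (F.ε ⊗₁ id)))          ≈⟨ assoc ⟨
        (G.F₁ S.λ⇒ ∘ θ _) ∘ (F.μ ∘ (F.ε ⊗₁ id))          ∎)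
      natural (S.ρ⇒ {A}) = cancel-epic
        (≈.trans (pullʳ (cancelˡ (⊗-inverse identityˡ F.ε-isoʳ))) F.μ-isoʳ) (begin
        (θ A ∘ F.F₁ S.ρ⇒) ∘ (F.μ ∘ (id ⊗₁ F.ε))          ≈⟨ pullʳ F.unitalityʳ ⟩
        θ A ∘ ρ⇒                                         ≈⟨ ρ-natural ⟨
        ρ⇒ ∘ (θ A ⊗₁ id)                                 ≈⟨ G.unitalityʳ ⟩∘⟨refl ⟨
        (G.F₁ S.ρ⇒ ∘ (G.μ ∘ (id ⊗₁ G.ε))) ∘ (θ A ⊗₁ id)
          ≈⟨ pullʳ (pullʳ (⊗-square idˡ-square (≈.trans identityʳ (≈.sym θ-unit)))) ⟩
        G.F₁ S.ρ⇒ ∘ (G.μ ∘ ((θ A ⊗₁ θ I) ∘ (id ⊗₁ F.ε))) ≈⟨ refl⟩∘⟨ extendʳ (≈.sym θ-⊗) ⟩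
        G.F₁ S.ρ⇒ ∘ (θ _ ∘ (F.μ ∘ (id ⊗₁ F.ε)))          ≈⟨ assoc ⟨
        (G.F₁ S.ρ⇒ ∘ θ _) ∘ (F.μ ∘ (id ⊗₁ F.ε))          ∎)
      natural (S.σ {A} {B}) = cancel-epic F.μ-isoʳ (begin
        (θ _ ∘ F.F₁ S.σ) ∘ F.μ            ≈⟨ pullʳ F.braided ⟩
        θ _ ∘ (F.μ ∘ σ)                   ≈⟨ extendʳ θ-⊗ ⟩
        G.μ ∘ ((θ B ⊗₁ θ A) ∘ σ)          ≈⟨ refl⟩∘⟨ σ-natural ⟨
        G.μ ∘ (σ ∘ (θ A ⊗₁ θ B))          ≈⟨ extendʳ (≈.sym G.braided) ⟩
        G.F₁ S.σ ∘ (G.μ ∘ (θ A ⊗₁ θ B))   ≈⟨ pullʳ θ-⊗ ⟨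
        (G.F₁ S.σ ∘ θ _) ∘ F.μ            ∎)
      natural (S.copy {A}) = begin
        θ _ ∘ F.F₁ S.copy              ≈⟨ refl⟩∘⟨ F.copy-preserving ⟩
        θ _ ∘ (F.μ ∘ copy)             ≈⟨ extendʳ θ-⊗ ⟩
        G.μ ∘ ((θ A ⊗₁ θ A) ∘ copy)    ≈⟨ refl⟩∘⟨ θ-deterministic A ⟨
        G.μ ∘ (copy ∘ θ A)             ≈⟨ pullˡ (≈.sym G.copy-preserving) ⟩
        G.F₁ S.copy ∘ θ A              ∎
      natural S.discard = GP.F₀-unit-terminal
      natural (S.α⇐ {A} {B} {C}) = natural⁻¹ S.α-isoˡ S.α-isoʳ (natural (S.α⇒ {A} {B} {C}))
      natural (S.λ⇐ {A})         = natural⁻¹ S.λ-isoˡ S.λ-isoʳ (natural (S.λ⇒ {A}))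
      natural (S.ρ⇐ {A})         = natural⁻¹ S.ρ-isoˡ S.ρ-isoʳ (natural (S.ρ⇒ {A}))

      transformation : NaturalTransformation F G
      transformation = record
        { η = θ ; natural = natural ; monoidal-⊗ = θ-⊗ ; monoidal-unit = θ-unit
        ; deterministic = θ-deterministic
        }

-- Positions in substituted tensor products

module _ (f : T → Obj T′) where

  bindAt : ∀ {x y A} → x ∈ᵗ A → y ∈ᵗ f x → y ∈ᵗ bind f A
  bindAt here      k = k
  bindAt (left i)  k = left (bindAt i k)
  bindAt (right i) k = right (bindAt i k)

  origin : ∀ {y} A → y ∈ᵗ bind f A → T
  origin (var x) k         = x
  origin (A ⊗ B) (left k)  = origin A k
  origin (A ⊗ B) (right k) = origin B k

  origin-bindAt : ∀ {x y A} (i : x ∈ᵗ A) (k : y ∈ᵗ f x) → origin A (bindAt i k) ≡ x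
  origin-bindAt here      k = refl
  origin-bindAt (left i)  k = origin-bindAt i k
  origin-bindAt (right i) k = origin-bindAt i k

  bindAt-injective : ∀ {x y A} (i : x ∈ᵗ A) {k l : y ∈ᵗ f x} → bindAt i k ≡ bindAt i l → k ≡ l
  bindAt-injective here      p = p
  bindAt-injective (left i)  p = bindAt-injective i (left-injective p)
    where
    left-injective : ∀ {y A B} {k l : y ∈ᵗ A} → left {B = B} k ≡ left l → k ≡ l
    left-injective refl = refl
  bindAt-injective (right i) p = bindAt-injective i (right-injective p)
    where
    right-injective : ∀ {y A B} {k l : y ∈ᵗ B} → right {A = A} k ≡ right l → k ≡ l
    right-injective refl = refl

  distinct-factor : ∀ {x A} → x ∈ᵗ A → Distinct (bind f A) → Distinct (f x)
  distinct-factor i d y k l = bindAt-injective i (d y _ _)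

  -- The two occurrences of `y` become positions of one object with distinct factors, so they
  -- coincide there, and `origin` recovers `x` and `x′` from them. This is the source of the
  -- disjointness of the sets `π(X)`.
  distinct-factors : ∀ {x x′ y A} → Distinct (bind f A) → x ∈ᵗ A → x′ ∈ᵗ A →
                     y ∈ᵗ f x → y ∈ᵗ f x′ → x ≡ x′
  distinct-factors {A = A} d i i′ k k′ =
    trans (sym (origin-bindAt i k))
      (trans (cong (origin A) (d _ (bindAt i k) (bindAt i′ k′))) (origin-bindAt i′ k′))

  unbind : ∀ {y} xs → y ∈ᵗ bind f (⨂ xs) → Σ[ x ∈ T ] x ∈ˡ xs × y ∈ᵗ f x
  unbind (x ∷ xs) (left k)  = x , at⁻¹ (left here) , k
  unbind (x ∷ xs) (right k) with x′ , i , k′ ← unbind xs k = x′ , at⁻¹ (right (at i)) , k′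

  -- The converse passage, from disjoint sets to distinct factors: a variable occurring both in the
  -- head and in the tail would make the head of the list occur again in its tail.
  bind-distinct : (∀ x → Distinct (f x)) → (∀ {x x′ y} → y ∈ᵗ f x → y ∈ᵗ f x′ → x ≡ x′) →
                  ∀ {xs} → Unique xs → Distinct (bind f (⨂ xs))
  bind-distinct d h (_ ∷ _)  y (left k)  (left l)  = cong left (d _ y k l)
  bind-distinct d h (x∉ ∷ _) y (left k)  (right l) with x′ , i , l′ ← unbind _ l =
    ⊥-elim (All.lookup x∉ i (h k l′))
  bind-distinct d h (x∉ ∷ _) y (right k) (left l)  with x′ , i , k′ ← unbind _ k =
    ⊥-elim (All.lookup x∉ i (h l k′))
  bind-distinct d h (_ ∷ u)  y (right k) (right l) = cong right (bind-distinct d h u y k l)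

  -- Moves whole blocks `f x` as `r` moves single factors `x`; this is what a wire becomes when a
  -- tensor product of maps out of the blocks is pulled through it.
  bindRewiring : ∀ {A} B → Rewiring A B → Rewiring (bind f A) (bind f B)
  bindRewiring (var x) r y k         = bindAt (r x here) k
  bindRewiring (B ⊗ C) r y (left k)  = bindRewiring B (λ x i → r x (left i)) y k
  bindRewiring (B ⊗ C) r y (right k) = bindRewiring C (λ x i → r x (right i)) y k

  bindRewiring-left : ∀ {A A′} B (r : Rewiring A B) y k →
                      bindRewiring {A ⊗ A′} B (λ x i → left (r x i)) y k ≡ left (bindRewiring B r y k)
  bindRewiring-left (var x) r y k         = refl
  bindRewiring-left (B ⊗ C) r y (left k)  = bindRewiring-left B _ y k
  bindRewiring-left (B ⊗ C) r y (right k) = bindRewiring-left C _ y k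

  bindRewiring-right : ∀ {A A′} B (r : Rewiring A B) y k →
                       bindRewiring {A′ ⊗ A} B (λ x i → right (r x i)) y k ≡ right (bindRewiring B r y k)
  bindRewiring-right (var x) r y k         = refl
  bindRewiring-right (B ⊗ C) r y (left k)  = bindRewiring-right B _ y k
  bindRewiring-right (B ⊗ C) r y (right k) = bindRewiring-right C _ y k

  bindRewiring-id : ∀ A y k → bindRewiring A (λ _ i → i) y k ≡ k
  bindRewiring-id (var x) y k         = refl
  bindRewiring-id (A ⊗ B) y (left k)  =
    trans (bindRewiring-left A (λ _ i → i) y k) (cong left (bindRewiring-id A y k))
  bindRewiring-id (A ⊗ B) y (right k) =
    trans (bindRewiring-right B (λ _ i → i) y k) (cong right (bindRewiring-id B y k))

  -- Needed because `Arr.bind-⨂-++` is defined by its own recursion instead of by substitution into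
  -- `Arr.⨂-++`.
  bindRewiring-++ : ∀ xs ys y k → bindRewiring (⨂ xs ⊗ ⨂ ys) (Arr.from (Arr.⨂-++ xs ys)) y k
                                    ≡ Arr.from (Arr.bind-⨂-++ f xs ys) y k
  bindRewiring-++ []       ys y (right k)        = bindRewiring-id (⨂ ys) y k
  bindRewiring-++ (x ∷ xs) ys y (left (left k))  = refl
  bindRewiring-++ (x ∷ xs) ys y (left (right k)) =
    trans (bindRewiring-right (⨂ xs) _ y k) (cong right (bindRewiring-++ xs ys y (left k)))
  bindRewiring-++ (x ∷ xs) ys y (right k)        =
    trans (bindRewiring-right (⨂ ys) _ y k) (cong right (bindRewiring-++ xs ys y (right k)))

module _ {f g : T → Obj T′} (s : ∀ x → Rewiring (f x) (g x)) where

  mapBind : ∀ A → Rewiring (bind f A) (bind g A)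
  mapBind (var x) y k         = s x y k
  mapBind (A ⊗ B) y (left k)  = left (mapBind A y k)
  mapBind (A ⊗ B) y (right k) = right (mapBind B y k)

  mapBind-++ : ∀ xs ys y k →
               mapBind (⨂ (xs ++ ys)) y (Arr.from (Arr.bind-⨂-++ g xs ys) y k)
                 ≡ Arr.from (Arr.bind-⨂-++ f xs ys) y (mapBind (⨂ xs ⊗ ⨂ ys) y k)
  mapBind-++ []       ys y (right k)        = refl
  mapBind-++ (x ∷ xs) ys y (left (left k))  = refl
  mapBind-++ (x ∷ xs) ys y (left (right k)) = cong right (mapBind-++ xs ys y (left k))
  mapBind-++ (x ∷ xs) ys y (right k)        = cong right (mapBind-++ xs ys y (right k))

mapBind-id : ∀ {f : T → Obj T′} A y k → mapBind {f = f} (λ _ _ i → i) A y k ≡ k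
mapBind-id (var x) y k         = refl
mapBind-id (A ⊗ B) y (left k)  = cong left (mapBind-id A y k)
mapBind-id (A ⊗ B) y (right k) = cong right (mapBind-id B y k)

-- Matching the sets of a query with their images

image-cong : {π π′ : Fin nH → Subset nL} → (∀ x → π x ≡ π′ x) → ∀ S → image π S ≡ image π′ S
image-cong p S = cong ⋃ (map-cong p (elems S))

-- This is the equation that `arrange` requires, and it mentions no `image`: the same target set can
-- thus serve for two different families `f`.
Block : (Fin nH → Obj (Fin nL)) → Subset nH → Subset nL → Set
Block f S V = vars (bind f (⨂ (elems S))) ≡ vars (⨂ (elems V))

imageBlock : (f : Fin nH → Obj (Fin nL)) {π : Fin nH → Subset nL} →
             (∀ x → vars (f x) ≡ π x) → ∀ S → Block f S (image π S)
imageBlock f p S = trans (vars-image f S) (cong (vars ∘ᶠ ⨂ ∘ᶠ elems) (image-cong p S))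

imageBlocks : (f : Fin nH → Obj (Fin nL)) {π : Fin nH → Subset nL} → (∀ x → vars (f x) ≡ π x) →
              ∀ {m} (Ss : Vec (Subset nH) m) → Pointwise (Block f) Ss (Vec.map (image π) Ss)
imageBlocks f p []       = []
imageBlocks f p (S ∷ Ss) = imageBlock f p S ∷ imageBlocks f p Ss

module _ (f : Fin nH → Obj (Fin nL)) (distinct : ∀ S → Distinct (bind f (⨂ (elems S)))) where

  -- `arrangeAll` with the target blocks freed from being images, so that they can
  -- be replaced along an equation.
  arrangeBlocks : ∀ {m} {Ss : Vec (Subset nH) m} {Vs : Vec (Subset nL) m} →
                  Pointwise (Block f) Ss Vs →
                  Arrangement (bind f (⨂ (concatElems Ss))) (⨂ (concatElems Vs))
  arrangeBlocks []                                 = Arr.idₐ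
  arrangeBlocks (_∷_ {x = S} {y = V} {xs = Ss} b bs) =
    Arr.transₐ (Arr.bind-⨂-++ f (elems S) (concatElems Ss))
      (Arr.transₐ
        (Arr._⊗ₐ_ (arrange (distinct S) (elems-distinct V) b) (arrangeBlocks bs))
        (Arr.symₐ (Arr.⨂-++ (elems V) _)))

  -- The two sides differ only in their proofs that variable sets are equal, and such proofs are
  -- unique.
  arrangeAll-blocks : ∀ {m} (Ss : Vec (Subset nH) m) →
                      arrangeAll f distinct Ss ≡ arrangeBlocks (imageBlocks f (λ _ → refl) Ss)
  arrangeAll-blocks []       = refl
  arrangeAll-blocks (S ∷ Ss) = cong₂
    (λ b a → Arr.transₐ (Arr.bind-⨂-++ f (elems S) (concatElems Ss))
      (Arr.transₐ (Arr._⊗ₐ_ (arrange (distinct S) (elems-distinct (image _ S)) b) a)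
                  (Arr.symₐ (Arr.⨂-++ (elems (image _ S)) _))))
    (≡-irrelevant _ _) (arrangeAll-blocks Ss)

module _ {f g : Fin nH → Obj (Fin nL)} (s : ∀ x → Rewiring (f x) (g x))
         (df : ∀ S → Distinct (bind f (⨂ (elems S)))) (dg : ∀ S → Distinct (bind g (⨂ (elems S)))) where

  -- Inside one block the factors are distinct, so any two positions of a variable agree, whatever
  -- `s` is. Different blocks may share variables, so this argument is available only one block at a
  -- time.
  arrangeBlocks-mapBind :
    ∀ {m} {Ss : Vec (Subset nH) m} {Vs : Vec (Subset nL) m}
    (p : Pointwise (Block f) Ss Vs) (q : Pointwise (Block g) Ss Vs) y k →
    mapBind s (⨂ (concatElems Ss)) y (Arr.from (arrangeBlocks g dg q) y k)
      ≡ Arr.from (arrangeBlocks f df p) y k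
  arrangeBlocks-mapBind (_∷_ {x = S} {y = V} {xs = Ss} b bs) (c ∷ cs) y k =
    -- The position is first located in the head block or in the rest; generalising it to `j` allows
    -- the case split.
    onBlocks (Arr.to (Arr.⨂-++ (elems V) _) y k)
    where
    onBlocks : ∀ j →
      mapBind s (⨂ (elems S ++ concatElems Ss)) y (Arr.from (Arr.bind-⨂-++ g (elems S) (concatElems Ss)) y
        (Arr.from (Arr._⊗ₐ_ (arrange (dg S) (elems-distinct V) c) (arrangeBlocks g dg cs)) y j))
      ≡ Arr.from (Arr.bind-⨂-++ f (elems S) (concatElems Ss)) y
        (Arr.from (Arr._⊗ₐ_ (arrange (df S) (elems-distinct V) b) (arrangeBlocks f df bs)) y j)
    onBlocks (left j)  = trans (mapBind-++ s (elems S) (concatElems Ss) y _)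
      (cong (Arr.from (Arr.bind-⨂-++ f (elems S) (concatElems Ss)) y ∘ᶠ left) (df S y _ _))
    onBlocks (right j) = trans (mapBind-++ s (elems S) (concatElems Ss) y _)
      (cong (Arr.from (Arr.bind-⨂-++ f (elems S) (concatElems Ss)) y ∘ᶠ right)
            (arrangeBlocks-mapBind bs cs y j))

-- Functors sending queries to queries

module Unpacking {Σ Σ′ : Signature} (π : Functor (Free Σ) (Free Σ′)) where
  open Functor π
  open MarkovCategory (Free Σ′)
  open MarkovProperties (Free Σ′)

  pack : ∀ A → bind (onTypes π) A ⇒ F₀ A
  pack I       = ε
  pack (var x) = id
  pack (A ⊗ B) = μ ∘ (pack A ⊗₁ pack B)

  unpack-pack : ∀ A → unpack π A ∘ pack A ≈ id
  unpack-pack I       = ε-isoˡ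
  unpack-pack (var x) = identityˡ
  unpack-pack (A ⊗ B) = ≈.trans (pullʳ (cancelˡ μ-isoˡ)) (⊗-inverse (unpack-pack A) (unpack-pack B))

  pack-unpack : ∀ A → pack A ∘ unpack π A ≈ id
  pack-unpack I       = ε-isoʳ
  pack-unpack (var x) = identityˡ
  pack-unpack (A ⊗ B) =
    ≈.trans (pullʳ (cancelˡ (⊗-inverse (pack-unpack A) (pack-unpack B)))) μ-isoʳ

module TransformationInverse {Σ : Signature} {𝒟 : MarkovCategory o ℓ e} (F G : Functor (Free Σ) 𝒟)
  {t   : ∀ x → MarkovCategory._⇒_ 𝒟 (Functor.F₀ F (var x)) (Functor.F₀ G (var x))}
  {t⁻¹ : ∀ x → MarkovCategory._⇒_ 𝒟 (Functor.F₀ G (var x)) (Functor.F₀ F (var x))}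
  (inverse : ∀ x → MarkovCategory._≈_ 𝒟 (MarkovCategory._∘_ 𝒟 (t⁻¹ x) (t x)) (MarkovCategory.id 𝒟)) where
  open MarkovCategory 𝒟
  open MarkovProperties 𝒟
  private
    module F = Functor F
    module G = Functor G
    module T = TransformationOnTypes F G t
    module T⁻¹ = TransformationOnTypes G F t⁻¹

  θ-inverse : ∀ A → T⁻¹.θ A ∘ T.θ A ≈ id
  θ-inverse I       = ≈.trans (pullʳ (cancelˡ G.ε-isoˡ)) F.ε-isoʳ
  θ-inverse (var x) = inverse x
  θ-inverse (A ⊗ B) = ≈.trans (pullʳ (pullʳ (cancelˡ G.μ-isoˡ)))
    (≈.trans (refl⟩∘⟨ cancelˡ (⊗-inverse (θ-inverse A) (θ-inverse B))) F.μ-isoʳ)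

blocks-unique : ∀ {f : Fin nH → Obj (Fin nL)} {m} {Ss : Vec (Subset nH) m} {Vs Vs′ : Vec (Subset nL) m} →
                Pointwise (Block f) Ss Vs → Pointwise (Block f) Ss Vs′ → Vs ≡ Vs′
blocks-unique []       []       = refl
blocks-unique (b ∷ bs) (c ∷ cs) = cong₂ _∷_
  (trans (sym (vars-elems _)) (trans (sym b) (trans c (vars-elems _)))) (blocks-unique bs cs)

module _ (π : Functor (Free (CF nH)) (Free (CF nL))) where

  DistinctSets : Set
  DistinctSets = ∀ S → Distinct (bind (onTypes π) (⨂ (elems S)))

  SendsBlocks : DistinctSets → ∀ {m} {Ys Xs : Vec (Subset nH) m} {Ys′ Xs′ : Vec (Subset nL) m} →
                Pointwise (Block (onTypes π)) Xs Xs′ → Pointwise (Block (onTypes π)) Ys Ys′ → Set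
  SendsBlocks distinct {Ys = Ys} {Xs} {Ys′} {Xs′} bX bY =
    Sends π (query Ys Xs) (query Ys′ Xs′) (arrangeBlocks _ distinct bX) (arrangeBlocks _ distinct bY)

  -- By `blocks-unique` both targets consist of the same sets, so they are one query. The wires do
  -- not depend on the proofs they are built from: this is `arrangeBlocks-mapBind` with identity
  -- rewirings as `s`.
  sends-transport : (distinct distinct′ : DistinctSets) →
    ∀ {m} {Ys Xs : Vec (Subset nH) m} {Ys₁ Xs₁ Ys₂ Xs₂ : Vec (Subset nL) m}
    (bX₁ : Pointwise (Block (onTypes π)) Xs Xs₁) (bY₁ : Pointwise (Block (onTypes π)) Ys Ys₁)
    (bX₂ : Pointwise (Block (onTypes π)) Xs Xs₂) (bY₂ : Pointwise (Block (onTypes π)) Ys Ys₂) →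
    SendsBlocks distinct bX₁ bY₁ → SendsBlocks distinct′ bX₂ bY₂
  sends-transport d d′ bX₁ bY₁ bX₂ bY₂ p
    with refl ← blocks-unique bX₁ bX₂ | refl ← blocks-unique bY₁ bY₂ =
    ≈.trans (same bY₂ bY₁ d′ d ⟩∘⟨refl) (≈.trans p (refl⟩∘⟨ (same bX₁ bX₂ d d′ ⟩∘⟨refl)))
    where
    open MarkovCategory (Free (CF nL))
    open MarkovProperties (Free (CF nL))
    open FreeWiring (CF nL)
    open FreeWires (CF nL)

    same : ∀ {m} {Ss : Vec (Subset nH) m} {Vs : Vec (Subset nL) m} (b c : Pointwise (Block (onTypes π)) Ss Vs)
           (db dc : DistinctSets) →
           wire _ _ (Arr.from (arrangeBlocks _ db b)) ≈ wire _ _ (Arr.from (arrangeBlocks _ dc c))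
    same {Ss = Ss} b c db dc = wire-cong (λ x i → trans
      (sym (arrangeBlocks-mapBind (λ _ _ j → j) db dc b c x i))
      (mapBind-id {f = onTypes π} (⨂ (concatElems Ss)) x _))

-- Comparing two functors by matching names

module Comparison (π π′ : Functor (Free (CF nH)) (Free (CF nL)))
  (distinct : DistinctSets π) (distinct′ : DistinctSets π′)
  (s : ∀ x → Rewiring (onTypes π x) (onTypes π′ x)) where

  open MarkovCategory (Free (CF nL))
  open MarkovProperties (Free (CF nL))
  open FreeWiring (CF nL)
  open FreeWires (CF nL)
  open ≈-Reasoning
  private
    module π = Functor π
    module π′ = Functor π′
    module U′ = Unpacking π′

  open TransformationOnTypes π π′ (λ x → wire _ _ (s x)) public

  -- Unpacking strips off the unknown structure maps of both functors, and leaves a wire.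
  θ-unpack : ∀ A → unpack π′ A ∘ θ A ≈ wire _ _ (mapBind s A) ∘ unpack π A
  θ-unpack I       = terminal
  θ-unpack (var x) = ≈.trans identityˡ (≈.sym identityʳ)
  θ-unpack (A ⊗ B) = begin
    ((unpack π′ A ⊗₁ unpack π′ B) ∘ π′.μ⁻¹) ∘ (π′.μ ∘ ((θ A ⊗₁ θ B) ∘ π.μ⁻¹))
      ≈⟨ pullʳ (cancelˡ π′.μ-isoˡ) ⟩
    (unpack π′ A ⊗₁ unpack π′ B) ∘ ((θ A ⊗₁ θ B) ∘ π.μ⁻¹)
      ≈⟨ extendʳ (⊗-square (θ-unpack A) (θ-unpack B)) ⟩
    (wire _ _ (mapBind s A) ⊗₁ wire _ _ (mapBind s B)) ∘ ((unpack π A ⊗₁ unpack π B) ∘ π.μ⁻¹)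
      ≈⟨ wire-⊗ {t = mapBind s (A ⊗ B)} (λ _ _ → refl) (λ _ _ → refl) ⟩∘⟨refl ⟩
    wire _ _ (mapBind s (A ⊗ B)) ∘ unpack π (A ⊗ B) ∎

  θ-blocks : ∀ {m} {Ss : Vec (Subset nH) m} {Vs : Vec (Subset nL) m}
             (b : Pointwise (Block (onTypes π)) Ss Vs) (b′ : Pointwise (Block (onTypes π′)) Ss Vs) →
             wire _ _ (Arr.from (arrangeBlocks _ distinct′ b′)) ∘ (unpack π′ _ ∘ θ (⨂ (concatElems Ss)))
             ≈ wire _ _ (Arr.from (arrangeBlocks _ distinct b)) ∘ unpack π _
  θ-blocks b b′ = ≈.trans (refl⟩∘⟨ θ-unpack _)
    (pullˡ (wire-∘ (arrangeBlocks-mapBind s distinct distinct′ b b′)))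

  -- Both functors send the query to the same generator `g′`, and by `θ-blocks` the comparison
  -- respects the identifications used. The identification of the outputs is invertible, hence can
  -- be cancelled.
  θ-gen : ∀ {m} {Ys Xs : Vec (Subset nH) m} {Ys′ Xs′ : Vec (Subset nL) m}
    (bX : Pointwise (Block (onTypes π)) Xs Xs′) (bY : Pointwise (Block (onTypes π)) Ys Ys′)
    (bX′ : Pointwise (Block (onTypes π′)) Xs Xs′) (bY′ : Pointwise (Block (onTypes π′)) Ys Ys′) →
    SendsBlocks π distinct bX bY → SendsBlocks π′ distinct′ bX′ bY′ → Natural (Syntax.gen (query Ys Xs))
  θ-gen {Ys = Ys} {Xs} {Ys′} {Xs′} bX bY bX′ bY′ p p′ =
    isoMonic (U′.pack-unpack _) (isoMonic (arrangement-isoˡ (arrangeBlocks _ distinct′ bY′)) (begin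
      wY′ ∘ (unpack π′ _ ∘ (θ _ ∘ π.F₁ g))       ≈⟨ refl⟩∘⟨ assoc ⟨
      wY′ ∘ ((unpack π′ _ ∘ θ _) ∘ π.F₁ g)       ≈⟨ pullˡ (θ-blocks bY bY′) ⟩
      (wY ∘ unpack π _) ∘ π.F₁ g                 ≈⟨ assoc ⟩
      wY ∘ (unpack π _ ∘ π.F₁ g)                 ≈⟨ p ⟩
      g′ ∘ (wX ∘ unpack π _)                     ≈⟨ refl⟩∘⟨ θ-blocks bX bX′ ⟨
      g′ ∘ (wX′ ∘ (unpack π′ _ ∘ θ _))           ≈⟨ refl⟩∘⟨ assoc ⟨
      g′ ∘ ((wX′ ∘ unpack π′ _) ∘ θ _)           ≈⟨ pullˡ (≈.sym p′) ⟩
      (wY′ ∘ (unpack π′ _ ∘ π′.F₁ g)) ∘ θ _      ≈⟨ pullʳ assoc ⟩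
      wY′ ∘ (unpack π′ _ ∘ (π′.F₁ g ∘ θ _))      ∎))
    where
    g   = Syntax.gen (query Ys Xs)
    g′  = Syntax.gen (query Ys′ Xs′)
    wX  = wire _ _ (Arr.from (arrangeBlocks _ distinct bX))
    wY  = wire _ _ (Arr.from (arrangeBlocks _ distinct bY))
    wX′ = wire _ _ (Arr.from (arrangeBlocks _ distinct′ bX′))
    wY′ = wire _ _ (Arr.from (arrangeBlocks _ distinct′ bY′))

-- Abstractions between two causal models

module Abstractions (𝒞 : MarkovCategory o ℓ e) (L H : FCM 𝒞) where
  open MarkovCategory 𝒞
  open MarkovProperties 𝒞
  open ≈-Reasoning
  private
    module L = FCM L
    module H = FCM H
    ΣL = CF L.size
    ΣH = CF H.size
    ⟦L⟧ = Semantics.model L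
    ⟦H⟧ = Semantics.model H
    module S = Syntax ΣL
    module SH = Syntax ΣH
    module FL = MarkovCategory (Free ΣL)
    module FLP = MarkovProperties (Free ΣL)
    module W = FreeWires ΣL
    module Wᴴ = FreeWires ΣH
    open FreeWiring ΣL using () renaming (wire to wireᴸ)
    open Extend ΣL 𝒞 L.X (Semantics.channel L) using (⟦_⟧₁; ⟦⟧-resp-≈)
    open Interpretation ΣL 𝒞 L.X (Semantics.channel L) using (⟦wire⟧)
    open Extend ΣH 𝒞 H.X (Semantics.channel H) using () renaming (⟦_⟧₁ to ⟦_⟧ᴴ; ⟦⟧-resp-≈ to ⟦⟧ᴴ-resp-≈)
    open Interpretation ΣH 𝒞 H.X (Semantics.channel H) using () renaming (⟦wire⟧ to ⟦wireᴴ⟧)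

    VL = Fin L.size
    VH = Fin H.size

  -- Wires in the two models

  join-split : ∀ xs ys → H.join xs ys ∘ H.split xs ys ≈ id
  join-split xs ys = ≈.trans
    (≈-reflexive (sym (cong₂ _∘_
      (⟦wireᴴ⟧ (⨂ xs ⊗ ⨂ ys) (⨂ (xs ++ ys)) (Arr.to (Arr.⨂-++ xs ys)))
      (⟦wireᴴ⟧ (⨂ (xs ++ ys)) (⨂ xs ⊗ ⨂ ys) (Arr.from (Arr.⨂-++ xs ys))))))
    (⟦⟧ᴴ-resp-≈ (Wᴴ.arrangement-isoˡ (Arr.⨂-++ xs ys)))

  -- Opaque because ⟦_⟧ is not injective: the objects are then inferred from the wire.
  opaque

    wire : ∀ A B → Rewiring A B → L.⟦ A ⟧ ⇒ L.⟦ B ⟧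
    wire A B r = ⟦ wireᴸ A B r ⟧₁

    ⟦wireᴸ⟧≡wire : ∀ A B r → ⟦ wireᴸ A B r ⟧₁ ≡ wire A B r
    ⟦wireᴸ⟧≡wire A B r = refl

    L-wire≡wire : ∀ A B r → L.wire A B r ≡ wire A B r
    L-wire≡wire A B r = sym (⟦wire⟧ A B r)

    wire-pair : ∀ {A B C r} → wire A (B ⊗ C) r ≈
                ⟨ wire A B (λ x i → r x (left i)) , wire A C (λ x i → r x (right i)) ⟩
    wire-pair = ≈.refl

    wire-deterministic : ∀ {A B r} → Deterministic (wire A B r)
    wire-deterministic {A} {B} {r} = FunctorProperties.F-deterministic ⟦L⟧ (W.wire-deterministic B r)

    wire-cong : ∀ {A B r s} → (∀ x i → r x i ≡ s x i) → wire A B r ≈ wire A B s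
    wire-cong {A} {B} p = ⟦⟧-resp-≈ (W.wire-cong {A} {B} p)

    wire-id : ∀ {A r} → (∀ x i → r x i ≡ i) → wire A A r ≈ id
    wire-id {A} {r} p = ⟦⟧-resp-≈ (W.wire-id {A} {r} p)

    wire-∘ : ∀ {A B C r s t} → (∀ x i → r x (s x i) ≡ t x i) → wire B C s ∘ wire A B r ≈ wire A C t
    wire-∘ {A} {B} {C} {r} {s} {t} p = ⟦⟧-resp-≈ (W.wire-∘ {A} {B} {C} {r} {s} {t} p)

    wire-⊗ : ∀ {A A′ B B′ r s t} →
             (∀ x i → t x (left i) ≡ left (r x i)) → (∀ x i → t x (right i) ≡ right (s x i)) →
             wire A A′ r ⊗₁ wire B B′ s ≈ wire (A ⊗ B) (A′ ⊗ B′) t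
    wire-⊗ {A} {A′} {B} {B′} {r} {s} {t} p q =
      ⟦⟧-resp-≈ (W.wire-⊗ {A} {A′} {B} {B′} {r} {s} {t} p q)

    wire-fst : ∀ {A B C r} → wire A C r ∘ fst ≈ wire (A ⊗ B) C (λ x i → left (r x i))
    wire-fst {A} {B} {C} {r} = ⟦⟧-resp-≈ (W.wire-fst {A} {C} {B} {r})

    wire-snd : ∀ {A B C r} → wire B C r ∘ snd ≈ wire (A ⊗ B) C (λ x i → right (r x i))
    wire-snd {A} {B} {C} {r} = ⟦⟧-resp-≈ (W.wire-snd {B} {C} {A} {r})

  wire-∘-distinct : ∀ {A B C r s t} → Distinct A → wire B C s ∘ wire A B r ≈ wire A C t
  wire-∘-distinct d = wire-∘ (λ x _ → d x _ _)

  wire-inverse-distinct : ∀ {A B r s} → Distinct A → wire B A s ∘ wire A B r ≈ id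
  wire-inverse-distinct d = ≈.trans (wire-∘-distinct d) (wire-id (λ _ _ → refl))

  -- Tensor products of components at variables

  module Tensor (f : VH → Obj VL) (t : ∀ x → L.⟦ f x ⟧ ⇒ H.X x) where

    -- Unlike in `τ⨂`, the objects `f x` are arbitrary: for a downward abstraction, `π(X)` need not
    -- list its variables in the order of `elems`.
    t⨂ : ∀ A → L.⟦ bind f A ⟧ ⇒ H.⟦ A ⟧
    t⨂ I       = id
    t⨂ (var x) = t x
    t⨂ (A ⊗ B) = t⨂ A ⊗₁ t⨂ B

    module _ (t-deterministic : ∀ x → Deterministic (t x)) where

      t⨂-deterministic : ∀ A → Deterministic (t⨂ A)
      t⨂-deterministic I       = id-deterministic
      t⨂-deterministic (var x) = t-deterministic x
      t⨂-deterministic (A ⊗ B) = ⊗-deterministic (t⨂-deterministic A) (t⨂-deterministic B)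

      t⨂-proj : ∀ {x A} (i : x ∈ᵗ A) →
                H.proj i ∘ t⨂ A ≈ t x ∘ wire (bind f A) (f x) (λ _ → bindAt f i)
      t⨂-proj here      = ≈.trans identityˡ
        (≈.trans (≈.sym identityʳ) (refl⟩∘⟨ ≈.sym (wire-id (λ _ _ → refl))))
      t⨂-proj (left i)  = ≈.trans (pullʳ fst-⊗) (≈.trans (pullˡ (t⨂-proj i)) (pullʳ wire-fst))
      t⨂-proj (right i) = ≈.trans (pullʳ snd-⊗) (≈.trans (pullˡ (t⨂-proj i)) (pullʳ wire-snd))

      -- A wire copies and discards its input, and a deterministic channel can be moved past both.
      t⨂-wire : ∀ A B (r : Rewiring A B) →
                H.wire A B r ∘ t⨂ A ≈ t⨂ B ∘ wire (bind f A) (bind f B) (bindRewiring f B r)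
      t⨂-wire A I       r = terminal
      t⨂-wire A (var x) r = t⨂-proj (r x here)
      t⨂-wire A (B ⊗ C) r = begin
        ⟨ H.wire A B _ , H.wire A C _ ⟩ ∘ t⨂ A           ≈⟨ ⟨⟩-∘ (t⨂-deterministic A) ⟩
        ⟨ H.wire A B _ ∘ t⨂ A , H.wire A C _ ∘ t⨂ A ⟩    ≈⟨ ⟨⟩-resp-≈ (t⨂-wire A B _) (t⨂-wire A C _) ⟩
        ⟨ t⨂ B ∘ wᴮ , t⨂ C ∘ wᶜ ⟩                        ≈⟨ ⊗-⟨⟩ ⟨
        (t⨂ B ⊗₁ t⨂ C) ∘ ⟨ wᴮ , wᶜ ⟩                     ≈⟨ refl⟩∘⟨ wire-pair ⟨
        (t⨂ B ⊗₁ t⨂ C) ∘ wire _ _ (bindRewiring f (B ⊗ C) r)  ∎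
        where
        wᴮ = wire (bind f A) (bind f B) (bindRewiring f B (λ x i → r x (left i)))
        wᶜ = wire (bind f A) (bind f C) (bindRewiring f C (λ x i → r x (right i)))

      -- By `t⨂-wire`, the split of the blocks becomes `H.split` after `t⨂`, where `H.join` cancels
      -- it.
      t⨂-split : ∀ xs ys →
        H.join xs ys ∘ ((t⨂ (⨂ xs) ⊗₁ t⨂ (⨂ ys)) ∘ wire _ _ (Arr.from (Arr.bind-⨂-++ f xs ys)))
          ≈ t⨂ (⨂ (xs ++ ys))
      t⨂-split xs ys = begin
        H.join xs ys ∘ (t⨂ (⨂ xs ⊗ ⨂ ys) ∘ wire _ _ (Arr.from (Arr.bind-⨂-++ f xs ys)))
          ≈⟨ refl⟩∘⟨ (refl⟩∘⟨ wire-cong (bindRewiring-++ f xs ys)) ⟨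
        H.join xs ys ∘ (t⨂ (⨂ xs ⊗ ⨂ ys) ∘ wire _ _ (bindRewiring f (⨂ xs ⊗ ⨂ ys) (Arr.from (Arr.⨂-++ xs ys))))
          ≈⟨ refl⟩∘⟨ t⨂-wire (⨂ (xs ++ ys)) (⨂ xs ⊗ ⨂ ys) _ ⟨
        H.join xs ys ∘ (H.split xs ys ∘ t⨂ (⨂ (xs ++ ys)))
          ≈⟨ cancelˡ (join-split xs ys) ⟩
        t⨂ (⨂ (xs ++ ys)) ∎

  open Tensor

  t⨂-mapBind : {f g : VH → Obj VL} {t : ∀ x → L.⟦ f x ⟧ ⇒ H.X x} {u : ∀ x → L.⟦ g x ⟧ ⇒ H.X x}
               (s : ∀ x → Rewiring (f x) (g x)) → (∀ x → u x ∘ wire (f x) (g x) (s x) ≈ t x) →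
               ∀ A → t⨂ g u A ∘ wire (bind f A) (bind g A) (mapBind s A) ≈ t⨂ f t A
  t⨂-mapBind s p I       = terminal
  t⨂-mapBind s p (var x) = p x
  t⨂-mapBind {f} {g} {t} {u} s p (A ⊗ B) = begin
    (t⨂ g u A ⊗₁ t⨂ g u B) ∘ wire _ _ (mapBind s (A ⊗ B))
      ≈⟨ refl⟩∘⟨ wire-⊗ (λ _ _ → refl) (λ _ _ → refl) ⟨
    (t⨂ g u A ⊗₁ t⨂ g u B) ∘ (wire _ _ (mapBind s A) ⊗₁ wire _ _ (mapBind s B))
      ≈⟨ ≈.trans (≈.sym ⊗-∘) (t⨂-mapBind s p A ⟩⊗⟨ t⨂-mapBind s p B) ⟩
    t⨂ f t A ⊗₁ t⨂ f t B ∎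

  -- The maps of an abstraction on sets of variables

  module _ (a : OnVariables L H) where
    open OnVariables a

    τ⨂≡t⨂ : ∀ A → τ⨂ A ≡ t⨂ π-obj τ A
    τ⨂≡t⨂ I       = refl
    τ⨂≡t⨂ (var x) = refl
    τ⨂≡t⨂ (A ⊗ B) = cong₂ _⊗₁_ (τ⨂≡t⨂ A) (τ⨂≡t⨂ B)

    module _ (f : VH → Obj VL) (t : ∀ x → L.⟦ f x ⟧ ⇒ H.X x) (s : ∀ x → Rewiring (f x) (π-obj x))
             (τ≈t : ∀ x → τ x ∘ wire (f x) (π-obj x) (s x) ≈ t x) where

      τ⨂-wire : ∀ A → τ⨂ A ∘ wire (bind f A) (bind π-obj A) (mapBind s A) ≈ t⨂ f t A
      τ⨂-wire A = ≈.trans (≈-reflexive (τ⨂≡t⨂ A) ⟩∘⟨refl) (t⨂-mapBind s τ≈t A)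

      module _ (t-deterministic : ∀ x → Deterministic (t x))
               (distinct : ∀ S → Distinct (bind f (⨂ (elems S)))) where

        -- An arbitrary `r` is allowed: the source has distinct factors, so `r` followed by the
        -- reordering inside `τS` agrees with `mapBind s`.
        τS-wire : ∀ S (r : Rewiring (bind f (⨂ (elems S))) (⨂ (elems (image π S)))) →
                  τS S ∘ wire _ _ r ≈ t⨂ f t (⨂ (elems S))
        τS-wire S r = begin
          τS S ∘ wire _ _ r
            ≈⟨ pullʳ (≈-reflexive (L-wire≡wire (⨂ (elems (image π S))) (bind π-obj (⨂ (elems S))) _) ⟩∘⟨refl) ⟩
          τ⨂ (⨂ (elems S)) ∘ (wire (⨂ (elems (image π S))) (bind π-obj (⨂ (elems S))) _ ∘ wire _ _ r)
            ≈⟨ refl⟩∘⟨ wire-∘-distinct (distinct S) ⟩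
          τ⨂ (⨂ (elems S)) ∘ wire _ _ (mapBind s (⨂ (elems S)))
            ≈⟨ τ⨂-wire (⨂ (elems S)) ⟩
          t⨂ f t (⨂ (elems S)) ∎

        -- Here the rewiring must respect the blocks, since a variable may occur in several of them.
        -- The split inside `τSs` undoes the final joining in `arrangeBlocks`, after which each
        -- block is handled by `τS-wire`.
        τSs-wire : ∀ {m} (Ss : Vec (Subset H.size) m) (bs : Pointwise (Block f) Ss (Vec.map (image π) Ss)) →
                   τSs Ss ∘ wire _ _ (Arr.from (arrangeBlocks f distinct bs)) ≈ t⨂ f t (⨂ (concatElems Ss))
        τSs-wire []       []       = terminal
        τSs-wire (S ∷ Ss) (b ∷ bs) = begin
          (H.join S′ Ss′ ∘ ((τS S ⊗₁ τSs Ss) ∘ L.split V′ Vs′)) ∘ wire _ _ (Arr.from all)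
            ≈⟨ pullʳ (pullʳ unsplit) ⟩
          H.join S′ Ss′ ∘ ((τS S ⊗₁ τSs Ss) ∘
            ((wire _ _ (Arr.from block) ⊗₁ wire _ _ (Arr.from rest)) ∘ wire _ _ (Arr.from parts)))
            ≈⟨ refl⟩∘⟨ pullˡ (≈.trans (≈.sym ⊗-∘) (τS-wire S _ ⟩⊗⟨ τSs-wire Ss bs)) ⟩
          H.join S′ Ss′ ∘ ((t⨂ f t (⨂ S′) ⊗₁ t⨂ f t (⨂ Ss′)) ∘ wire _ _ (Arr.from parts))
            ≈⟨ t⨂-split f t t-deterministic S′ Ss′ ⟩
          t⨂ f t (⨂ (S′ ++ Ss′)) ∎
          where
          S′    = elems S
          Ss′   = concatElems Ss
          V′    = elems (image π S)
          Vs′   = concatElems (Vec.map (image π) Ss)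
          parts = Arr.bind-⨂-++ f S′ Ss′
          block = arrange (distinct S) (elems-distinct _) b
          rest  = arrangeBlocks f distinct bs
          both  = Arr._⊗ₐ_ block rest
          all   = arrangeBlocks f distinct (b ∷ bs)

          unsplit : L.split V′ Vs′ ∘ wire _ _ (Arr.from all)
                    ≈ (wire _ _ (Arr.from block) ⊗₁ wire _ _ (Arr.from rest)) ∘ wire _ _ (Arr.from parts)
          unsplit = begin
            L.split V′ Vs′ ∘ wire _ _ (Arr.from all)
              ≈⟨ ≈-reflexive (L-wire≡wire _ (⨂ V′ ⊗ ⨂ Vs′) (Arr.from (Arr.⨂-++ V′ Vs′))) ⟩∘⟨refl ⟩
            wire _ _ (Arr.from (Arr.⨂-++ V′ Vs′)) ∘ wire _ _ (Arr.from all)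
              ≈⟨ wire-∘ (λ x i → cong (λ j → Arr.from parts x (Arr.from both x j))
                   (Inverse.strictlyInverseˡ (Arr.⨂-++ V′ Vs′ x) i)) ⟩
            wire _ _ (λ x i → Arr.from parts x (Arr.from both x i))
              ≈⟨ wire-∘ (λ _ _ → refl) ⟨
            wire _ _ (Arr.from both) ∘ wire _ _ (Arr.from parts)
              ≈⟨ wire-⊗ (λ _ _ → refl) (λ _ _ → refl) ⟩∘⟨refl ⟨
            (wire _ _ (Arr.from block) ⊗₁ wire _ _ (Arr.from rest)) ∘ wire _ _ (Arr.from parts) ∎

  -- Naturality at a query and consistency at that query

  module _ (π : Functor (Free ΣH) (Free ΣL))
           (η : ∀ A → L.⟦ Functor.F₀ π A ⟧ ⇒ H.⟦ A ⟧)
           (η-⊗ : ∀ A B → η (A ⊗ B) ∘ ⟦ Functor.μ π ⟧₁ ≈ η A ⊗₁ η B) where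
    private module π = Functor π

    -- Repeated use of monoidality; `η-⊗` is its form when the identity structure maps of the two
    -- models are left out.
    η-unpack : ∀ A → t⨂ (onTypes π) (λ x → η (var x)) A ∘ ⟦ unpack π A ⟧₁ ≈ η A
    η-unpack I       = terminal
    η-unpack (var x) = identityʳ
    η-unpack (A ⊗ B) = begin
      (t⨂ _ _ A ⊗₁ t⨂ _ _ B) ∘ ((⟦ unpack π A ⟧₁ ⊗₁ ⟦ unpack π B ⟧₁) ∘ ⟦ π.μ⁻¹ ⟧₁)
        ≈⟨ pullˡ (≈.trans (≈.sym ⊗-∘) (η-unpack A ⟩⊗⟨ η-unpack B)) ⟩
      (η A ⊗₁ η B) ∘ ⟦ π.μ⁻¹ ⟧₁                 ≈⟨ η-⊗ A B ⟩∘⟨refl ⟨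
      (η (A ⊗ B) ∘ ⟦ π.μ ⟧₁) ∘ ⟦ π.μ⁻¹ ⟧₁       ≈⟨ cancelʳ (⟦⟧-resp-≈ π.μ-isoʳ) ⟩
      η (A ⊗ B)                                 ∎

    module _ (a : OnVariables L H) (η-deterministic : ∀ x → Deterministic (η (var x)))
             (distinct : DistinctSets π) (s : ∀ x → Rewiring (onTypes π x) (OnVariables.π-obj a x))
             (τ≈η : ∀ x → OnVariables.τ a x ∘ wire (onTypes π x) (OnVariables.π-obj a x) (s x)
                            ≈ η (var x)) where
      private
        module a = OnVariables a
        module U = Unpacking π

        Blocks : ∀ {m} → Vec (Subset H.size) m → Set
        Blocks Ss = Pointwise (Block (onTypes π)) Ss (Vec.map (image a.π) Ss)

        gather : ∀ {m} {Ss : Vec (Subset H.size) m} → Blocks Ss →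
                 π.F₀ (⨂ (concatElems Ss)) S.⇒ ⨂ (concatElems (Vec.map (image a.π) Ss))
        gather bs = wireᴸ _ _ (Arr.from (arrangeBlocks _ distinct bs)) S.∘ unpack π _

        gather-epic : ∀ {m} {Ss : Vec (Subset H.size) m} (bs : Blocks Ss) → Epic ⟦ gather bs ⟧₁
        gather-epic bs = ∘-epic
          (isoEpic (⟦⟧-resp-≈ (W.arrangement-isoˡ (Arr.symₐ (arrangeBlocks _ distinct bs)))))
          (isoEpic (⟦⟧-resp-≈ (U.unpack-pack _)))

        τSs-gather : ∀ {m} {Ss : Vec (Subset H.size) m} (bs : Blocks Ss) →
                     a.τSs Ss ∘ ⟦ gather bs ⟧₁ ≈ η (⨂ (concatElems Ss))
        τSs-gather {Ss = Ss} bs = begin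
          a.τSs Ss ∘ ⟦ gather bs ⟧₁
            ≈⟨ refl⟩∘⟨ (≈-reflexive (⟦wireᴸ⟧≡wire _ _ (Arr.from (arrangeBlocks _ distinct bs))) ⟩∘⟨refl) ⟩
          a.τSs Ss ∘ (wire _ _ (Arr.from (arrangeBlocks _ distinct bs)) ∘ ⟦ unpack π _ ⟧₁)
            ≈⟨ pullˡ (τSs-wire a _ _ s τ≈η η-deterministic distinct Ss bs) ⟩
          t⨂ _ _ (⨂ (concatElems Ss)) ∘ ⟦ unpack π _ ⟧₁
            ≈⟨ η-unpack (⨂ (concatElems Ss)) ⟩
          η (⨂ (concatElems Ss)) ∎

      module _ {m} {Ys Xs : Vec (Subset H.size) m} (bX : Blocks Xs) (bY : Blocks Ys)
               (sends : SendsBlocks π distinct bX bY) where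
        private
          q  = query Ys Xs
          q′ = mapQuery L H (image a.π) q

          -- This is `sends` interpreted in `L` and followed by `τSs` on the outputs. It links the
          -- left sides of consistency and naturality, in both directions.
          query-square : a.τSs Ys ∘ (Semantics.channel L q′ ∘ ⟦ gather bX ⟧₁)
                         ≈ η (⨂ (concatElems Ys)) ∘ ⟦ π.F₁ (SH.gen q) ⟧₁
          query-square = begin
            a.τSs Ys ∘ (Semantics.channel L q′ ∘ ⟦ gather bX ⟧₁)     ≈⟨ refl⟩∘⟨ ⟦⟧-resp-≈ sends ⟨
            a.τSs Ys ∘
              ⟦ wireᴸ _ _ (Arr.from (arrangeBlocks _ distinct bY)) S.∘ (unpack π _ S.∘ π.F₁ (SH.gen q)) ⟧₁
              ≈⟨ refl⟩∘⟨ assoc ⟨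
            a.τSs Ys ∘ (⟦ gather bY ⟧₁ ∘ ⟦ π.F₁ (SH.gen q) ⟧₁)       ≈⟨ pullˡ (τSs-gather bY) ⟩
            η (⨂ (concatElems Ys)) ∘ ⟦ π.F₁ (SH.gen q) ⟧₁            ∎

        consistent⇒natural :
          a.τSs Ys ∘ Semantics.channel L q′ ≈ Semantics.channel H q ∘ a.τSs Xs →
          η (⨂ (concatElems Ys)) ∘ ⟦ π.F₁ (SH.gen q) ⟧₁ ≈ Semantics.channel H q ∘ η (⨂ (concatElems Xs))
        consistent⇒natural p = begin
          η (⨂ (concatElems Ys)) ∘ ⟦ π.F₁ (SH.gen q) ⟧₁          ≈⟨ query-square ⟨
          a.τSs Ys ∘ (Semantics.channel L q′ ∘ ⟦ gather bX ⟧₁)   ≈⟨ extendʳ p ⟩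
          Semantics.channel H q ∘ (a.τSs Xs ∘ ⟦ gather bX ⟧₁)    ≈⟨ refl⟩∘⟨ τSs-gather bX ⟩
          Semantics.channel H q ∘ η (⨂ (concatElems Xs))         ∎

        -- The two sides are compared after `gather bX`, the isomorphism from `π` of the inputs to
        -- the inputs of the image query, and this is then cancelled.
        natural⇒consistent :
          η (⨂ (concatElems Ys)) ∘ ⟦ π.F₁ (SH.gen q) ⟧₁ ≈ Semantics.channel H q ∘ η (⨂ (concatElems Xs)) →
          a.τSs Ys ∘ Semantics.channel L q′ ≈ Semantics.channel H q ∘ a.τSs Xs
        natural⇒consistent p = gather-epic bX _ _ (begin
          (a.τSs Ys ∘ Semantics.channel L q′) ∘ ⟦ gather bX ⟧₁   ≈⟨ assoc ⟩
          a.τSs Ys ∘ (Semantics.channel L q′ ∘ ⟦ gather bX ⟧₁)   ≈⟨ query-square ⟩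
          η (⨂ (concatElems Ys)) ∘ ⟦ π.F₁ (SH.gen q) ⟧₁          ≈⟨ p ⟩
          Semantics.channel H q ∘ η (⨂ (concatElems Xs))         ≈⟨ pullʳ (τSs-gather bX) ⟨
          (Semantics.channel H q ∘ a.τSs Xs) ∘ ⟦ gather bX ⟧₁    ∎)

  -- Lets the image sets be described by any `g` that agrees with the variables of `π(X)`. Two
  -- functors can then be given literally the same target query.
  sends-arrangeAll : (π : Functor (Free ΣH) (Free ΣL)) (distinct : DistinctSets π) {g : VH → Subset L.size}
    (g-sets : ∀ x → vars (onTypes π x) ≡ g x) (q : CFQuery H.size) →
    let open CFQuery q in
    (Sends π q (mapQuery L H (image (λ x → vars (onTypes π x))) q)
       (arrangeAll (onTypes π) distinct Xs) (arrangeAll (onTypes π) distinct Ys) →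
     SendsBlocks π distinct (imageBlocks (onTypes π) g-sets Xs) (imageBlocks (onTypes π) g-sets Ys))
    ×
    (SendsBlocks π distinct (imageBlocks (onTypes π) g-sets Xs) (imageBlocks (onTypes π) g-sets Ys) →
     Sends π q (mapQuery L H (image (λ x → vars (onTypes π x))) q)
       (arrangeAll (onTypes π) distinct Xs) (arrangeAll (onTypes π) distinct Ys))
  sends-arrangeAll π distinct g-sets (query Ys Xs)
    rewrite arrangeAll-blocks (onTypes π) distinct Xs | arrangeAll-blocks (onTypes π) distinct Ys =
    sends-transport π distinct distinct (own Xs) (own Ys) (given Xs) (given Ys) ,
    sends-transport π distinct distinct (given Xs) (given Ys) (own Xs) (own Ys)
    where
    own given : ∀ {m} (Ss : Vec (Subset H.size) m) → Pointwise (Block (onTypes π)) Ss _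
    own   = imageBlocks (onTypes π) (λ _ → refl)
    given = imageBlocks (onTypes π) g-sets

  -- Brings transports into the calculus of wires; any `r` will do because `elems` has no
  -- repetitions.
  subst-wire : ∀ {X S S′} (p : S ≡ S′) (r : Rewiring (⨂ (elems S′)) (⨂ (elems S)))
               (h : L.⟦ ⨂ (elems S) ⟧ ⇒ X) →
               subst (λ S → L.⟦ ⨂ (elems S) ⟧ ⇒ X) p h ≈ h ∘ wire _ _ r
  subst-wire {S = S} refl r h = ≈.sym (≈.trans
    (refl⟩∘⟨ wire-id (λ x i → elems-distinct S x _ _)) identityʳ)

  -- Restricting a downward abstraction to variables

  module Downward (D : CounterfactualDownward L H) where
    open CounterfactualDownward D public
    module π = Functor π
    module τ = NaturalTransformation τ

    var-distinct : ∀ x → Distinct (π-var x)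
    var-distinct x = distinct-factor π-var (at (∈-elems⁺ {S = ⁅ x ⁆} (x∈⁅x⁆ x))) (sets ⁅ x ⁆)

    gather : ∀ x → Rewiring (π-var x) (⨂ (elems (π-set x)))
    gather x = by-name (vars-elems (π-set x))

    scatter : ∀ x → Rewiring (⨂ (elems (π-set x))) (π-var x)
    scatter x = by-name (sym (vars-elems (π-set x)))

    onVariables : OnVariables L H
    onVariables = restrictToVariables L H D
    module a = OnVariables onVariables

    a-τ : ∀ x → a.τ x ≈ τ.η (var x) ∘ wire _ _ (scatter x)
    a-τ x = refl⟩∘⟨ ≈-reflexive (L-wire≡wire (⨂ (elems (π-set x))) (π-var x) (scatter x))

    a-τ-gather : ∀ x → a.τ x ∘ wire _ _ (gather x) ≈ τ.η (var x)
    a-τ-gather x = ≈.trans (a-τ x ⟩∘⟨refl) (cancelʳ (wire-inverse-distinct (var-distinct x)))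

    η-⊗ : ∀ A B → τ.η (A ⊗ B) ∘ ⟦ π.μ ⟧₁ ≈ τ.η A ⊗₁ τ.η B
    η-⊗ A B = ≈.trans (refl⟩∘⟨ ≈.sym identityʳ) (≈.trans (τ.monoidal-⊗ {A} {B}) identityˡ)

    η-components : ∀ A → t⨂ π-var (λ x → τ.η (var x)) A ∘ ⟦ unpack π A ⟧₁ ≈ τ.η A
    η-components = η-unpack π τ.η η-⊗

    η-deterministic : ∀ x → Deterministic (τ.η (var x))
    η-deterministic x = τ.deterministic (var x)

    sendsBlocks : {g : VH → Subset L.size} (g-sets : ∀ x → π-set x ≡ g x) (q : CFQuery H.size) →
                  SendsBlocks π sets (imageBlocks π-var g-sets (CFQuery.Xs q))
                                     (imageBlocks π-var g-sets (CFQuery.Ys q))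
    sendsBlocks g-sets q = proj₁ (sends-arrangeAll π sets g-sets q) (on-queries q)

    -- `sets` at the set of just `x` and `y` rules out a common variable, which would occur twice.
    disjoint : ∀ {x y} → x ≢ y → Empty (π-set x ∩ π-set y)
    disjoint {x} {y} x≢y (z , z∈) =
      x≢y (distinct-factors π-var {A = ⨂ (elems xy)} (sets xy)
        (at (∈-elems⁺ {S = xy} (x∈p∪q⁺ (inj₁ (x∈⁅x⁆ x)))))
        (at (∈-elems⁺ {S = xy} (x∈p∪q⁺ {p = ⁅ x ⁆} (inj₂ (x∈⁅x⁆ y)))))
        (∈-vars⁻ (proj₁ (x∈p∩q⁻ (π-set x) (π-set y) z∈))) (∈-vars⁻ (proj₂ (x∈p∩q⁻ (π-set x) (π-set y) z∈))))
      where xy = ⁅ x ⁆ ∪ ⁅ y ⁆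

    -- The epic component of `τ` at `A` factors as `a.τ⨂ A` after `rest`, and the last factor of an
    -- epic composite is epic.
    epic : ∀ A → Epic (a.τ⨂ A)
    epic A g h p = τ-epic A g h (≈.trans (refl⟩∘⟨ η≈) (≈.trans (extend p) (refl⟩∘⟨ ≈.sym η≈)))
      where
      rest : L.⟦ π.F₀ A ⟧ ⇒ L.⟦ bind a.π-obj A ⟧
      rest = wire _ _ (mapBind gather A) ∘ ⟦ unpack π A ⟧₁

      η≈ : τ.η A ≈ a.τ⨂ A ∘ rest
      η≈ = ≈.sym (≈.trans (pullˡ (τ⨂-wire onVariables _ _ gather a-τ-gather A)) (η-components A))

      extend : g ∘ a.τ⨂ A ≈ h ∘ a.τ⨂ A → g ∘ (a.τ⨂ A ∘ rest) ≈ h ∘ (a.τ⨂ A ∘ rest)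
      extend p = ≈.trans (pullˡ p) assoc

    abstraction : CounterfactualAbstraction L H
    abstraction = record
      { onVariables   = onVariables
      ; disjoint      = disjoint
      ; deterministic = λ x → Deterministic-resp-≈ (≈.sym (a-τ x))
                                (∘-deterministic (η-deterministic x) wire-deterministic)
      ; epic          = epic
      ; consistent    = λ q → natural⇒consistent π τ.η η-⊗ onVariables η-deterministic sets gather a-τ-gather
                                (imageBlocks π-var (λ _ → refl) _) (imageBlocks π-var (λ _ → refl) _)
                                (sendsBlocks (λ _ → refl) q) (τ.natural (SH.gen q))
      }

  restrict : CounterfactualDownward L H → CounterfactualAbstraction L H
  restrict D = Downward.abstraction D

  -- Restriction preserves and reflects equality of abstractions

  module _ (D D′ : CounterfactualDownward L H) where
    private
      module D  = Downward D
      module D′ = Downward D′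

    module _ (same-sets : ∀ x → D.π-set x ≡ D′.π-set x) where
      private
        s : ∀ x → Rewiring (D.π-var x) (D′.π-var x)
        s x = by-name (sym (same-sets x))

        s⁻¹ : ∀ x → Rewiring (D′.π-var x) (D.π-var x)
        s⁻¹ x = by-name (same-sets x)

        swap : ∀ x → Rewiring (⨂ (elems (D′.π-set x))) (⨂ (elems (D.π-set x)))
        swap x = by-name (cong (λ S → vars (⨂ (elems S))) (same-sets x))

      -- The two conditions differ by wires out of objects with distinct factors, and any two such
      -- wires with the same target agree. The converse below holds for the same reason.
      components⇒τ : ∀ x → D′.τ.η (var x) ∘ wire _ _ (s x) ≈ D.τ.η (var x) →
        subst (λ S → L.⟦ ⨂ (elems S) ⟧ ⇒ H.X x) (same-sets x) (D.a.τ x) ≈ D′.a.τ x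
      components⇒τ x p = begin
        subst (λ S → L.⟦ ⨂ (elems S) ⟧ ⇒ H.X x) (same-sets x) (D.a.τ x)
          ≈⟨ subst-wire (same-sets x) (swap x) _ ⟩
        D.a.τ x ∘ wire _ _ (swap x)                                       ≈⟨ D.a-τ x ⟩∘⟨refl ⟩
        (D.τ.η (var x) ∘ wire _ _ (D.scatter x)) ∘ wire _ _ (swap x)
          ≈⟨ pullʳ (wire-∘-distinct (elems-distinct (D′.π-set x))) ⟩
        D.τ.η (var x) ∘ wire _ _ (λ y i → swap x y (D.scatter x y i))     ≈⟨ p ⟩∘⟨refl ⟨
        (D′.τ.η (var x) ∘ wire _ _ (s x)) ∘ wire _ _ (λ y i → swap x y (D.scatter x y i))
          ≈⟨ pullʳ (wire-∘-distinct (elems-distinct (D′.π-set x))) ⟩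
        D′.τ.η (var x) ∘ wire _ _ (D′.scatter x)                       ≈⟨ D′.a-τ x ⟨
        D′.a.τ x                                                       ∎

      τ⇒components : ∀ x →
        subst (λ S → L.⟦ ⨂ (elems S) ⟧ ⇒ H.X x) (same-sets x) (D.a.τ x) ≈ D′.a.τ x →
        D′.τ.η (var x) ∘ wire _ _ (s x) ≈ D.τ.η (var x)
      τ⇒components x p = begin
        D′.τ.η (var x) ∘ wire _ _ (s x)                                ≈⟨ D′.a-τ-gather x ⟩∘⟨refl ⟨
        (D′.a.τ x ∘ wire _ _ (D′.gather x)) ∘ wire _ _ (s x)
          ≈⟨ pullʳ (wire-∘-distinct (D.var-distinct x)) ⟩
        D′.a.τ x ∘ wire _ _ (λ y i → s x y (D′.gather x y i))
          ≈⟨ ≈.trans (≈.sym p) (subst-wire (same-sets x) (swap x) _) ⟩∘⟨refl ⟩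
        (D.a.τ x ∘ wire _ _ (swap x)) ∘ wire _ _ (λ y i → s x y (D′.gather x y i))
          ≈⟨ pullʳ (wire-∘-distinct (D.var-distinct x)) ⟩
        D.a.τ x ∘ wire _ _ (D.gather x)                                ≈⟨ D.a-τ-gather x ⟩
        D.τ.η (var x)                                                  ∎

      private
        module C   = Comparison D.π D′.π D.sets D′.sets s
        module C⁻¹ = Comparison D′.π D.π D′.sets D.sets s⁻¹
        module CI = TransformationInverse D.π D′.π
          (λ x → W.wire-inverse-distinct (D.var-distinct x) {s x} {s⁻¹ x})
        module CI⁻¹ = TransformationInverse D′.π D.π
          (λ x → W.wire-inverse-distinct (D′.var-distinct x) {s⁻¹ x} {s x})

        gen-natural : ∀ q → C.Natural (SH.gen q)
        gen-natural q = C.θ-gen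
          (imageBlocks D.π-var (λ _ → refl) _) (imageBlocks D.π-var (λ _ → refl) _)
          -- The blocks of `D′` are taken over the sets of `D`, so that both functors send the query
          -- to the same generator.
          (imageBlocks D′.π-var (λ x → sym (same-sets x)) _) (imageBlocks D′.π-var (λ x → sym (same-sets x)) _)
          (D.sendsBlocks (λ _ → refl) q) (D′.sendsBlocks (λ x → sym (same-sets x)) q)

      comparison : NaturalIsomorphism D.π D′.π
      comparison = record
        { transformation = C.transformation (λ x → W.wire-deterministic _ (s x)) gen-natural
        ; η⁻¹  = C⁻¹.θ
        ; isoˡ = CI.θ-inverse
        ; isoʳ = CI⁻¹.θ-inverse
        }

      -- Unpacking turns `D′.τ` into the tensor product of its components, and the comparison into
      -- the wire that applies `s` in each factor, so agreement at variables suffices.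
      comparison-τ : (∀ x → D′.τ.η (var x) ∘ wire _ _ (s x) ≈ D.τ.η (var x)) →
                     ∀ A → D′.τ.η A ∘ ⟦ C.θ A ⟧₁ ≈ D.τ.η A
      comparison-τ p A = begin
        D′.τ.η A ∘ ⟦ C.θ A ⟧₁                                        ≈⟨ D′.η-components A ⟩∘⟨refl ⟨
        (t⨂ _ _ A ∘ ⟦ unpack D′.π A ⟧₁) ∘ ⟦ C.θ A ⟧₁                 ≈⟨ pullʳ (⟦⟧-resp-≈ (C.θ-unpack A)) ⟩
        t⨂ _ _ A ∘ (⟦ wireᴸ _ _ (mapBind s A) ⟧₁ ∘ ⟦ unpack D.π A ⟧₁)
          ≈⟨ refl⟩∘⟨ (≈-reflexive (⟦wireᴸ⟧≡wire _ _ (mapBind s A)) ⟩∘⟨refl) ⟩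
        t⨂ _ _ A ∘ (wire _ _ (mapBind s A) ∘ ⟦ unpack D.π A ⟧₁)      ≈⟨ pullˡ (t⨂-mapBind s p A) ⟩
        t⨂ _ _ A ∘ ⟦ unpack D.π A ⟧₁                                 ≈⟨ D.η-components A ⟩
        D.τ.η A                                                      ∎

    restrict-injective : _≈ᴬ_ L H (restrict D) (restrict D′) → _≈ᴰ_ L H D D′
    restrict-injective p = record
      { same-sets = same-π
      ; θ         = comparison same-π
      -- By definition, the comparison at a variable is the wire matching names.
      ; θ-var     = λ x → S.≈-refl
      ; θ-τ       = comparison-τ same-π (λ x → τ⇒components same-π x (same-τ x))
      }
      where open _≈ⱽ_ p

    restrict-cong : _≈ᴰ_ L H D D′ → _≈ᴬ_ L H (restrict D) (restrict D′)
    restrict-cong p = record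
      { same-π = same-sets
      ; same-τ = λ x → components⇒τ same-sets x (≈.trans
          (refl⟩∘⟨ ≈.trans (≈-reflexive (sym (⟦wireᴸ⟧≡wire _ _ _))) (≈.sym (⟦⟧-resp-≈ (θ-var x))))
          (θ-τ (var x)))
      }
      where open _≈ᴰ_ p

  -- Extending a counterfactual abstraction to all queries

  module Extension (A : CounterfactualAbstraction L H) where
    private
      module A = CounterfactualAbstraction A
      module WA = Wiring (Free ΣL) A.π-obj

    distinct : ∀ S → Distinct (bind A.π-obj (⨂ (elems S)))
    distinct S = bind-distinct A.π-obj (λ x → elems-distinct (A.π x)) separate
      (filter⁺ (_∈? S) (allFin⁺ H.size))
      where
      separate : ∀ {x x′ y} → y ∈ᵗ A.π-obj x → y ∈ᵗ A.π-obj x′ → x ≡ x′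
      separate {x} {x′} i i′ with x Fin.≟ x′
      ... | yes p = p
      ... | no  p = ⊥-elim (A.disjoint p (_ , x∈p∩q⁺ (∈-elems⁻ (at⁻¹ i) , ∈-elems⁻ (at⁻¹ i′))))

    blocks : ∀ {m} (Ss : Vec (Subset H.size) m) → Pointwise (Block A.π-obj) Ss (Vec.map (image A.π) Ss)
    blocks = imageBlocks A.π-obj (λ x → vars-elems (A.π x))

    arr : ∀ {m} (Ss : Vec (Subset H.size) m) →
          Arrangement (bind A.π-obj (⨂ (concatElems Ss))) (⨂ (concatElems (Vec.map (image A.π) Ss)))
    arr Ss = arrangeBlocks A.π-obj distinct (blocks Ss)

    -- `WA.⟦_⟧` and `bind A.π-obj` have the same clauses but are different functions, not
    -- definitionally equal at an open term; this is the identity between their values.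
    flatten : ∀ B → WA.⟦ B ⟧ S.⇒ bind A.π-obj B
    flatten I       = S.id
    flatten (var x) = S.id
    flatten (B ⊗ C) = flatten B S.⊗₁ flatten C

    unflatten : ∀ B → bind A.π-obj B S.⇒ WA.⟦ B ⟧
    unflatten I       = S.id
    unflatten (var x) = S.id
    unflatten (B ⊗ C) = unflatten B S.⊗₁ unflatten C

    flatten-unflatten : ∀ B → flatten B S.∘ unflatten B S.≈ S.id
    flatten-unflatten I       = S.identityˡ
    flatten-unflatten (var x) = S.identityˡ
    flatten-unflatten (B ⊗ C) = FLP.⊗-inverse (flatten-unflatten B) (flatten-unflatten C)

    -- The conjugation makes `sends` a matter of cancelling the permutation and the flattening on
    -- the outputs.
    queryImage : ∀ q → WA.⟦ ⨂ (concatElems (CFQuery.Xs q)) ⟧ S.⇒ WA.⟦ ⨂ (concatElems (CFQuery.Ys q)) ⟧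
    queryImage q = unflatten (⨂ (concatElems Ys)) S.∘ (wireᴸ _ _ (Arr.to (arr Ys)) S.∘
      (S.gen (mapQuery L H (image A.π) q) S.∘
        (wireᴸ _ _ (Arr.from (arr Xs)) S.∘ flatten (⨂ (concatElems Xs)))))
      where open CFQuery q

    π : Functor (Free ΣH) (Free ΣL)
    π = Extend.extend ΣH (Free ΣL) A.π-obj queryImage

    unpack≈flatten : ∀ B → unpack π B S.≈ flatten B
    unpack≈flatten I       = S.≈-refl
    unpack≈flatten (var x) = S.≈-refl
    unpack≈flatten (B ⊗ C) = S.≈-trans S.identityʳ (S.⊗-resp-≈ (unpack≈flatten B) (unpack≈flatten C))

    sends : ∀ q → SendsBlocks π distinct (blocks (CFQuery.Xs q)) (blocks (CFQuery.Ys q))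
    sends q =
      S.≈-trans (FLP.refl⟩∘⟨ S.≈-trans (unpack≈flatten Y FLP.⟩∘⟨refl) (FLP.cancelˡ (flatten-unflatten Y)))
      (S.≈-trans (FLP.cancelˡ (W.arrangement-isoˡ {A = πY} {B = bind A.π-obj Y} (Arr.symₐ (arr Ys))))
        (FLP.refl⟩∘⟨ (FLP.refl⟩∘⟨ S.≈-sym (unpack≈flatten (⨂ (concatElems Xs))))))
      where
      open CFQuery q
      Y  = ⨂ (concatElems Ys)
      πY = ⨂ (concatElems (Vec.map (image A.π) Ys))

    private
      module T = TransformationOnTypes (⟦L⟧ ∘F π) ⟦H⟧ A.τ

      -- The structure maps of `π` and of both models are identities; the factor `id` is `μ` of `π`
      -- interpreted in `L`.
      θ-⊗ : ∀ B C → T.θ (B ⊗ C) ∘ id ≈ T.θ B ⊗₁ T.θ C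
      θ-⊗ B C = ≈.trans (refl⟩∘⟨ ≈.sym identityʳ) (≈.trans (T.θ-⊗ {B} {C}) identityˡ)

      keep : ∀ x → Rewiring (A.π-obj x) (A.π-obj x)
      keep x y i = i

      τ-keep : ∀ x → A.τ x ∘ wire (A.π-obj x) (A.π-obj x) (keep x) ≈ A.τ x
      τ-keep x = ≈.trans (refl⟩∘⟨ wire-id (λ _ _ → refl)) identityʳ

      gen-natural : ∀ q → T.Natural (SH.gen q)
      gen-natural q = consistent⇒natural π T.θ θ-⊗ A.onVariables A.deterministic distinct keep τ-keep
        (blocks _) (blocks _) (sends q) (A.consistent q)

    -- The component is `A.τ⨂ B` after the isomorphism `unpack`, so it is epic because all tensor
    -- products of the given maps are.
    τ-epic : ∀ B → Epic (T.θ B)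
    τ-epic B = Epic-resp-≈
      (≈.trans (≈-reflexive (τ⨂≡t⨂ A.onVariables B) ⟩∘⟨refl) (η-unpack π T.θ θ-⊗ B))
      (∘-epic (A.epic B) (isoEpic (⟦⟧-resp-≈ (Unpacking.unpack-pack π B))))

    downward : CounterfactualDownward L H
    downward = record
      { downward = record
        { π         = π
        ; π-queries = λ q → _ , arr (CFQuery.Xs q) , arr (CFQuery.Ys q) , sends q
        ; τ         = T.transformation A.deterministic gen-natural
        ; τ-epic    = τ-epic
        }
      ; sets       = distinct
      ; on-queries = λ q → proj₂ (sends-arrangeAll π distinct (λ x → vars-elems (A.π x)) q) (sends q)
      }

    -- Restriction reads each set back off its list of elements, which `vars-elems` equates with the
    -- original set. The reordering inside the restricted map then cancels against this transport.
    restrict-downward : _≈ᴬ_ L H (restrict downward) A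
    restrict-downward = record
      { same-π = λ x → vars-elems (A.π x)
      ; same-τ = λ x → begin
          subst (λ S → L.⟦ ⨂ (elems S) ⟧ ⇒ H.X x) (vars-elems (A.π x)) (D.a.τ x)
            ≈⟨ subst-wire (vars-elems (A.π x)) (swap x) _ ⟩
          D.a.τ x ∘ wire _ _ (swap x)                         ≈⟨ D.a-τ x ⟩∘⟨refl ⟩
          (A.τ x ∘ wire _ _ (D.scatter x)) ∘ wire _ _ (swap x)
            ≈⟨ cancelʳ (wire-inverse-distinct (elems-distinct (A.π x))) ⟩
          A.τ x                                            ∎
      }
      where
      module D = Downward downward
      swap : ∀ x → Rewiring (⨂ (elems (A.π x))) (⨂ (elems (D.π-set x)))
      swap x = by-name (cong (λ S → vars (⨂ (elems S))) (vars-elems (A.π x)))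

  ≈ⱽ-trans : ∀ {a b c} → _≈ⱽ_ L H a b → _≈ⱽ_ L H b c → _≈ⱽ_ L H a c
  ≈ⱽ-trans p q = record
    { same-π = λ x → trans (P.same-π x) (Q.same-π x)
    ; same-τ = λ x → substs (P.same-π x) (Q.same-π x) (P.same-τ x) (Q.same-τ x)
    }
    where
    module P = _≈ⱽ_ p
    module Q = _≈ⱽ_ q
    substs : ∀ {X S S′ S″} (p : S ≡ S′) (q : S′ ≡ S″) {f : L.⟦ ⨂ (elems S) ⟧ ⇒ X} {g h} →
             subst (λ S → L.⟦ ⨂ (elems S) ⟧ ⇒ X) p f ≈ g →
             subst (λ S → L.⟦ ⨂ (elems S) ⟧ ⇒ X) q g ≈ h →
             subst (λ S → L.⟦ ⨂ (elems S) ⟧ ⇒ X) (trans p q) f ≈ h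
    substs refl refl = ≈.trans

proposition36 : {o ℓ e : Level} (𝒞 : MarkovCategory o ℓ e) (L H : FCM 𝒞) →
    Σ[ restrict ∈ (CounterfactualDownward L H → CounterfactualAbstraction L H) ]
    ( (∀ D → CounterfactualAbstraction.onVariables (restrict D) ≡ restrictToVariables L H D)
    × Congruent (_≈ᴰ_ L H) (_≈ᴬ_ L H) restrict
    × Bijective (_≈ᴰ_ L H) (_≈ᴬ_ L H) restrict )
proposition36 𝒞 L H =
  restrict , (λ D → refl) , (λ {D} {D′} → restrict-cong D D′) , (λ {D} {D′} → restrict-injective D D′) ,
  λ A → Extension.downward A ,
        -- Surjectivity is stated for every `D` equal to the chosen preimage, hence the use of
        -- `restrict-cong` and transitivity.
        λ {D} p → ≈ⱽ-trans (restrict-cong D (Extension.downward A) p) (Extension.restrict-downward A)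
  where open Abstractions 𝒞 L H
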